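{- The problem $\#\mathsf{OV}_{\mathbb{Z}_2}$ on $n+n$ vectors in dimension $d$ can be solved in time $\tilde O(n\cdot 1.36^d)$. Moreover, there are positive numbers $a_m=\Omega\!\left(\frac{1}{m^2\log m}\right)$ such that, for each fixed integer $m\ge 2$, the problem $\#\mathsf{OV}_{\mathbb{Z}_m}$ on $n+n$ vectors in dimension $d$ can be solved in time $\tilde O(n\cdot m^{(1/2-a_m)d})$.
   Context: In $\#\mathsf{OV}_{\mathbb{Z}_m}$ one is given $u_1,\dots,u_n,v_1,\dots,v_n\in\mathbb{Z}_m^d$ (where $\mathbb{Z}_m=\mathbb{Z}/m\mathbb{Z}$) and must output the number of pairs $(i,j)\in[n]\times[n]$ with $\langle u_i,v_j\rangle\equiv 0\pmod m$. $\tilde O$ hides factors polynomial in $d$ and $\log n$. -}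

module Defs where

open import Data.Bool using (if_then_else_)
open import Data.Fin using (Fin; toℕ)
open import Data.Integer using (ℤ; +_; -[1+_]; ∣_∣)
open import Data.List using (List; []; _∷_; _++_; allFin; cartesianProduct; filter; length)
open import Data.Nat using (ℕ; zero; suc; _+_; _*_; _∸_; _^_; _≤_; _≡ᵇ_; NonZero)
open import Data.Nat.Divisibility using (_∣?_)
open import Data.Nat.DivMod using (_/_)
open import Data.Nat.Logarithm using (⌊log₂_⌋)
open import Data.Product using (Σ; _×_; _,_)
open import Data.Rational.Unnormalised as ℚ using (ℚᵘ; ↥_; ↧ₙ_)
open import Data.Vec using (Vec; lookup; map; zipWith; sum; concat; toList)
open import Relation.Binary.PropositionalEquality using (_≡_)

-- Residues modulo m are represented by Fin m.

-- An integer representative of the inner product; only its class mod m matters.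
⟪_,_⟫ : ∀ {m d} → Vec (Fin m) d → Vec (Fin m) d → ℕ
⟪ u , v ⟫ = sum (zipWith (λ a b → toℕ a * toℕ b) u v)

#OV : ∀ m {n d} → Vec (Vec (Fin m) d) n → Vec (Vec (Fin m) d) n → ℕ
#OV m {n} us vs =
  length (filter (λ (i , j) → m ∣? ⟪ lookup us i , lookup vs j ⟫)
                 (cartesianProduct (allFin n) (allFin n)))

-- A random access machine with the logarithmic cost criterion of Aho, Hopcroft
-- and Ullman, programmed with structured control flow instead of jumps.  A
-- program mentions finitely many registers; memory is addressed indirectly.
-- Up to factors polynomial in the word length, this agrees with a word RAM
-- with words of polynomial length in log n and d on the time bounds below.

Reg : Set
Reg = ℕ

data Op : Set where
  add sub mul div : Op

⟦_⟧ : Op → ℕ → ℕ → ℕ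
⟦ add ⟧ x y       = x + y
⟦ sub ⟧ x y       = x ∸ y
⟦ mul ⟧ x y       = x * y
⟦ div ⟧ x zero    = zero
⟦ div ⟧ x (suc y) = x / suc y

infixr 5 _⨾_

data Program : Set where
  const : Reg → ℕ → Program
  arith : Op → Reg → Reg → Reg → Program   -- destination first
  load  : Reg → Reg → Program              -- x := M[y]
  store : Reg → Reg → Program              -- M[x] := y
  _⨾_   : Program → Program → Program
  ifNZ  : Reg → Program → Program → Program
  while : Reg → Program → Program

record State : Set where
  constructor ⟨_,_⟩
  field
    reg : ℕ → ℕ
    mem : ℕ → ℕ

open State public

_[_↦_] : (ℕ → ℕ) → ℕ → ℕ → (ℕ → ℕ)
(f [ x ↦ v ]) y = if x ≡ᵇ y then v else f y

-- The number of binary digits of x (one digit for 0).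
size : ℕ → ℕ
size x = suc ⌊log₂ x ⌋

-- p , s ⇓ s′ , t : started in s, p halts in s′ at cost t.
-- The relation is functional in (s′ , t).
data _,_⇓_,_ : Program → State → State → ℕ → Set where
  ⇓const : ∀ {r M x k} →
    const x k , ⟨ r , M ⟩ ⇓ ⟨ r [ x ↦ k ] , M ⟩ , size k
  ⇓arith : ∀ {r M o x y z} →
    arith o x y z , ⟨ r , M ⟩ ⇓ ⟨ r [ x ↦ ⟦ o ⟧ (r y) (r z) ] , M ⟩ ,
      (size (r y) + size (r z))
  ⇓load : ∀ {r M x y} →
    load x y , ⟨ r , M ⟩ ⇓ ⟨ r [ x ↦ M (r y) ] , M ⟩ ,
      (size (r y) + size (M (r y)))
  ⇓store : ∀ {r M x y} →
    store x y , ⟨ r , M ⟩ ⇓ ⟨ r , M [ r x ↦ r y ] ⟩ ,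
      (size (r x) + size (r y))
  ⇓seq : ∀ {p q s s′ s″ t t′} →
    p , s ⇓ s′ , t → q , s′ ⇓ s″ , t′ → (p ⨾ q) , s ⇓ s″ , (t + t′)
  ⇓if-nonzero : ∀ {x p q s s′ t} → NonZero (reg s x) →
    p , s ⇓ s′ , t → ifNZ x p q , s ⇓ s′ , (size (reg s x) + t)
  ⇓if-zero : ∀ {x p q s s′ t} → reg s x ≡ 0 →
    q , s ⇓ s′ , t → ifNZ x p q , s ⇓ s′ , (size (reg s x) + t)
  ⇓while-nonzero : ∀ {x p s s′ s″ t t′} → NonZero (reg s x) →
    p , s ⇓ s′ , t → while x p , s′ ⇓ s″ , t′ →
    while x p , s ⇓ s″ , (size (reg s x) + t + t′)
  ⇓while-zero : ∀ {x p s} → reg s x ≡ 0 →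
    while x p , s ⇓ s , size (reg s x)

contents : List ℕ → ℕ → ℕ
contents []       _       = 0
contents (x ∷ _)  zero    = x
contents (_ ∷ xs) (suc i) = contents xs i

flatten : ∀ {m n d} → Vec (Vec (Fin m) d) n → List ℕ
flatten us = toList (map toℕ (concat us))

-- Registers 0 and 1 hold n and d; memory holds u₁ , … , uₙ , v₁ , … , vₙ,
-- one coordinate per cell.  The answer is expected in register 0.
input : ∀ {m n d} → Vec (Vec (Fin m) d) n → Vec (Vec (Fin m) d) n → State
input {n = n} {d} us vs =
  ⟨ contents (n ∷ d ∷ []) , contents (flatten us ++ flatten vs) ⟩

-- The real inequality t ≤ A · bᵉ, for rational b > 0 and e, raised to the
-- power of the denominator of e and cleared of the denominators of b.
_≤_·_^ʳ_ : ℕ → ℕ → ℚᵘ → ℚᵘ → Set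
t ≤ A · b ^ʳ e = cleared (↥ e)
  where
  q = ↧ₙ e
  N = ∣ ↥ b ∣
  D = ↧ₙ b
  cleared : ℤ → Set
  cleared (+ k)    = t ^ q * D ^ k ≤ A ^ q * N ^ k
  cleared -[1+ k ] = t ^ q * N ^ suc k ≤ A ^ q * D ^ suc k

fromℕ : ℕ → ℚᵘ
fromℕ n = + n ℚ./ 1

-- #OV over ℤ/m is solvable in time Õ(n · b^(e d)), for b > 0, the hidden factor
-- being C (1 + d + log n)^k.  Rounding log n down only makes this stronger.
-- The program, C and k may depend on m, b and e but not on n and d.
#OV-SolvableInÕ[n·_^[_·d]] : ℚᵘ → ℚᵘ → ℕ → Set
#OV-SolvableInÕ[n· b ^[ e ·d]] m =
  Σ Program λ p → Σ ℕ λ C → Σ ℕ λ k →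
  ∀ n d .{{_ : NonZero n}} (us vs : Vec (Vec (Fin m) d) n) →
  Σ State λ s → Σ ℕ λ t →
    (p , input us vs ⇓ s , t)
    × reg s 0 ≡ #OV m us vs
    × t ≤ (C * (1 + d + ⌊log₂ n ⌋) ^ k * n) · b ^ʳ (e ℚ.* fromℕ d)

-- a(m) = Ω(1 / (m² log m)) over m ≥ 2.  Rounding log₂ m (≥ 1) down changes it by
-- a factor of at most 2, and in the direction that strengthens the claim.
IsΩ[1/m²logm] : (ℕ → ℚᵘ) → Set
IsΩ[1/m²logm] a =
  Σ ℚᵘ λ c → ℚ.0ℚᵘ ℚ.< c
    × (∀ m → 2 ≤ m → c ℚ.≤ a m ℚ.* fromℕ (m ^ 2 * ⌊log₂ m ⌋))

{-# OPTIONS --safe #-}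
module Submission where

-- Over the group ring ℤ[x]/(x^m − 1), take the matrix x^⟨u,v⟩ indexed by blocks
-- u, v of six coordinates.  It is the rank one matrix x^(−Q(u)−Q(v)), where
-- Q(w) = w₁w₂ + w₃w₄ + w₅w₆, plus a matrix with at most s entries in every row
-- and column: s = 28 for m = 2, and s = m⁶ − m⁴ in general.  In the Kronecker
-- power choose one of the two summands in each block, and enumerate the entries
-- of the chosen sparse factors alternately from the side of u and from the side
-- of v.  This writes x^⟨u,v⟩ as a sum over the common ends of paths starting at
-- u and at v, with about 1 + √s < m³ paths per block on either side.  So the sum
-- of x^⟨uᵢ,vⱼ⟩ is found by storing the paths of all uᵢ by their ends and looking
-- up those of all vⱼ.  Replacing x by an integer X > n² + 1, and calculating
-- modulo X^m − 1, its constant coefficient is the last digit in radix X.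

open import Defs
open import Data.Bool using (Bool; true; false; if_then_else_; _∧_; _∨_; T)
open import Data.Fin using (Fin; zero; suc; toℕ; fromℕ<)
open import Data.Fin.Properties using (toℕ-fromℕ<; toℕ<n; fromℕ<-toℕ; fromℕ<-cong; all?)
open import Data.List using (List; []; _∷_; _++_; length; filter; concatMap; cartesianProduct; allFin; tabulate)
import Data.List as List
open import Data.List.Properties using (length-++; length-map; length-tabulate)
open import Data.List.Relation.Binary.Pointwise using (Pointwise; []; _∷_)
open import Data.List.Relation.Unary.All as All using (All; []; _∷_)
import Data.List.Relation.Unary.All.Properties as All
open import Data.Nat hiding (compare)
open import Data.Nat.Divisibility
open import Data.Nat.DivMod hiding (_div_; _mod_; result)
open import Data.Nat.Induction using (<-wellFounded)
open import Data.Nat.ListAction using (sum)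
open import Data.Nat.Logarithm
open import Data.Nat.Properties
open import Data.Nat.Tactic.RingSolver using (solve-∀)
open import Data.Product using (Σ; _×_; _,_; proj₁; proj₂)
open import Data.Unit using (⊤; tt)
open import Data.Vec as Vec using (Vec; []; _∷_; lookup; toList)
open import Induction.WellFounded using (Acc; acc)
open import Relation.Binary.PropositionalEquality
open import Relation.Nullary using (¬_; Dec; yes; no; contradiction)
open import Relation.Nullary.Decidable using (¬?; does; toWitness)

-- Finite sums and digits

-- Why six coordinates: with j pairs, the bound s = m^(2j) - m^(2j-2) gives 1 + √s ≈ m^j + 1 -
-- m^(j-2)/2, which exceeds m^j for j = 1, 2 and falls below it for j = 3. For m = 2 and the exact
-- s, the base (1 + √s)^(1/2j) is about 1.414, 1.363, 1.359, 1.364 for j = 1, 2, 3, 4, so j = 3 is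
-- also the choice that beats 1.36. The number of paths after a few blocks depends on which summands
-- were chosen, whereas a loop wants a fixed number of alternatives. So K blocks are merged into one
-- letter of the machine. The path lists of a letter have constant length, are padded with paths of
-- weight zero to a common width, and are written into the program as a table; the machine only
-- forms the Kronecker power of that table. Per letter this loses a constant factor over (1 + √s)^K.
-- The target rates are larger than the true ones by a strict margin, so a large constant K makes up
-- for the loss. Weights are natural numbers and are reduced modulo X^m - 1 only once, at the very
-- end. Until then their bit length is at most quadratic in 1 + d + log n, which the hidden factor
-- can afford.

∑ : ℕ → (ℕ → ℕ) → ℕ
∑ zero    f = 0
∑ (suc n) f = f n + ∑ n f

∑-cong : ∀ n {f g} → (∀ i → i < n → f i ≡ g i) → ∑ n f ≡ ∑ n g
∑-cong zero    h = refl
∑-cong (suc n) h = cong₂ _+_ (h n ≤-refl) (∑-cong n λ i p → h i (m≤n⇒m≤1+n p))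

∑-mono : ∀ n {f g} → (∀ i → i < n → f i ≤ g i) → ∑ n f ≤ ∑ n g
∑-mono zero    h = z≤n
∑-mono (suc n) h = +-mono-≤ (h n ≤-refl) (∑-mono n λ i p → h i (m≤n⇒m≤1+n p))

∑-const : ∀ n c → ∑ n (λ _ → c) ≡ n * c
∑-const zero    c = refl
∑-const (suc n) c = cong (c +_) (∑-const n c)

∑-≤ : ∀ n {f} c → (∀ i → i < n → f i ≤ c) → ∑ n f ≤ n * c
∑-≤ n c h = ≤-trans (∑-mono n h) (≤-reflexive (∑-const n c))

∑-zero : ∀ n {f} → (∀ i → i < n → f i ≡ 0) → ∑ n f ≡ 0
∑-zero n h = trans (∑-cong n h) (trans (∑-const n 0) (*-zeroʳ n))

+-interchange : ∀ a b c d → (a + b) + (c + d) ≡ (a + c) + (b + d)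
+-interchange = solve-∀

∑-+ : ∀ n f g → ∑ n (λ i → f i + g i) ≡ ∑ n f + ∑ n g
∑-+ zero    f g = refl
∑-+ (suc n) f g = trans (cong (f n + g n +_) (∑-+ n f g)) (+-interchange (f n) (g n) (∑ n f) (∑ n g))

∑-*ˡ : ∀ n c f → ∑ n (λ i → c * f i) ≡ c * ∑ n f
∑-*ˡ zero    c f = sym (*-zeroʳ c)
∑-*ˡ (suc n) c f = trans (cong (c * f n +_) (∑-*ˡ n c f)) (sym (*-distribˡ-+ c (f n) (∑ n f)))

∑-*ʳ : ∀ n c f → ∑ n (λ i → f i * c) ≡ ∑ n f * c
∑-*ʳ n c f = trans (∑-cong n λ i _ → *-comm (f i) c) (trans (∑-*ˡ n c f) (*-comm c (∑ n f)))

∑-swap : ∀ n k (f : ℕ → ℕ → ℕ) → ∑ n (λ i → ∑ k (f i)) ≡ ∑ k (λ j → ∑ n (λ i → f i j))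
∑-swap zero    k f = sym (∑-zero k λ _ _ → refl)
∑-swap (suc n) k f = trans (cong (∑ k (f n) +_) (∑-swap n k f)) (sym (∑-+ k (f n) _))

∑-split : ∀ r k f → ∑ (r + k) f ≡ ∑ r (λ x → f (x + k)) + ∑ k f
∑-split zero    k f = refl
∑-split (suc r) k f = trans (cong (f (r + k) +_) (∑-split r k f)) (sym (+-assoc (f (r + k)) _ _))

digit-% : ∀ {x r} q .{{_ : NonZero r}} → x < r → (x + q * r) % r ≡ x
digit-% {x} {r} q h = trans ([m+kn]%n≡m%n x q r) (m<n⇒m%n≡m h)

digit-/ : ∀ {x r} q .{{_ : NonZero r}} → x < r → (x + q * r) / r ≡ q
digit-/ {x} {r} q h = *-cancelʳ-≡ _ _ r (+-cancelˡ-≡ x _ _ (begin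
  x + (x + q * r) / r * r                  ≡⟨ cong (_+ (x + q * r) / r * r) (sym (digit-% q h)) ⟩
  (x + q * r) % r + (x + q * r) / r * r    ≡⟨ sym (m≡m%n+[m/n]*n (x + q * r) r) ⟩
  x + q * r                                ∎))
  where open ≡-Reasoning

digit-< : ∀ {x q r n} → x < r → q < n → x + q * r < n * r
digit-< {x} {q} {r} x<r q<n = ≤-trans (+-monoˡ-≤ (q * r) x<r) (*-monoˡ-≤ r q<n)

∑-digits : ∀ n r .{{_ : NonZero r}} (f : ℕ → ℕ → ℕ) →
  ∑ (n * r) (λ c → f (c % r) (c / r)) ≡ ∑ n (λ q → ∑ r (λ x → f x q))
∑-digits zero    r f = refl
∑-digits (suc n) r f = trans (∑-split r (n * r) _) (cong₂ _+_
  (∑-cong r λ x h → cong₂ f (digit-% n h) (digit-/ n h)) (∑-digits n r f))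

δ : ℕ → ℕ → ℕ
δ a b = if a ≡ᵇ b then 1 else 0

δ-refl : ∀ a → δ a a ≡ 1
δ-refl zero    = refl
δ-refl (suc a) = δ-refl a

δ-≢ : ∀ a b → a ≢ b → δ a b ≡ 0
δ-≢ a b h with a ≡ᵇ b in eq
... | true  = contradiction (≡ᵇ⇒≡ a b (subst T (sym eq) tt)) h
... | false = refl

δ-sym : ∀ a b → δ a b ≡ δ b a
δ-sym a b with a ≟ b
... | yes refl = refl
... | no  h    = trans (δ-≢ a b h) (sym (δ-≢ b a λ e → h (sym e)))

δ≤1 : ∀ a b → δ a b ≤ 1
δ≤1 a b with a ≡ᵇ b
... | true  = ≤-refl
... | false = z≤n

-- Digit expansions are unique, so two numbers are equal exactly when their digits are. As a product
-- of Kronecker deltas, this lets sums over matching codes factor block by block.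
δ-digit : ∀ {x y r} p q .{{_ : NonZero r}} → x < r → y < r →
  δ (x + p * r) (y + q * r) ≡ δ x y * δ p q
δ-digit {x} {y} {r} p q hx hy with x ≟ y | p ≟ q
... | yes refl | yes refl = trans (δ-refl (x + p * r)) (sym (cong₂ _*_ (δ-refl x) (δ-refl p)))
... | no h     | _        = trans
  (δ-≢ _ _ λ e → h (trans (sym (digit-% p hx)) (trans (cong (_% r) e) (digit-% q hy))))
  (sym (cong (_* δ p q) (δ-≢ x y h)))
... | yes _    | no h     = trans
  (δ-≢ _ _ λ e → h (trans (sym (digit-/ p hx)) (trans (cong (_/ r) e) (digit-/ q hy))))
  (sym (trans (cong (δ x y *_) (δ-≢ p q h)) (*-zeroʳ (δ x y))))

-- Binary size

2^log≤ : ∀ x → Acc _<_ x → 0 < x → 2 ^ ⌊log₂ x ⌋ ≤ x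
2^log≤ 1 _ _ = ≤-refl
2^log≤ x@(suc (suc y)) (acc rec) _ = begin
  2 ^ ⌊log₂ x ⌋                ≡⟨ cong (2 ^_) (sym (m+[n∸m]≡n (⌊log₂⌋-mono-≤ {2} {x} (s≤s (s≤s z≤n))))) ⟩
  2 ^ (1 + (⌊log₂ x ⌋ ∸ 1))    ≡⟨ cong (λ e → 2 * 2 ^ e) (sym (⌊log₂⌊n/2⌋⌋≡⌊log₂n⌋∸1 x)) ⟩
  2 * 2 ^ ⌊log₂ ⌊ x /2⌋ ⌋      ≤⟨ *-monoʳ-≤ 2 (2^log≤ ⌊ x /2⌋ (rec (⌊n/2⌋<n (suc y))) (s≤s z≤n)) ⟩
  2 * ⌊ x /2⌋                  ≡⟨ cong (⌊ x /2⌋ +_) (+-identityʳ ⌊ x /2⌋) ⟩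
  ⌊ x /2⌋ + ⌊ x /2⌋            ≤⟨ +-monoʳ-≤ ⌊ x /2⌋ (⌊n/2⌋≤⌈n/2⌉ x) ⟩
  ⌊ x /2⌋ + ⌈ x /2⌉            ≡⟨ ⌊n/2⌋+⌈n/2⌉≡n x ⟩
  x                            ∎
  where open ≤-Reasoning

2^⌊log₂⌋≤ : ∀ x → 0 < x → 2 ^ ⌊log₂ x ⌋ ≤ x
2^⌊log₂⌋≤ x = 2^log≤ x (<-wellFounded x)

<2^size : ∀ x → x < 2 ^ size x
<2^size x = ≰⇒> λ h → 1+n≰n (≤-trans (≤-reflexive (sym (⌊log₂[2^n]⌋≡n (size x)))) (⌊log₂⌋-mono-≤ h))

size-< : ∀ {x k} → x < 2 ^ k → 1 ≤ k → size x ≤ k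
size-< {zero}  h p = p
size-< {suc x} h p = ≰⇒> λ q → <⇒≱ h (≤-trans (^-monoʳ-≤ 2 q) (2^⌊log₂⌋≤ (suc x) (s≤s z≤n)))

size-mono : ∀ {x y} → x ≤ y → size x ≤ size y
size-mono h = s≤s (⌊log₂⌋-mono-≤ h)

size≥1 : ∀ x → 1 ≤ size x
size≥1 x = s≤s z≤n

size-* : ∀ x y → size (x * y) ≤ size x + size y
size-* x y = size-< {x * y} (subst (x * y <_) (sym (^-distribˡ-+-* 2 (size x) (size y)))
  (≤-trans (s≤s (*-monoʳ-≤ x (<⇒≤ (<2^size y))))
           (*-monoˡ-< (2 ^ size y) {{m^n≢0 2 (size y)}} (<2^size x)))) (s≤s z≤n)

-- For positive x and y, (x - 1)(y - 1) ≥ 0 bounds the sum by xy + 1, which is still below 2^(size x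
-- + size y). Sums can thus be charged like products, as `weight` does.
size-+ : ∀ x y → size (x + y) ≤ size x + size y
size-+ zero    y       = m≤n+m (size y) 1
size-+ x@(suc _) zero  = ≤-trans (≤-reflexive (cong size (+-identityʳ x))) (m≤m+n (size x) 1)
size-+ (suc x) (suc y) = ≤-trans (size-mono {suc x + suc y} {suc x * suc y + 1} (lem x y)) (size-+1 (suc x) (suc y))
  where
  lem : ∀ x y → suc x + suc y ≤ suc x * suc y + 1
  lem x y = ≤-trans (m≤m+n (suc x + suc y) (x * y)) (≤-reflexive (ring x y))
    where
    ring : ∀ x y → suc x + suc y + x * y ≡ suc x * suc y + 1
    ring = solve-∀
  size-+1 : ∀ x y → size (x * y + 1) ≤ size x + size y
  size-+1 x y = size-< {x * y + 1} (subst (_< 2 ^ (size x + size y)) (+-comm 1 (x * y))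
    (subst (suc (x * y) <_) (sym (^-distribˡ-+-* 2 (size x) (size y))) (h {x} {y} {2 ^ ⌊log₂ x ⌋} {2 ^ ⌊log₂ y ⌋} (<2^size x) (<2^size y)))) (s≤s z≤n)
    where
    h : ∀ {x y a b} → x < 2 * a → y < 2 * b → suc (x * y) < 2 * a * (2 * b)
    h {x} {y} {zero}  {b}     () q
    h {x} {y} {suc a} {zero}  p ()
    h {x} {y} {suc a} {suc b} p q = ≤-trans (s≤s (s≤s (*-mono-≤ (≤-pred p) (≤-pred q))))
      (≤-trans (m≤m+n _ (2 * a + 2 * b + 1)) (≤-reflexive (ring a b)))
      where
      ring : ∀ a b → suc (suc ((a + suc (a + 0)) * (b + suc (b + 0)))) + (2 * a + 2 * b + 1) ≡ 2 * suc a * (2 * suc b)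
      ring = solve-∀

size-^ : ∀ x k → size (x ^ k) ≤ suc (k * size x)
size-^ x zero    = ≤-refl
size-^ x (suc k) = ≤-trans (size-* x (x ^ k))
  (≤-trans (+-monoʳ-≤ (size x) (size-^ x k)) (≤-reflexive (+-suc (size x) (k * size x))))

-- Saves the additive one of `size-^`: a number below U ^ e then costs at most e units, a unit being
-- at least `size U`.
size-^⁺ : ∀ x k → 1 ≤ k → size (x ^ k) ≤ k * size x
size-^⁺ x 1 _ = ≤-trans (≤-reflexive (cong size (*-identityʳ x))) (m≤m+n (size x) 0)
size-^⁺ x (suc (suc k)) _ = ≤-trans (size-* x (x ^ suc k)) (+-monoʳ-≤ (size x) (size-^⁺ x (suc k) (s≤s z≤n)))

^⁺≥ : ∀ U e → 2 ≤ U → 1 ≤ e → 2 ≤ U ^ e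
^⁺≥ U (suc e) h _ = ≤-trans h (m≤m*n U (U ^ e) {{m^n≢0 U e {{>-nonZero (≤-trans (s≤s z≤n) h)}}}})

+≤* : ∀ a b → 2 ≤ a → 2 ≤ b → a + b ≤ a * b
+≤* (suc (suc a)) (suc (suc b)) (s≤s (s≤s z≤n)) (s≤s (s≤s z≤n)) =
  ≤-trans (m≤m+n _ (a * b + a + b)) (≤-reflexive (ring a b))
  where
  ring : ∀ a b → suc (suc a) + suc (suc b) + (a * b + a + b) ≡ suc (suc a) * suc (suc b)
  ring = solve-∀

-- Runs of programs

Run : Program → State → (State → Set) → ℕ → Set
Run p s Q c = Σ State λ s′ → Σ ℕ λ t → (p , s ⇓ s′ , t) × Q s′ × t ≤ c

writes : Program → Reg → Bool
writes (const x _)     y = x ≡ᵇ y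
writes (arith _ x _ _) y = x ≡ᵇ y
writes (load x _)      y = x ≡ᵇ y
writes (store _ _)     y = false
writes (p ⨾ q)         y = writes p y ∨ writes q y
writes (ifNZ _ p q)    y = writes p y ∨ writes q y
writes (while _ p)     y = writes p y

storeFree : Program → Bool
storeFree (store _ _)  = false
storeFree (p ⨾ q)      = storeFree p ∧ storeFree q
storeFree (ifNZ _ p q) = storeFree p ∧ storeFree q
storeFree (while _ p)  = storeFree p
storeFree _            = true

∨-false : ∀ {a b} → a ∨ b ≡ false → a ≡ false × b ≡ false
∨-false {false} {false} refl = refl , refl

∧-true : ∀ {a b} → a ∧ b ≡ true → a ≡ true × b ≡ true
∧-true {true} {true} refl = refl , refl

frame : ∀ {p s s′ t} → p , s ⇓ s′ , t → ∀ y → writes p y ≡ false → reg s′ y ≡ reg s y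
frame (⇓const {x = x}) y h rewrite h = refl
frame (⇓arith {x = x}) y h rewrite h = refl
frame (⇓load {x = x})  y h rewrite h = refl
frame ⇓store y h = refl
frame (⇓seq d e) y h = trans (frame e y (proj₂ (∨-false h))) (frame d y (proj₁ (∨-false h)))
frame (⇓if-nonzero _ d) y h = frame d y (proj₁ (∨-false h))
frame (⇓if-zero _ d) y h = frame d y (proj₂ (∨-false h))
frame (⇓while-nonzero _ d e) y h = trans (frame e y h) (frame d y h)
frame (⇓while-zero _) y h = refl

memFrame : ∀ {p s s′ t} → p , s ⇓ s′ , t → storeFree p ≡ true → mem s′ ≡ mem s
memFrame ⇓const h = refl
memFrame ⇓arith h = refl
memFrame ⇓load  h = refl
memFrame ⇓store ()
memFrame (⇓seq d e) h = trans (memFrame e (proj₂ (∧-true h))) (memFrame d (proj₁ (∧-true h)))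
memFrame (⇓if-nonzero _ d) h = memFrame d (proj₁ (∧-true h))
memFrame (⇓if-zero _ d) h = memFrame d (proj₂ (∧-true h))
memFrame (⇓while-nonzero _ d e) h = trans (memFrame e h) (memFrame d h)
memFrame (⇓while-zero _) h = refl

-- The continuation receives the frame facts of the first program. For concrete code `writes p y`
-- computes to `false`, so the value of an untouched register is recovered later with `refl`.
Run-seq : ∀ {p q s P Q a b} → Run p s P a → (∀ s′ → (∀ y → writes p y ≡ false → reg s′ y ≡ reg s y) →
  (storeFree p ≡ true → mem s′ ≡ mem s) → P s′ → Run q s′ Q b) → Run (p ⨾ q) s Q (a + b)
Run-seq (s′ , t , d , h , l) k with k s′ (frame d) (memFrame d) h
... | s″ , t′ , e , h′ , l′ = s″ , t + t′ , ⇓seq d e , h′ , +-mono-≤ l l′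

Run-weaken : ∀ {p s P Q a b} → (∀ s′ → (∀ y → writes p y ≡ false → reg s′ y ≡ reg s y) → P s′ → Q s′) → a ≤ b →
  Run p s P a → Run p s Q b
Run-weaken f l (s , t , d , h , l′) = s , t , d , f s (frame d) h , ≤-trans l′ l

-- Straight-line code without stores, costed by abstract interpretation: an
-- environment E records bounds U ^ E x on the registers, 0 standing for
-- "unknown".

exec : Program → (ℕ → ℕ) → (ℕ → ℕ) → (ℕ → ℕ)
exec (const x k)     M r = r [ x ↦ k ]
exec (arith o x y z) M r = r [ x ↦ ⟦ o ⟧ (r y) (r z) ]
exec (load x y)      M r = r [ x ↦ M (r y) ]
exec (p ⨾ q)         M r = exec q M (exec p M r)
exec _               M r = r

opExp : Op → ℕ → ℕ → ℕ
opExp add a b = a + b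
opExp mul a b = a + b
opExp sub a b = a
opExp div a b = a

post : Program → (ℕ → ℕ) → (ℕ → ℕ)
post (const x k)     E = E [ x ↦ 1 ]
post (arith o x y z) E = E [ x ↦ opExp o (E y) (E z) ]
post (load x y)      E = E [ x ↦ 1 ]
post (p ⨾ q)         E = post q (post p E)
post _               E = E

units : Program → (ℕ → ℕ) → ℕ
units (const x k)     E = 1
units (arith o x y z) E = E y + E z
units (load x y)      E = E y + 1
units (p ⨾ q)         E = units p E + units q (post p E)
units _               E = 0

known : (ℕ → ℕ) → Reg → Bool
known E y = 0 <ᵇ E y

checked : Program → (ℕ → ℕ) → Bool
checked (const x k)     E = true
checked (arith o x y z) E = known E y ∧ known E z
checked (load x y)      E = known E y
checked (p ⨾ q)         E = checked p E ∧ checked q (post p E)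
checked _               E = false

consts : Program → List ℕ
consts (const x k) = k ∷ []
consts (p ⨾ q)     = consts p ++ consts q
consts _           = []

live : List Reg → ℕ → ℕ
live []       _ = 0
live (x ∷ xs) = live xs [ x ↦ 1 ]

module Straight (U V : ℕ) (2≤U : 2 ≤ U) (U≤V : size U ≤ V) where

  Bounded : (ℕ → ℕ) → (ℕ → ℕ) → Set
  Bounded E r = ∀ x → 1 ≤ E x → r x ≤ U ^ E x

  bounded-set : ∀ {E r} x e v → Bounded E r → (1 ≤ e → v ≤ U ^ e) → Bounded (E [ x ↦ e ]) (r [ x ↦ v ])
  bounded-set x e v B h y with x ≡ᵇ y
  ... | true  = h
  ... | false = B y

  live-bounded : ∀ {r} xs → All (λ x → r x ≤ U) xs → Bounded (live xs) r
  live-bounded [] [] x ()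
  live-bounded (x ∷ xs) (h ∷ hs) y with x ≡ᵇ y in eq
  ... | true rewrite sym (≡ᵇ⇒≡ x y (subst T (sym eq) tt)) = λ _ → ≤-trans h (≤-reflexive (sym (*-identityʳ U)))
  ... | false = live-bounded xs hs y

  op-bound : ∀ o x y a b → 1 ≤ a → 1 ≤ b → x ≤ U ^ a → y ≤ U ^ b → ⟦ o ⟧ x y ≤ U ^ opExp o a b
  op-bound add x y a b p q hx hy = ≤-trans (+-mono-≤ hx hy)
    (≤-trans (+≤* (U ^ a) (U ^ b) (^⁺≥ U a 2≤U p) (^⁺≥ U b 2≤U q)) (≤-reflexive (sym (^-distribˡ-+-* U a b))))
  op-bound sub x y a b p q hx hy = ≤-trans (m∸n≤m x y) hx
  op-bound mul x y a b p q hx hy = ≤-trans (*-mono-≤ hx hy) (≤-reflexive (sym (^-distribˡ-+-* U a b)))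
  op-bound div x zero    a b p q hx hy = z≤n
  op-bound div x (suc y) a b p q hx hy = ≤-trans (m/n≤m x (suc y)) hx

  size-bound : ∀ x e → 1 ≤ e → x ≤ U ^ e → size x ≤ e * V
  size-bound x e p h = ≤-trans (size-mono h) (≤-trans (size-^⁺ U e p) (*-monoʳ-≤ e U≤V))

  known⇒ : ∀ E y → known E y ≡ true → 1 ≤ E y
  known⇒ E y h with E y
  ... | suc _ = s≤s z≤n

  -- With all loaded values and constants below U, each instruction keeps registers below fixed
  -- powers of U, so its cost is a fixed number of units V. `checked` and `units` evaluate on the
  -- program text, which reduces the cost analysis of a block to `refl` and bounds on its live
  -- registers.
  straight : ∀ p {E r M} → checked p E ≡ true → Bounded E r → All (_≤ U) (consts p) → (∀ a → M a ≤ U) →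
    Σ ℕ λ t → (p , ⟨ r , M ⟩ ⇓ ⟨ exec p M r , M ⟩ , t) × t ≤ units p E * V × Bounded (post p E) (exec p M r)
  straight (const x k) {E} {r} {M} _ B (h ∷ []) _ = _ , ⇓const ,
    ≤-trans (size-mono h) (≤-trans U≤V (m≤m+n V 0)) ,
    bounded-set {E} {r} x 1 k B (λ _ → ≤-trans h (≤-reflexive (sym (*-identityʳ U))))
  straight (arith o x y z) {E} {r} {M} c B _ _ =
    let cy = known⇒ E y (proj₁ (∧-true c)); cz = known⇒ E z (proj₂ (∧-true c)) in
    _ , ⇓arith ,
    ≤-trans (+-mono-≤ (size-bound _ _ cy (B y cy)) (size-bound _ _ cz (B z cz))) (≤-reflexive (sym (*-distribʳ-+ (V) (E y) (E z)))) ,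
    bounded-set {E} {r} x _ _ B (λ _ → op-bound o (r y) (r z) (E y) (E z) cy cz (B y cy) (B z cz))
  straight (load x y) {E} {r} {M} c B _ m =
    let cy = known⇒ E y c in
    _ , ⇓load ,
    ≤-trans (+-mono-≤ (size-bound _ _ cy (B y cy)) (size-bound _ 1 ≤-refl (≤-trans (m (r y)) (≤-reflexive (sym (*-identityʳ U)))))) (≤-reflexive (sym (*-distribʳ-+ (V) (E y) 1))) ,
    bounded-set {E} {r} x 1 _ B (λ _ → ≤-trans (m (r y)) (≤-reflexive (sym (*-identityʳ U))))
  straight (p ⨾ q) {E} {r} {M} c B k m with straight p (proj₁ (∧-true c)) B (All.++⁻ˡ (consts p) k) m
  ... | t , d , l , B′ with straight q (proj₂ (∧-true {checked p E} c)) B′ (All.++⁻ʳ (consts p) k) m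
  ...   | t′ , d′ , l′ , B″ = _ , ⇓seq d d′ ,
    ≤-trans (+-mono-≤ l l′) (≤-reflexive (sym (*-distribʳ-+ (V) (units p E) _))) , B″

  block : ∀ p xs {r M} → checked p (live xs) ≡ true → All (λ x → r x ≤ U) xs → All (_≤ U) (consts p) → (∀ a → M a ≤ U) →
    Run p ⟨ r , M ⟩ (λ s → s ≡ ⟨ exec p M r , M ⟩) (units p (live xs) * V)
  block p xs c l k m with straight p c (live-bounded xs l) k m
  ... | t , d , h , _ = _ , t , d , refl , h

-- Counting loops and costs in units

one : Reg
one = 2

for : Reg → Program → Program
for x p = while x (arith sub x x one ⨾ p)

update-same : ∀ (r : ℕ → ℕ) x v → (r [ x ↦ v ]) x ≡ v
update-same r x v with x ≡ᵇ x in eq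
... | true  = refl
... | false = contradiction (≡⇒≡ᵇ x x refl) (subst (λ b → ¬ T b) (sym eq) λ z → z)

update-other : ∀ (r : ℕ → ℕ) x y v → (x ≡ᵇ y) ≡ false → (r [ x ↦ v ]) y ≡ r y
update-other r x y v h rewrite h = refl

-- `P k` is the invariant with k iterations left. The counter is decremented before the body, which
-- therefore runs with the indices k₀ - 1, ..., 0. The hypothesis on updates of x makes the
-- invariant blind to the counter. The 3 V pay for the test and for the two operands of the
-- subtraction.
for-run : ∀ x p {r₀ M₀} (P : ℕ → State → Set) {c V} k₀ → size k₀ ≤ V → r₀ one ≡ 1 →
  writes (for x p) one ≡ false → writes p x ≡ false →
  (∀ {k r M v} → P k ⟨ r , M ⟩ → P k ⟨ r [ x ↦ v ] , M ⟩) →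
  r₀ x ≡ k₀ → P k₀ ⟨ r₀ , M₀ ⟩ →
  (∀ k r M → k < k₀ → r x ≡ k → (∀ y → writes (for x p) y ≡ false → r y ≡ r₀ y) →
     (storeFree p ≡ true → M ≡ M₀) → P (suc k) ⟨ r , M ⟩ → Run p ⟨ r , M ⟩ (P k) c) →
  Run (for x p) ⟨ r₀ , M₀ ⟩ (P 0) (k₀ * (c + 3 * V) + V)
for-run x p {r₀} {M₀} P {c} {V} k₀ szk h1 w1 wx shift rx P₀ body =
  go k₀ r₀ M₀ ≤-refl rx (λ _ _ → refl) (λ _ → refl) P₀
  where
  1≤V : 1 ≤ V
  1≤V = ≤-trans (size≥1 k₀) szk
  arrange : ∀ k c V → V + (V + V + c) + (k * (c + 3 * V) + V) ≡ suc k * (c + 3 * V) + V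
  arrange = solve-∀
  go : ∀ k r M → k ≤ k₀ → r x ≡ k → (∀ y → writes (for x p) y ≡ false → r y ≡ r₀ y) →
    (storeFree p ≡ true → M ≡ M₀) → P k ⟨ r , M ⟩ → Run (for x p) ⟨ r , M ⟩ (P 0) (k * (c + 3 * V) + V)
  go zero r M _ e fr mf Pk = ⟨ r , M ⟩ , _ , ⇓while-zero e , Pk , ≤-trans (≤-reflexive (cong size e)) 1≤V
  go (suc k) r M le e fr mf Pk = iterate
    where
    r1 : ℕ → ℕ
    r1 = r [ x ↦ r x ∸ r one ]
    eq1 : r one ≡ 1
    eq1 = trans (fr one w1) h1
    r1x : r1 x ≡ k
    r1x = trans (update-same r x _) (trans (cong₂ _∸_ e eq1) refl)
    x≢ : ∀ y → writes (for x p) y ≡ false → (x ≡ᵇ y) ≡ false × writes p y ≡ false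
    x≢ y h = ∨-false h
    fr1 : ∀ y → writes (for x p) y ≡ false → r1 y ≡ r₀ y
    fr1 y h = trans (update-other r x y _ (proj₁ (x≢ y h))) (fr y h)
    iterate : Run (for x p) ⟨ r , M ⟩ (P 0) (suc k * (c + 3 * V) + V)
    iterate with body k r1 M le r1x fr1 mf (shift Pk)
    ... | ⟨ r2 , M2 ⟩ , t , d , Q , l with go k r2 M2 (<⇒≤ le)
            (trans (frame d x wx) r1x) (λ y h → trans (frame d y (proj₂ (x≢ y h))) (fr1 y h))
            (λ h → trans (memFrame d h) (mf h)) Q
    ...   | s′ , t′ , d′ , Q′ , l′ = s′ , _ , ⇓while-nonzero (subst NonZero (sym e) _) (⇓seq ⇓arith d) d′ , Q′ ,
      ≤-trans (+-mono-≤ (+-mono-≤ szx (+-mono-≤ (+-mono-≤ szx (≤-trans (≤-reflexive (cong size eq1)) 1≤V)) l)) l′)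
              (≤-reflexive (arrange k c V))
      where
      szx : size (r x) ≤ V
      szx = ≤-trans (size-mono (≤-trans (≤-reflexive e) le)) szk

-- A record and not an abbreviation, so that the number of units c can be read off the type by
-- unification, which could not invert c * V.
record Timed (V : ℕ) (p : Program) (s : State) (Q : State → Set) (c : ℕ) : Set where
  constructor timed
  field
    outcome : Run p s Q (c * V)

module Costed (U V : ℕ) (2≤U : 2 ≤ U) (U≤V : size U ≤ V) where
  open Straight U V 2≤U U≤V hiding (block)

  RunU : Program → State → (State → Set) → ℕ → Set
  RunU = Timed V

  block : ∀ p xs {r M} → checked p (live xs) ≡ true → All (λ x → r x ≤ U) xs → All (_≤ U) (consts p) → (∀ a → M a ≤ U) →
    RunU p ⟨ r , M ⟩ (λ s → s ≡ ⟨ exec p M r , M ⟩) (units p (live xs))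
  block p xs c l k m = timed (Straight.block U V 2≤U U≤V p xs c l k m)

  blockAt : ∀ p xs {s r M} → s ≡ ⟨ r , M ⟩ → checked p (live xs) ≡ true → All (λ x → reg s x ≤ U) xs →
    All (_≤ U) (consts p) → (∀ a → M a ≤ U) → RunU p s (λ s′ → s′ ≡ ⟨ exec p M (reg s) , M ⟩) (units p (live xs))
  blockAt p xs refl = block p xs

  seqU : ∀ {p q s P Q a b} → RunU p s P a → (∀ s′ → (∀ y → writes p y ≡ false → reg s′ y ≡ reg s y) →
    (storeFree p ≡ true → mem s′ ≡ mem s) → P s′ → RunU q s′ Q b) → RunU (p ⨾ q) s Q (a + b)
  seqU {a = a} {b} (timed x) k = timed (Run-weaken (λ _ _ h → h) (≤-reflexive (sym (*-distribʳ-+ V a b)))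
    (Run-seq x λ s f g h → Timed.outcome (k s f g h)))

  forU : ∀ x p {r₀ M₀} (P : ℕ → State → Set) {c} k₀ → k₀ ≤ U → r₀ one ≡ 1 →
    writes (for x p) one ≡ false → writes p x ≡ false →
    (∀ {k r M v} → P k ⟨ r , M ⟩ → P k ⟨ r [ x ↦ v ] , M ⟩) →
    r₀ x ≡ k₀ → P k₀ ⟨ r₀ , M₀ ⟩ →
    (∀ k r M → k < k₀ → r x ≡ k → (∀ y → writes (for x p) y ≡ false → r y ≡ r₀ y) →
       (storeFree p ≡ true → M ≡ M₀) → P (suc k) ⟨ r , M ⟩ → RunU p ⟨ r , M ⟩ (P k) c) →
    RunU (for x p) ⟨ r₀ , M₀ ⟩ (P 0) (k₀ * (c + 3) + 1)
  forU x p P {c} k₀ k₀≤U h1 w1 wx sh rx P₀ body =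
    timed (Run-weaken (λ _ _ h → h) (≤-reflexive (arrange k₀ c V))
      (for-run x p P k₀ (≤-trans (size-mono k₀≤U) U≤V) h1 w1 wx sh rx P₀
        λ k r M l e f g h → Timed.outcome (body k r M l e f g h)))
    where
    arrange : ∀ k c V → k * (c * V + 3 * V) + V ≡ (k * (c + 3) + 1) * V
    arrange = solve-∀

  weakenU : ∀ {p s P Q a b} → (∀ s′ → (∀ y → writes p y ≡ false → reg s′ y ≡ reg s y) → P s′ → Q s′) → a ≤ b →
    RunU p s P a → RunU p s Q b
  weakenU f l (timed x) = timed (Run-weaken f (*-monoˡ-≤ V l) x)

  infix 4 _⊑_
  _⊑_ : ∀ {x v} → x ≡ v → v ≤ U → x ≤ U
  e ⊑ h = ≤-trans (≤-reflexive e) h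

-- Enumerating the paths of all vectors

horner : ℕ → ℕ → (ℕ → ℕ) → ℕ → ℕ
horner m zero    f a = a
horner m (suc k) f a = horner m k f (a * m + f k)

-- Since partial values only grow, the accumulator is at all times bounded by its final value, hence
-- by m ^ k; no separate bound has to be carried through the loop.
horner-≥ : ∀ m k f a .{{_ : NonZero m}} → a ≤ horner m k f a
horner-≥ m zero    f a = ≤-refl
horner-≥ m (suc k) f a = ≤-trans (≤-trans (m≤m*n a m) (m≤m+n (a * m) (f k))) (horner-≥ m k f _)

horner-< : ∀ m k f a j → (∀ t → f t < m) → a < m ^ j → horner m k f a < m ^ (k + j)
horner-< m zero    f a j hf h = h
horner-< m (suc k) f a j hf h = subst (λ e → horner m k f (a * m + f k) < m ^ e) (+-suc k j)
  (horner-< m k f (a * m + f k) (suc j) hf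
    (subst₂ _<_ (+-comm (f k) (a * m)) (*-comm (m ^ j) m) (digit-< (hf k) h)))

-- A walk reads the digits of c in radix r, least significant first, and
-- follows in each block b, from the last to the first, the table entry of the
-- letter l b that the digit selects.

module Walk (r Z : ℕ) .{{_ : NonZero r}} (cd cf : ℕ → ℕ → ℕ) (l : ℕ → ℕ) where

  codeOf : ℕ → ℕ → ℕ → ℕ
  codeOf zero    c z = z
  codeOf (suc k) c z = codeOf k (c / r) (z * Z + cd (l k) (c % r))

  coefOf : ℕ → ℕ → ℕ → ℕ
  coefOf zero    c w = w
  coefOf (suc k) c w = coefOf k (c / r) (w * cf (l k) (c % r))

  codeOf-≥ : ∀ k c z .{{_ : NonZero Z}} → z ≤ codeOf k c z
  codeOf-≥ zero    c z = ≤-refl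
  codeOf-≥ (suc k) c z = ≤-trans (≤-trans (m≤m*n z Z) (m≤m+n (z * Z) _)) (codeOf-≥ k (c / r) _)

  codeOf-< : ∀ k c z j → (∀ b δ → δ < r → cd (l b) δ < Z) → z < Z ^ j → codeOf k c z < Z ^ (k + j)
  codeOf-< zero    c z j hc h = h
  codeOf-< (suc k) c z j hc h = subst (λ e → codeOf k (c / r) (z * Z + cd (l k) (c % r)) < Z ^ e) (+-suc k j)
    (codeOf-< k (c / r) _ (suc j) hc
      (subst₂ _<_ (+-comm (cd (l k) (c % r)) (z * Z)) (*-comm (Z ^ j) Z) (digit-< (hc k (c % r) (m%n<n c r)) h)))

  coefOf-≤ : ∀ k c w G j → (∀ b δ → δ < r → cf (l b) δ ≤ G) → w ≤ G ^ j → coefOf k c w ≤ G ^ (k + j)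
  coefOf-≤ zero    c w G j hc h = h
  coefOf-≤ (suc k) c w G j hc h = subst (λ e → coefOf k (c / r) (w * cf (l k) (c % r)) ≤ G ^ e) (+-suc k j)
    (coefOf-≤ k (c / r) _ G (suc j) hc
      (≤-trans (*-mono-≤ h (hc k (c % r) (m%n<n c r))) (≤-reflexive (*-comm (G ^ j) G))))

-- Registers: 0 n, 1 d, 2 the constant one, 3 X, 4 Y, 5 N, 6 number B of blocks,
-- 7 r ^ B, 8 base of the table in use, 9 base of the cells indexed by codes,
-- 10 base of the vectors in use, 11 accumulator, 12 row, 13 address of that row,
-- 14 path, 15 its remaining digits, 16 code, 17 coefficient, 18 block, 19 letter,
-- 20 coordinate in the block, 21 and above scratch.
module Code (m κ r Z : ℕ) where

  letterBody : Program
  letterBody = const 21 κ ⨾ arith mul 21 18 21 ⨾ arith add 21 21 20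
    -- For a coordinate index p ≥ d this reads a cell beyond the row. The mask 1 ∸ ((p + 1) ∸ d)
    -- computed next annihilates whatever is found there.
    ⨾ arith add 22 13 21 ⨾ load 22 22
    ⨾ arith add 21 21 2 ⨾ arith sub 21 21 1 ⨾ arith sub 21 2 21
    ⨾ arith mul 22 22 21
    ⨾ const 21 m ⨾ arith mul 19 19 21 ⨾ arith add 19 19 22

  letter : Program
  letter = (const 19 0 ⨾ const 20 κ) ⨾ for 20 letterBody

  -- The digit δ is obtained as c - (c / r) r, there being no remainder instruction. The index a r +
  -- δ is doubled because an entry occupies two cells.
  selectEntry readCode readCoef : Program
  selectEntry = const 21 r ⨾ arith div 22 15 21 ⨾ arith mul 22 22 21 ⨾ arith sub 22 15 22 ⨾ arith div 15 15 21
    ⨾ arith mul 21 19 21 ⨾ arith add 21 21 22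
  readCode = arith add 21 21 21 ⨾ arith add 21 8 21 ⨾ load 22 21
    ⨾ const 23 Z ⨾ arith mul 16 16 23 ⨾ arith add 16 16 22
  readCoef = arith add 21 21 2 ⨾ load 22 21 ⨾ arith mul 17 17 22

  -- Multiplication by register 2, which holds one, serves as the copy instruction.
  walk : Program
  walk = (const 16 0 ⨾ const 17 1 ⨾ arith mul 15 14 2 ⨾ arith mul 18 6 2) ⨾ for 18 (letter ⨾ selectEntry ⨾ readCode ⨾ readCoef)

  sweep : Program → Program
  sweep tail = arith mul 12 0 2 ⨾ for 12
    ((arith mul 13 12 1 ⨾ arith add 13 10 13 ⨾ arith mul 14 7 2) ⨾ for 14 (walk ⨾ tail))

  letterUnits : ℕ
  letterUnits = units letterBody (live (1 ∷ 2 ∷ 13 ∷ 18 ∷ 19 ∷ 20 ∷ []))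

  stepUnits : ℕ
  stepUnits = 2 + (κ * (letterUnits + 3) + 1) + (units selectEntry (live (15 ∷ 19 ∷ []))
    + (units readCode (live (8 ∷ 16 ∷ 21 ∷ [])) + units readCoef (live (2 ∷ 17 ∷ 21 ∷ []))))

div-op : ∀ x r .{{_ : NonZero r}} → ⟦ div ⟧ x r ≡ x / r
div-op x (suc r) = refl

record MemOK (U Q r n d tabA vec : ℕ) (x : ℕ → ℕ → ℕ) (cd cf : ℕ → ℕ → ℕ) (M : ℕ → ℕ) : Set where
  field
    bounded : ∀ a → M a ≤ U
    coord   : ∀ i p → i < n → p < d → M (vec + i * d + p) ≡ x i p
    codes   : ∀ a δ → a < Q → δ < r → M (tabA + ((a * r + δ) + (a * r + δ))) ≡ cd a δ
    coefs   : ∀ a δ → a < Q → δ < r → M (tabA + ((a * r + δ) + (a * r + δ)) + 1) ≡ cf a δ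

Globals : (n d B pw tabA tb vec : ℕ) → (ℕ → ℕ) → Set
Globals n d B pw tabA tb vec r =
  r 2 ≡ 1 × r 0 ≡ n × r 1 ≡ d × r 6 ≡ B × r 7 ≡ pw × r 8 ≡ tabA × r 9 ≡ tb × r 10 ≡ vec

globals : List Reg
globals = 2 ∷ 0 ∷ 1 ∷ 6 ∷ 7 ∷ 8 ∷ 9 ∷ 10 ∷ []

Avoids : Program → List Reg → Set
Avoids p []       = ⊤
Avoids p (y ∷ ys) = writes p y ≡ false × Avoids p ys

globals-frame : ∀ {n d B pw tabA tb vec} (r₀ r : ℕ → ℕ) → Globals n d B pw tabA tb vec r₀ →
  All (λ y → r y ≡ r₀ y) globals → Globals n d B pw tabA tb vec r
globals-frame _ _ (a , b , c , d , e , f , g , h) (a′ ∷ b′ ∷ c′ ∷ d′ ∷ e′ ∷ f′ ∷ g′ ∷ h′ ∷ []) =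
  trans a′ a , trans b′ b , trans c′ c , trans d′ d , trans e′ e , trans f′ f , trans g′ g , trans h′ h

-- The sweep over the uᵢ and the sweep over the vⱼ are two instances of this. They differ in the
-- base of the vectors, in the half of the table and in the functions stored there.
record SweepData (m κ r Z : ℕ) : Set where
  field
    U V : ℕ
    2≤U : 2 ≤ U
    U≤V : size U ≤ V
    n d B pw tabA tb vec : ℕ
    x     : ℕ → ℕ → ℕ
    cd cf : ℕ → ℕ → ℕ
    G     : ℕ
    x<m   : ∀ i p → x i p < m
    cd<Z  : ∀ a δ → δ < r → cd a δ < Z
    cf≤G  : ∀ a δ → a < m ^ κ → δ < r → cf a δ ≤ G
    1≤G   : 1 ≤ G
    m≤U : m ≤ U
    κ≤U : κ ≤ U
    r≤U : r ≤ U
    Z≤U : Z ≤ U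
    n≤U : n ≤ U
    d≤U : d ≤ U
    B≤U : B ≤ U
    pw≤U   : pw ≤ U
    tabA≤U : tabA ≤ U
    tb≤U   : tb ≤ U
    vec≤U  : vec ≤ U
    entry≤U : ∀ a δ → a < m ^ κ → δ < r → tabA + ((a * r + δ) + (a * r + δ)) ≤ U
    row≤U   : ∀ i → i < n → vec + i * d ≤ U
    Q≤U   : m ^ κ ≤ U
    Z^B≤U : Z ^ B ≤ U
    G^B≤U : G ^ B ≤ U

module Sweep (m κ r Z : ℕ) .{{_ : NonZero m}} .{{_ : NonZero r}} .{{_ : NonZero Z}} (sweepData : SweepData m κ r Z) where

  open SweepData sweepData
  open Costed U V 2≤U U≤V
  open Code m κ r Z

  Q : ℕ
  Q = m ^ κ

  OK : (ℕ → ℕ) → Set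
  OK = MemOK U Q r n d tabA vec x cd cf

  Glob : (ℕ → ℕ) → Set
  Glob = Globals n d B pw tabA tb vec

  1≤U : 1 ≤ U
  1≤U = ≤-trans (s≤s z≤n) 2≤U

  -- The truncated factor is 1 for p < d and 0 otherwise: vectors are padded with zeros.
  coordinate : ℕ → ℕ → ℕ
  coordinate i p = x i p * (1 ∸ ((p + 1) ∸ d))

  coordinate<m : ∀ i p → coordinate i p < m
  coordinate<m i p = ≤-trans (s≤s (≤-trans (*-monoʳ-≤ (x i p) (m∸n≤m 1 (p + 1 ∸ d))) (≤-reflexive (*-identityʳ (x i p))))) (x<m i p)

  letterOf : ℕ → ℕ → ℕ
  letterOf i b = horner m κ (λ t → coordinate i (b * κ + t)) 0

  letterOf<Q : ∀ i b → letterOf i b < Q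
  letterOf<Q i b = subst (λ e → letterOf i b < m ^ e) (+-identityʳ κ)
    (horner-< m κ (λ t → coordinate i (b * κ + t)) 0 0 (λ t → coordinate<m i _) (s≤s z≤n))

  read : ∀ {i M} p → i < n → OK M → M (vec + i * d + p) * (1 ∸ ((p + 1) ∸ d)) ≡ coordinate i p
  read {i} {M} p i<n ok with p <? d
  ... | yes p<d = cong (_* _) (MemOK.coord ok i p i<n p<d)
  ... | no  p≮d = trans (vanish (M (vec + i * d + p))) (sym (vanish (x i p)))
    where
    vanish : ∀ y → y * (1 ∸ ((p + 1) ∸ d)) ≡ 0
    vanish y = trans (cong (λ e → y * (1 ∸ e)) (trans (cong (_∸ d) (+-comm p 1)) (+-∸-assoc 1 (≮⇒≥ p≮d))))
      (trans (cong (y *_) (0∸n≡0 (p ∸ d))) (*-zeroʳ y))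

  -- The invariant says that finishing the Horner scheme from the present accumulator yields the
  -- letter, so partial results need no description of their own. The walk below is treated in the
  -- same way.
  letter-run : ∀ {r₀ M i b} → i < n → b < B → OK M → r₀ 2 ≡ 1 → r₀ 1 ≡ d → r₀ 13 ≡ vec + i * d → r₀ 18 ≡ b →
    RunU letter ⟨ r₀ , M ⟩ (λ s → reg s 19 ≡ letterOf i b) (2 + (κ * (letterUnits + 3) + 1))
  letter-run {r₀} {M} {i} {b} i<n b<B ok h2 h1 h13 h18 = seqU
    (block (const 19 0 ⨾ const 20 κ) [] refl [] (z≤n ∷ κ≤U ∷ []) (MemOK.bounded ok))
    λ { _ _ _ refl → forU 20 letterBody (λ k s → horner m k f (reg s 19) ≡ letterOf i b) κ κ≤U h2 refl refl
      (λ h → h) refl refl body }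
    where
    f : ℕ → ℕ
    f t = coordinate i (b * κ + t)
    body : ∀ k r′ M′ → k < κ → r′ 20 ≡ k →
      (∀ y → writes (for 20 letterBody) y ≡ false → r′ y ≡ ((r₀ [ 19 ↦ 0 ]) [ 20 ↦ κ ]) y) →
      (storeFree letterBody ≡ true → M′ ≡ M) → horner m (suc k) f (r′ 19) ≡ letterOf i b →
      RunU letterBody ⟨ r′ , M′ ⟩ (λ s → horner m k f (reg s 19) ≡ letterOf i b) letterUnits
    body k r′ M′ k<κ e20 fr mf inv with mf refl
    ... | refl = weakenU (λ { _ _ refl → trans (cong (horner m k f) value) inv }) ≤-refl
      (block letterBody (1 ∷ 2 ∷ 13 ∷ 18 ∷ 19 ∷ 20 ∷ []) refl
        ( (g1 ⊑ d≤U) ∷ (g2 ⊑ 1≤U) ∷ (g13 ⊑ row≤U i i<n) ∷ (g18 ⊑ ≤-trans (<⇒≤ b<B) B≤U)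
        ∷ ≤-trans (≤-trans (horner-≥ m (suc k) f (r′ 19)) (≤-reflexive inv)) (≤-trans (<⇒≤ (letterOf<Q i b)) Q≤U)
        ∷ (e20 ⊑ ≤-trans (<⇒≤ k<κ) κ≤U) ∷ [])
        (κ≤U ∷ m≤U ∷ []) (MemOK.bounded ok))
      where
      g1 : r′ 1 ≡ d
      g1 = trans (fr 1 refl) h1
      g2 : r′ 2 ≡ 1
      g2 = trans (fr 2 refl) h2
      g13 : r′ 13 ≡ vec + i * d
      g13 = trans (fr 13 refl) h13
      g18 : r′ 18 ≡ b
      g18 = trans (fr 18 refl) h18
      value : exec letterBody M′ r′ 19 ≡ r′ 19 * m + f k
      value rewrite g1 | g2 | g13 | g18 | e20 = cong (r′ 19 * m +_) (read (b * κ + k) i<n ok)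

  walkUnits : ℕ
  walkUnits = units (const 16 0 ⨾ const 17 1 ⨾ arith mul 15 14 2 ⨾ arith mul 18 6 2) (live (2 ∷ 6 ∷ 14 ∷ []))
    + (B * (stepUnits + 3) + 1)

  module Row (i : ℕ) (i<n : i < n) where
    open Walk r Z cd cf (letterOf i) public

    code<Z^B : ∀ c → codeOf B c 0 < Z ^ B
    code<Z^B c = subst (λ e → codeOf B c 0 < Z ^ e) (+-identityʳ B)
      (codeOf-< B c 0 0 (λ b δ h → cd<Z (letterOf i b) δ h) (s≤s z≤n))

    coef≤G^B : ∀ c → coefOf B c 1 ≤ G ^ B
    coef≤G^B c = subst (λ e → coefOf B c 1 ≤ G ^ e) (+-identityʳ B)
      (coefOf-≤ B c 1 G 0 (λ b δ h → cf≤G (letterOf i b) δ (letterOf<Q i b) h) ≤-refl)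

    -- Codes only grow, so the final code bounds the present one. Coefficients may become zero on
    -- the way, because padding paths have weight zero; their bound needs the potential `coef≤`,
    -- which allows a factor G for each of the k blocks left.
    record Walking (c₀ k : ℕ) (s : State) : Set where
      field
        code-eq : codeOf k (reg s 15) (reg s 16) ≡ codeOf B c₀ 0
        coef-eq : coefOf k (reg s 15) (reg s 17) ≡ coefOf B c₀ 1
        c≤U     : reg s 15 ≤ U
        coef≤   : reg s 17 * G ^ k ≤ G ^ B

    walk-run : ∀ {r₀ M c₀} → OK M → Glob r₀ → r₀ 13 ≡ vec + i * d → r₀ 14 ≡ c₀ → c₀ ≤ U →
      RunU walk ⟨ r₀ , M ⟩ (λ s → reg s 16 ≡ codeOf B c₀ 0 × reg s 17 ≡ coefOf B c₀ 1) walkUnits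
    walk-run {r₀} {M} {c₀} ok (h2 , _ , h1 , h6 , _ , h8 , _) h13 h14 c₀≤U = seqU
      (block (const 16 0 ⨾ const 17 1 ⨾ arith mul 15 14 2 ⨾ arith mul 18 6 2) (2 ∷ 6 ∷ 14 ∷ []) refl
        ((h2 ⊑ 1≤U) ∷ (h6 ⊑ B≤U) ∷ (h14 ⊑ c₀≤U) ∷ []) (z≤n ∷ 1≤U ∷ []) (MemOK.bounded ok))
      λ { _ _ _ refl → weakenU (λ s _ w → Walking.code-eq w , Walking.coef-eq w) ≤-refl
        (forU 18 (letter ⨾ selectEntry ⨾ readCode ⨾ readCoef) (Walking c₀) B B≤U h2 refl refl
          (λ w → record { code-eq = Walking.code-eq w ; coef-eq = Walking.coef-eq w ; c≤U = Walking.c≤U w ; coef≤ = Walking.coef≤ w })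
          b-eq
          (record { code-eq = cong (λ e → codeOf B e 0) c-eq ; coef-eq = cong (λ e → coefOf B e 1) c-eq
                  ; c≤U = ≤-trans (≤-reflexive c-eq) c₀≤U ; coef≤ = ≤-reflexive (*-identityˡ (G ^ B)) })
          body) }
      where
      c-eq : r₀ 14 * r₀ 2 ≡ c₀
      c-eq = trans (cong₂ _*_ h14 h2) (*-identityʳ c₀)
      b-eq : r₀ 6 * r₀ 2 ≡ B
      b-eq = trans (cong₂ _*_ h6 h2) (*-identityʳ B)
      body : ∀ k r′ M′ → k < B → r′ 18 ≡ k → (∀ y → writes (for 18 (letter ⨾ selectEntry ⨾ readCode ⨾ readCoef)) y ≡ false →
          r′ y ≡ exec (const 16 0 ⨾ const 17 1 ⨾ arith mul 15 14 2 ⨾ arith mul 18 6 2) M r₀ y) →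
        (storeFree (letter ⨾ selectEntry ⨾ readCode ⨾ readCoef) ≡ true → M′ ≡ M) → Walking c₀ (suc k) ⟨ r′ , M′ ⟩ →
        RunU (letter ⨾ selectEntry ⨾ readCode ⨾ readCoef) ⟨ r′ , M′ ⟩ (Walking c₀ k) stepUnits
      body k r′ M′ k<B e18 fr mf w with mf refl
      ... | refl = seqU
        (letter-run i<n k<B ok (trans (fr 2 refl) h2) (trans (fr 1 refl) h1) (trans (fr 13 refl) h13) e18)
        λ { ⟨ r″ , M″ ⟩ fr′ mf′ e19 → step r″ M″ fr′ (mf′ refl) e19 }
        where
        open Walking w
        a : ℕ
        a = letterOf i k
        c δ′ e : ℕ
        c  = r′ 15
        δ′ = c % r
        e  = a * r + δ′
        δ<r : δ′ < r
        δ<r = m%n<n c r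
        e≤U : tabA + (e + e) ≤ U
        e≤U = entry≤U a δ′ (letterOf<Q i k) δ<r
        digit : c ∸ ⟦ div ⟧ c r * r ≡ δ′
        digit = trans (cong (λ q → c ∸ q * r) (div-op c r)) (sym (m%n≡m∸m/n*n c r))
        step : ∀ r″ M″ → (∀ y → writes letter y ≡ false → r″ y ≡ r′ y) → M″ ≡ M′ → r″ 19 ≡ a →
          RunU (selectEntry ⨾ readCode ⨾ readCoef) ⟨ r″ , M″ ⟩ (Walking c₀ k) _
        step r″ M″ fr′ refl e19 = seqU
          (block selectEntry (15 ∷ 19 ∷ []) refl ((g15 ⊑ c≤U) ∷ (e19 ⊑ ≤-trans (<⇒≤ (letterOf<Q i k)) Q≤U) ∷ [])
            (r≤U ∷ []) (MemOK.bounded ok))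
          λ { s₁ fr₁ _ eq₁ → seqU
            (blockAt readCode (8 ∷ 16 ∷ 21 ∷ []) eq₁ refl
              ( (trans (fr₁ 8 refl) g8 ⊑ tabA≤U)
              ∷ (trans (fr₁ 16 refl) g16 ⊑ ≤-trans (≤-trans (codeOf-≥ (suc k) c (r′ 16)) (≤-reflexive code-eq)) (≤-trans (<⇒≤ (code<Z^B c₀)) Z^B≤U))
              ∷ (v21 eq₁ ⊑ ≤-trans (m≤m+n e e) (≤-trans (m≤n+m (e + e) tabA) e≤U)) ∷ []) (Z≤U ∷ []) (MemOK.bounded ok))
            λ { s₂ fr₂ _ eq₂ → weakenU (λ { s₃ fr₃ eq₃ → finish
                  (trans (fr₃ 15 refl) (trans (fr₂ 15 refl) (v15 eq₁)))
                  (trans (fr₃ 16 refl) (w16 {s₁} eq₂ (v21 eq₁) (trans (fr₁ 8 refl) g8) (trans (fr₁ 16 refl) g16)))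
                  (w17 {s₂} eq₃ (w21 {s₁} eq₂ (v21 eq₁) (trans (fr₁ 8 refl) g8)) (trans (fr₂ 2 refl) (trans (fr₁ 2 refl) g2))
                    (trans (fr₂ 17 refl) (trans (fr₁ 17 refl) g17))) }) ≤-refl
              (blockAt readCoef (2 ∷ 17 ∷ 21 ∷ []) eq₂ refl
                ( (trans (fr₂ 2 refl) (trans (fr₁ 2 refl) g2) ⊑ 1≤U)
                ∷ (trans (fr₂ 17 refl) (trans (fr₁ 17 refl) g17) ⊑ ≤-trans (≤-trans (m≤m*n (r′ 17) (G ^ suc k) {{m^n≢0 G (suc k) {{>-nonZero 1≤G}}}}) coef≤) G^B≤U)
                ∷ (w21 {s₁} eq₂ (v21 eq₁) (trans (fr₁ 8 refl) g8) ⊑ e≤U) ∷ []) [] (MemOK.bounded ok)) } }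
          where
          g2 : r″ 2 ≡ 1
          g2 = trans (fr′ 2 refl) (trans (fr 2 refl) h2)
          g8 : r″ 8 ≡ tabA
          g8 = trans (fr′ 8 refl) (trans (fr 8 refl) h8)
          g15 : r″ 15 ≡ c
          g15 = fr′ 15 refl
          g16 : r″ 16 ≡ r′ 16
          g16 = fr′ 16 refl
          g17 : r″ 17 ≡ r′ 17
          g17 = fr′ 17 refl
          v15 : ∀ {s} → s ≡ ⟨ exec selectEntry M′ r″ , M′ ⟩ → reg s 15 ≡ c / r
          v15 refl = trans (cong (λ z → ⟦ div ⟧ z r) g15) (div-op c r)
          v21 : ∀ {s} → s ≡ ⟨ exec selectEntry M′ r″ , M′ ⟩ → reg s 21 ≡ e
          v21 refl = trans (cong₂ (λ y z → y * r + (z ∸ ⟦ div ⟧ z r * r)) e19 g15) (cong (a * r +_) digit)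
          w21 : ∀ {s s′} → s′ ≡ ⟨ exec readCode M′ (reg s) , M′ ⟩ → reg s 21 ≡ e → reg s 8 ≡ tabA →
            reg s′ 21 ≡ tabA + (e + e)
          w21 refl q21 q8 = cong₂ (λ y z → z + (y + y)) q21 q8
          w16 : ∀ {s s′} → s′ ≡ ⟨ exec readCode M′ (reg s) , M′ ⟩ → reg s 21 ≡ e → reg s 8 ≡ tabA → reg s 16 ≡ r′ 16 →
            reg s′ 16 ≡ r′ 16 * Z + cd a δ′
          w16 refl q21 q8 q16 = cong₂ (λ y z → y * Z + z) q16
            (trans (cong M′ (cong₂ (λ y z → z + (y + y)) q21 q8)) (MemOK.codes ok a δ′ (letterOf<Q i k) δ<r))
          w17 : ∀ {s s′} → s′ ≡ ⟨ exec readCoef M′ (reg s) , M′ ⟩ → reg s 21 ≡ tabA + (e + e) → reg s 2 ≡ 1 →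
            reg s 17 ≡ r′ 17 → reg s′ 17 ≡ r′ 17 * cf a δ′
          w17 refl q21 q2 q17 = cong₂ _*_ q17
            (trans (cong M′ (cong₂ _+_ q21 q2)) (MemOK.coefs ok a δ′ (letterOf<Q i k) δ<r))
          finish : ∀ {s} → reg s 15 ≡ c / r → reg s 16 ≡ r′ 16 * Z + cd a δ′ → reg s 17 ≡ r′ 17 * cf a δ′ → Walking c₀ k s
          finish {s} q15 q16 q17 = record
            { code-eq = trans (cong₂ (codeOf k) q15 q16) code-eq
            ; coef-eq = trans (cong₂ (coefOf k) q15 q17) coef-eq
            ; c≤U     = ≤-trans (≤-reflexive q15) (≤-trans (m/n≤m c r) c≤U)
            ; coef≤   = ≤-trans (*-monoˡ-≤ (G ^ k) (≤-trans (≤-reflexive q17) (*-monoʳ-≤ (r′ 17) (cf≤G a δ′ (letterOf<Q i k) δ<r))))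
                          (≤-trans (≤-reflexive (*-assoc (r′ 17) G (G ^ k))) coef≤) }

  code coef : ℕ → ℕ → ℕ
  code i c = Walk.codeOf r Z cd cf (letterOf i) B c 0
  coef i c = Walk.coefOf r Z cd cf (letterOf i) B c 1

  rowPrefix : Program
  rowPrefix = arith mul 13 12 1 ⨾ arith add 13 10 13 ⨾ arith mul 14 7 2

  sweepUnits : ℕ → ℕ
  sweepUnits tailUnits = 2 + (n * (7 + (pw * (walkUnits + tailUnits + 3) + 1) + 3) + 1)

  -- The invariant Inv R a M relates the accumulator a and the memory M to the
  -- contributions R that are still to be added.
  record TailSpec : Set₁ where
    field
      tail      : Program
      tailUnits : ℕ
      tail-writes : Avoids tail (14 ∷ 13 ∷ 12 ∷ globals)
      Inv    : (ℕ → ℕ) → ℕ → (ℕ → ℕ) → Set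
      Inv-OK : ∀ {R a M} → Inv R a M → OK M
      g      : ℕ → ℕ → ℕ → ℕ
      tail-run : ∀ {r M} i c (R : ℕ → ℕ) → i < n → c < pw → r 9 ≡ tb → r 16 ≡ code i c → r 17 ≡ coef i c →
        Inv (λ z → g (code i c) (coef i c) z + R z) (r 11) M →
        RunU tail ⟨ r , M ⟩ (λ s → Inv R (reg s 11) (mem s)) tailUnits

  module WithTail (tailSpec : TailSpec) where

    open TailSpec tailSpec

    -- The recursion follows the order of the loop, so that one iteration removes one summand
    -- definitionally, in the shape that `tail-run` expects.
    remainingPaths : ℕ → ℕ → (ℕ → ℕ) → ℕ → ℕ
    remainingPaths i zero    R z = R z
    remainingPaths i (suc c) R z = g (code i c) (coef i c) z + remainingPaths i c R z

    remainingRows : ℕ → ℕ → ℕ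
    remainingRows zero    z = 0
    remainingRows (suc i) z = remainingPaths i pw (remainingRows i) z

    remainingPaths-∑ : ∀ i c R z → remainingPaths i c R z ≡ ∑ c (λ c → g (code i c) (coef i c) z) + R z
    remainingPaths-∑ i zero    R z = refl
    remainingPaths-∑ i (suc c) R z = trans (cong (g (code i c) (coef i c) z +_) (remainingPaths-∑ i c R z))
      (sym (+-assoc (g (code i c) (coef i c) z) _ _))

    remainingRows-∑ : ∀ k z → remainingRows k z ≡ ∑ k (λ i → ∑ pw (λ c → g (code i c) (coef i c) z))
    remainingRows-∑ zero    z = refl
    remainingRows-∑ (suc k) z = trans (remainingPaths-∑ k pw (remainingRows k) z) (cong₂ _+_ refl (remainingRows-∑ k z))

    Pending : (ℕ → ℕ) → State → Set
    Pending R s = Inv R (reg s 11) (mem s)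

    paths-run : ∀ {r₀ M₀} i → i < n → Glob r₀ → r₀ 13 ≡ vec + i * d → r₀ 14 ≡ pw → ∀ R → Inv (remainingPaths i pw R) (r₀ 11) M₀ →
      RunU (for 14 (walk ⨾ tail)) ⟨ r₀ , M₀ ⟩ (Pending R) (pw * (walkUnits + tailUnits + 3) + 1)
    paths-run {r₀} {M₀} i i<n gl h13 h14 R inv =
      let (t14 , t13 , t12 , t2 , t0 , t1 , t6 , t7 , t8 , t9 , t10 , _) = tail-writes in
      forU 14 (walk ⨾ tail) (λ k → Pending (remainingPaths i k R)) pw pw≤U (proj₁ gl) t2 t14 (λ h → h) h14 inv
      λ k r′ M′ k<pw e14 fr _ h →
        let gl′ = globals-frame r₀ r′ gl (fr 2 t2 ∷ fr 0 t0 ∷ fr 1 t1 ∷ fr 6 t6 ∷ fr 7 t7 ∷ fr 8 t8 ∷ fr 9 t9 ∷ fr 10 t10 ∷ []) in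
        seqU (Row.walk-run i i<n (Inv-OK h) gl′ (trans (fr 13 t13) h13) e14 (≤-trans (<⇒≤ k<pw) pw≤U))
        λ { ⟨ r″ , M″ ⟩ fr′ mf (q16 , q17) → tail-run i k (remainingPaths i k R) i<n k<pw
              (trans (fr′ 9 refl) (trans (fr 9 t9) (proj₁ (proj₂ (proj₂ (proj₂ (proj₂ (proj₂ (proj₂ gl)))))))))
              q16 q17 (subst₂ (Inv (remainingPaths i (suc k) R)) (sym (fr′ 11 refl)) (sym (mf refl)) h) }

    sweep-run : ∀ {r₀ M₀} → Glob r₀ → Inv (remainingRows n) (r₀ 11) M₀ →
      RunU (sweep tail) ⟨ r₀ , M₀ ⟩ (Pending (λ _ → 0)) (sweepUnits tailUnits)
    sweep-run {r₀} {M₀} gl@(h2 , h0 , _) inv = let (t14 , t13 , t12 , t2 , t0 , t1 , t6 , t7 , t8 , t9 , t10 , _) = tail-writes in seqU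
      (block (arith mul 12 0 2) (0 ∷ 2 ∷ []) refl ((h0 ⊑ n≤U) ∷ (h2 ⊑ 1≤U) ∷ []) [] (MemOK.bounded (Inv-OK inv)))
      λ { _ _ _ refl → forU 12 (rowPrefix ⨾ for 14 (walk ⨾ tail)) (λ k → Pending (remainingRows k)) n n≤U h2 t2 t12 (λ h → h)
        (trans (cong₂ _*_ h0 h2) (*-identityʳ n)) inv
        λ k r′ M′ k<n e12 fr _ h →
          let gl′ = globals-frame r₀ r′ gl (fr 2 t2 ∷ fr 0 t0 ∷ fr 1 t1 ∷ fr 6 t6 ∷ fr 7 t7 ∷ fr 8 t8 ∷ fr 9 t9 ∷ fr 10 t10 ∷ [])
              (q2 , q0 , q1 , q6 , q7 , q8 , q9 , q10) = gl′ in
          seqU (block rowPrefix (1 ∷ 2 ∷ 7 ∷ 10 ∷ 12 ∷ []) refl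
                 ((q1 ⊑ d≤U) ∷ (q2 ⊑ 1≤U) ∷ (q7 ⊑ pw≤U) ∷ (q10 ⊑ vec≤U) ∷ (e12 ⊑ ≤-trans (<⇒≤ k<n) n≤U) ∷ []) []
                 (MemOK.bounded (Inv-OK h)))
          λ { _ _ _ refl → paths-run k k<n gl′ (trans (cong₂ _+_ q10 (cong₂ _*_ e12 q1)) refl)
                (trans (cong₂ _*_ q7 q2) (*-identityʳ pw)) (remainingRows k) h } }

-- Expressions in X and Y

-- Table entries depend on X and hence on n, while the program may not. It therefore contains
-- expressions in X and Y, fixed once m is, and evaluates them when it starts.
data Expr : Set where
  lit       : ℕ → Expr
  varX varY : Expr
  _⊕_ _⊗_   : Expr → Expr → Expr

value : ℕ → ℕ → Expr → ℕ
value X Y (lit c) = c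
value X Y varX    = X
value X Y varY    = Y
value X Y (e ⊕ f) = value X Y e + value X Y f
value X Y (e ⊗ f) = value X Y e * value X Y f

-- Result in register k, intermediate results in the registers above it.
compile : Expr → Reg → Program
compile (lit c) k = const k c
compile varX    k = arith mul k 3 2
compile varY    k = arith mul k 4 2
compile (e ⊕ f) k = compile e k ⨾ compile f (suc k) ⨾ arith add k k (suc k)
compile (e ⊗ f) k = compile e k ⨾ compile f (suc k) ⨾ arith mul k k (suc k)

≡ᵇ-false : ∀ {x y} → y < x → (x ≡ᵇ y) ≡ false
≡ᵇ-false {suc x} {zero}  _       = refl
≡ᵇ-false {suc x} {suc y} (s≤s h) = ≡ᵇ-false h

compile-writes : ∀ e {k y} → y < k → writes (compile e k) y ≡ false
compile-writes (lit c) h = ≡ᵇ-false h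
compile-writes varX    h = ≡ᵇ-false h
compile-writes varY    h = ≡ᵇ-false h
compile-writes (e ⊕ f) h rewrite compile-writes e h | compile-writes f (m≤n⇒m≤1+n h) = ≡ᵇ-false h
compile-writes (e ⊗ f) h rewrite compile-writes e h | compile-writes f (m≤n⇒m≤1+n h) = ≡ᵇ-false h

compile-storeFree : ∀ e k → storeFree (compile e k) ≡ true
compile-storeFree (lit c) k = refl
compile-storeFree varX    k = refl
compile-storeFree varY    k = refl
compile-storeFree (e ⊕ f) k rewrite compile-storeFree e k | compile-storeFree f (suc k) = refl
compile-storeFree (e ⊗ f) k rewrite compile-storeFree e k | compile-storeFree f (suc k) = refl

weight : Expr → ℕ
weight (lit c) = size c
weight varX    = 1
weight varY    = 1
weight (e ⊕ f) = weight e + weight f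
weight (e ⊗ f) = weight e + weight f

compileUnits : Expr → ℕ
compileUnits (lit c) = size c
compileUnits varX    = 2
compileUnits varY    = 2
compileUnits (e ⊕ f) = compileUnits e + (compileUnits f + (weight e + weight f))
compileUnits (e ⊗ f) = compileUnits e + (compileUnits f + (weight e + weight f))

value-size : ∀ {X Y V} e → 1 ≤ V → size X ≤ V → size Y ≤ V → size (value X Y e) ≤ weight e * V
value-size {V = V} (lit c) 1≤V hX hY = m≤m*n (size c) V {{>-nonZero 1≤V}}
value-size {V = V} varX    1≤V hX hY = ≤-trans hX (m≤m+n V 0)
value-size {V = V} varY    1≤V hX hY = ≤-trans hY (m≤m+n V 0)
value-size {X} {Y} {V} (e ⊕ f) 1≤V hX hY = ≤-trans (size-+ (value X Y e) (value X Y f))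
  (≤-trans (+-mono-≤ (value-size e 1≤V hX hY) (value-size f 1≤V hX hY)) (≤-reflexive (sym (*-distribʳ-+ V (weight e) (weight f)))))
value-size {X} {Y} {V} (e ⊗ f) 1≤V hX hY = ≤-trans (size-* (value X Y e) (value X Y f))
  (≤-trans (+-mono-≤ (value-size e 1≤V hX hY) (value-size f 1≤V hX hY)) (≤-reflexive (sym (*-distribʳ-+ V (weight e) (weight f)))))

compile-run : ∀ {X Y V r M} e k → 4 < k → 1 ≤ V → size X ≤ V → size Y ≤ V → r 2 ≡ 1 → r 3 ≡ X → r 4 ≡ Y →
  Timed V (compile e k) ⟨ r , M ⟩ (λ s → reg s k ≡ value X Y e) (compileUnits e)
compile-run {V = V} {r} (lit c) k h 1≤V hX hY h2 h3 h4 =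
  timed (_ , _ , ⇓const , update-same r k c , m≤m*n (size c) V {{>-nonZero 1≤V}})
compile-run {V = V} {r} varX k h 1≤V hX hY h2 h3 h4 = timed (_ , _ , ⇓arith ,
  trans (update-same r k _) (trans (cong₂ _*_ h3 h2) (*-identityʳ _)) ,
  +-mono-≤ (≤-trans (≤-reflexive (cong size h3)) hX)
    (≤-trans (≤-reflexive (cong size h2)) (≤-trans 1≤V (m≤m+n V 0))))
compile-run {V = V} {r} varY k h 1≤V hX hY h2 h3 h4 = timed (_ , _ , ⇓arith ,
  trans (update-same r k _) (trans (cong₂ _*_ h4 h2) (*-identityʳ _)) ,
  +-mono-≤ (≤-trans (≤-reflexive (cong size h4)) hY)
    (≤-trans (≤-reflexive (cong size h2)) (≤-trans 1≤V (m≤m+n V 0))))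
compile-run {X} {Y} {V} {r} {M} (e ⊕ f) k h 1≤V hX hY h2 h3 h4
  with compile-run {M = M} e k h 1≤V hX hY h2 h3 h4
... | timed (⟨ r₁ , M₁ ⟩ , t₁ , d₁ , v₁ , l₁)
  with compile-run {M = M₁} f (suc k) (m≤n⇒m≤1+n h) 1≤V hX hY
         (trans (frame d₁ 2 (compile-writes e (≤-trans (s≤s (s≤s (s≤s z≤n))) h))) h2)
         (trans (frame d₁ 3 (compile-writes e (≤-trans (s≤s (s≤s (s≤s (s≤s z≤n)))) h))) h3)
         (trans (frame d₁ 4 (compile-writes e h)) h4)
... | timed (⟨ r₂ , M₂ ⟩ , t₂ , d₂ , v₂ , l₂) =
  timed (_ , _ , ⇓seq d₁ (⇓seq d₂ ⇓arith) , trans (update-same r₂ k _) (cong₂ _+_ v v₂) ,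
    ≤-trans (+-mono-≤ l₁ (+-mono-≤ l₂ (+-mono-≤
        (≤-trans (≤-reflexive (cong size v)) (value-size e 1≤V hX hY))
        (≤-trans (≤-reflexive (cong size v₂)) (value-size f 1≤V hX hY)))))
      (≤-reflexive (arrange (compileUnits e) (compileUnits f) (weight e) (weight f) V)))
  where
  v : r₂ k ≡ value X Y e
  v = trans (frame d₂ k (compile-writes f ≤-refl)) v₁
  arrange : ∀ a b c d V → a * V + (b * V + (c * V + d * V)) ≡ (a + (b + (c + d))) * V
  arrange = solve-∀
compile-run {X} {Y} {V} {r} {M} (e ⊗ f) k h 1≤V hX hY h2 h3 h4
  with compile-run {M = M} e k h 1≤V hX hY h2 h3 h4
... | timed (⟨ r₁ , M₁ ⟩ , t₁ , d₁ , v₁ , l₁)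
  with compile-run {M = M₁} f (suc k) (m≤n⇒m≤1+n h) 1≤V hX hY
         (trans (frame d₁ 2 (compile-writes e (≤-trans (s≤s (s≤s (s≤s z≤n))) h))) h2)
         (trans (frame d₁ 3 (compile-writes e (≤-trans (s≤s (s≤s (s≤s (s≤s z≤n)))) h))) h3)
         (trans (frame d₁ 4 (compile-writes e h)) h4)
... | timed (⟨ r₂ , M₂ ⟩ , t₂ , d₂ , v₂ , l₂) =
  timed (_ , _ , ⇓seq d₁ (⇓seq d₂ ⇓arith) , trans (update-same r₂ k _) (cong₂ _*_ v v₂) ,
    ≤-trans (+-mono-≤ l₁ (+-mono-≤ l₂ (+-mono-≤
        (≤-trans (≤-reflexive (cong size v)) (value-size e 1≤V hX hY))
        (≤-trans (≤-reflexive (cong size v₂)) (value-size f 1≤V hX hY)))))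
      (≤-reflexive (arrange (compileUnits e) (compileUnits f) (weight e) (weight f) V)))
  where
  v : r₂ k ≡ value X Y e
  v = trans (frame d₂ k (compile-writes f ≤-refl)) v₁
  arrange : ∀ a b c d V → a * V + (b * V + (c * V + d * V)) ≡ (a + (b + (c + d))) * V
  arrange = solve-∀

-- The number of cells does not depend on n or d, so the code is unrolled, one group of instructions
-- per cell.
fillTable : ℕ → (ℕ → Expr) → Program
-- There is no empty program; setting a scratch register takes its place.
fillTable zero    E = const 21 0
fillTable (suc j) E = fillTable j E ⨾ compile (E j) 20 ⨾ (const 21 j ⨾ arith add 21 8 21) ⨾ store 21 20

fillTable-writes : ∀ j E y → y < 20 → writes (fillTable j E) y ≡ false
fillTable-writes zero    E y h = ≡ᵇ-false (m≤n⇒m≤1+n h)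
fillTable-writes (suc j) E y h rewrite fillTable-writes j E y h | compile-writes (E j) h | ≡ᵇ-false {21} (m≤n⇒m≤1+n h) = refl

fillUnits : ℕ → (ℕ → Expr) → ℕ
fillUnits zero    E = 1
fillUnits (suc j) E = fillUnits j E + (compileUnits (E j) + (3 + (1 + weight (E j))))

fillTable-run : ∀ {X Y U V r M base} (2≤U : 2 ≤ U) (U≤V : size U ≤ V) E j → base + j ≤ U → size X ≤ V → size Y ≤ V →
  r 2 ≡ 1 → r 3 ≡ X → r 4 ≡ Y → r 8 ≡ base →
  Timed V (fillTable j E) ⟨ r , M ⟩ (λ s → (∀ i → i < j → mem s (base + i) ≡ value X Y (E i))
    × (∀ a → a < base → mem s a ≡ M a) × (∀ a → base + j ≤ a → mem s a ≡ M a)) (fillUnits j E)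
fillTable-run {U = U} {V} 2≤U U≤V E zero h hX hY h2 h3 h4 h8 =
  timed (_ , _ , ⇓const , ((λ _ ()) , (λ _ _ → refl) , λ _ _ → refl) , ≤-trans (size≥1 U) (≤-trans U≤V (m≤m+n V 0)))
fillTable-run {X} {Y} {U} {V} {r} {M} {base} 2≤U U≤V E (suc j) h hX hY h2 h3 h4 h8 =
  seqU (fillTable-run 2≤U U≤V E j j≤U hX hY h2 h3 h4 h8)
  λ { s₁ fr₁ _ (i₁ , l₁ , u₁) → seqU
    (compile-run (E j) 20 (s≤s (s≤s (s≤s (s≤s (s≤s z≤n))))) (≤-trans (size≥1 U) U≤V) hX hY
      (trans (fr₁ 2 (w 2 (s≤s (s≤s (s≤s z≤n))))) h2) (trans (fr₁ 3 (w 3 (s≤s (s≤s (s≤s (s≤s z≤n)))))) h3)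
      (trans (fr₁ 4 (w 4 (s≤s (s≤s (s≤s (s≤s (s≤s z≤n))))))) h4))
    λ { s₂ fr₂ mf₂ v₂ → write s₁ i₁ l₁ u₁ s₂ (mf₂ (compile-storeFree (E j) 20)) v₂
      (trans (fr₂ 8 (compile-writes (E j) 8<20)) (trans (fr₁ 8 (w 8 8<20)) h8)) } }
  where
  open Costed U V 2≤U U≤V
  8<20 : 8 < 20
  8<20 = s≤s (s≤s (s≤s (s≤s (s≤s (s≤s (s≤s (s≤s (s≤s z≤n))))))))
  w : ∀ y → y < 20 → writes (fillTable j E) y ≡ false
  w = fillTable-writes j E
  j≤U : base + j ≤ U
  j≤U = ≤-trans (+-monoʳ-≤ base (n≤1+n j)) h
  1≤V : 1 ≤ V
  1≤V = ≤-trans (size≥1 U) U≤V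
  write : ∀ s₁ → (∀ i → i < j → mem s₁ (base + i) ≡ value X Y (E i)) → (∀ a → a < base → mem s₁ a ≡ M a) →
    (∀ a → base + j ≤ a → mem s₁ a ≡ M a) → ∀ s₂ → mem s₂ ≡ mem s₁ → reg s₂ 20 ≡ value X Y (E j) → reg s₂ 8 ≡ base →
    RunU ((const 21 j ⨾ arith add 21 8 21) ⨾ store 21 20) s₂ (λ s → (∀ i → i < suc j → mem s (base + i) ≡ value X Y (E i))
      × (∀ a → a < base → mem s a ≡ M a) × (∀ a → base + suc j ≤ a → mem s a ≡ M a)) (3 + (1 + weight (E j)))
  write s₁ i₁ l₁ u₁ ⟨ r₂ , M₂ ⟩ refl v₂ q8 = timed (_ , _ , ⇓seq (⇓seq ⇓const ⇓arith) ⇓store ,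
      (table , (λ a p → trans (outside a (λ e → <⇒≢ (≤-trans p (m≤m+n base j)) e)) (l₁ a p))
             , (λ a p → trans (outside a (λ e → <⇒≢ (≤-trans (≤-reflexive (sym (+-suc base j))) p) (sym e)))
                              (u₁ a (≤-trans (+-monoʳ-≤ base (n≤1+n j)) p)))) ,
      ≤-trans (+-mono-≤ (+-mono-≤ (sz (≤-trans (m≤n+m j base) j≤U)) (+-mono-≤ (sz (≤-trans (≤-reflexive q8) (≤-trans (m≤m+n base j) j≤U))) (sz (≤-trans (m≤n+m j base) j≤U))))
                        (+-mono-≤ (sz (≤-trans (≤-reflexive addr) j≤U)) (≤-trans (≤-reflexive (cong size v₂)) (value-size (E j) 1≤V hX hY))))
        (≤-reflexive (arrange V (weight (E j)))))
    where
    addr : r₂ 8 + j ≡ base + j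
    addr = cong (_+ j) q8
    sz : ∀ {x} → x ≤ U → size x ≤ V
    sz p = ≤-trans (size-mono p) U≤V
    arrange : ∀ V w → V + (V + V) + (V + w * V) ≡ (3 + (1 + w)) * V
    arrange = solve-∀
    outside : ∀ a → a ≢ base + j → (M₂ [ r₂ 8 + j ↦ r₂ 20 ]) a ≡ M₂ a
    outside a ne with (r₂ 8 + j) ≡ᵇ a in eq
    ... | true  = contradiction (trans (sym (≡ᵇ⇒≡ _ a (subst T (sym eq) tt))) addr) ne
    ... | false = refl
    table : ∀ i → i < suc j → (M₂ [ r₂ 8 + j ↦ r₂ 20 ]) (base + i) ≡ value X Y (E i)
    table i p with i ≟ j
    ... | yes refl = trans (cong (λ z → (M₂ [ z ↦ r₂ 20 ]) (base + i)) addr) (trans (update-same M₂ (base + i) (r₂ 20)) v₂)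
    ... | no  ne   = trans (outside (base + i) (λ e → ne (+-cancelˡ-≡ base i j e))) (i₁ i (≤∧≢⇒< (≤-pred p) ne))

-- Congruences and pairings

module Congruence (N : ℕ) .{{_ : NonZero N}} where

  infix 4 _≈_
  record _≈_ (a b : ℕ) : Set where
    constructor mk
    field residue : a % N ≡ b % N
  open _≈_ public

  ≡⇒≈ : ∀ {a b} → a ≡ b → a ≈ b
  ≡⇒≈ refl = mk refl

  ≈-sym : ∀ {a b} → a ≈ b → b ≈ a
  ≈-sym (mk h) = mk (sym h)

  ≈-trans : ∀ {a b c} → a ≈ b → b ≈ c → a ≈ c
  ≈-trans (mk h) (mk k) = mk (trans h k)

  +-≈ : ∀ {a b c d} → a ≈ b → c ≈ d → a + c ≈ b + d
  +-≈ {a} {b} {c} {d} (mk h) (mk k) = mk (trans (%-distribˡ-+ a c N)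
    (trans (cong₂ (λ x y → (x + y) % N) h k) (sym (%-distribˡ-+ b d N))))

  *-≈ : ∀ {a b c d} → a ≈ b → c ≈ d → a * c ≈ b * d
  *-≈ {a} {b} {c} {d} (mk h) (mk k) = mk (trans (%-distribˡ-* a c N)
    (trans (cong₂ (λ x y → (x * y) % N) h k) (sym (%-distribˡ-* b d N))))

  ∑-≈ : ∀ n {f g} → (∀ i → i < n → f i ≈ g i) → ∑ n f ≈ ∑ n g
  ∑-≈ zero    h = ≡⇒≈ refl
  ∑-≈ (suc n) h = +-≈ (h n ≤-refl) (∑-≈ n λ i p → h i (m≤n⇒m≤1+n p))

  +-N≈ : ∀ a k → a + k * N ≈ a
  +-N≈ a k = mk ([m+kn]%n≡m%n a k N)

module Cyclic (X m : ℕ) .{{_ : NonZero m}} (N : ℕ) .{{_ : NonZero N}} (X^m≡ : X ^ m ≡ suc N) where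
  open Congruence N

  ^-mul-≈ : ∀ q → X ^ (q * m) ≈ 1
  ^-mul-≈ zero    = ≡⇒≈ refl
  ^-mul-≈ (suc q) = ≈-trans (≡⇒≈ (^-distribˡ-+-* X m (q * m)))
    (*-≈ (≈-trans (≡⇒≈ (trans X^m≡ (cong suc (sym (+-identityʳ N))))) (+-N≈ 1 1)) (^-mul-≈ q))

  ^-%-≈ : ∀ e → X ^ e ≈ X ^ (e % m)
  ^-%-≈ e = ≈-trans (≡⇒≈ (trans (cong (X ^_) (m≡m%n+[m/n]*n e m)) (^-distribˡ-+-* X (e % m) (e / m * m))))
    (≈-trans (*-≈ (≡⇒≈ {X ^ (e % m)} refl) (^-mul-≈ (e / m))) (≡⇒≈ (*-identityʳ (X ^ (e % m)))))

  ^-∣-≈ : ∀ e k → m ∣ e → X ^ (e + k) ≈ X ^ k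
  ^-∣-≈ e k (divides q refl) = ≈-trans (≡⇒≈ (^-distribˡ-+-* X (q * m) k))
    (≈-trans (*-≈ (^-mul-≈ q) (≡⇒≈ {X ^ k} refl)) (≡⇒≈ (*-identityˡ (X ^ k))))

∏ : ℕ → (ℕ → ℕ) → ℕ
∏ zero    f = 1
∏ (suc n) f = f n * ∏ n f

∑-∑-digits : ∀ n r .{{_ : NonZero r}} (H : ℕ → ℕ → ℕ → ℕ → ℕ) →
  ∑ (n * r) (λ c → ∑ (n * r) (λ c′ → H (c % r) (c / r) (c′ % r) (c′ / r))) ≡
  ∑ r (λ x → ∑ r (λ y → ∑ n (λ q → ∑ n (λ q′ → H x q y q′))))
∑-∑-digits n r H = begin
  ∑ (n * r) (λ c → ∑ (n * r) (λ c′ → H (c % r) (c / r) (c′ % r) (c′ / r)))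
    ≡⟨ ∑-digits n r (λ x q → ∑ (n * r) (λ c′ → H x q (c′ % r) (c′ / r))) ⟩
  ∑ n (λ q → ∑ r (λ x → ∑ (n * r) (λ c′ → H x q (c′ % r) (c′ / r))))
    ≡⟨ ∑-swap n r _ ⟩
  ∑ r (λ x → ∑ n (λ q → ∑ (n * r) (λ c′ → H x q (c′ % r) (c′ / r))))
    ≡⟨ ∑-cong r (λ x _ → ∑-cong n λ q _ → trans (∑-digits n r (λ y q′ → H x q y q′)) (∑-swap n r _)) ⟩
  ∑ r (λ x → ∑ n (λ q → ∑ r (λ y → ∑ n (λ q′ → H x q y q′))))
    ≡⟨ ∑-cong r (λ x _ → ∑-swap n r _) ⟩
  ∑ r (λ x → ∑ r (λ y → ∑ n (λ q → ∑ n (λ q′ → H x q y q′)))) ∎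
  where open ≡-Reasoning

-- Entry (a, b) of a product of two matrices whose rows are given sparsely, by r pairs of an inner
-- index (the code) and a coefficient.
kernel : ℕ → (cdL cfL cdR cfR : ℕ → ℕ → ℕ) → ℕ → ℕ → ℕ
kernel r cdL cfL cdR cfR a b = ∑ r λ x → ∑ r λ y → δ (cdL a x) (cdR b y) * (cfL a x * cfR b y)

module Pairing (r Z : ℕ) .{{_ : NonZero r}} .{{_ : NonZero Z}} (cdL cfL cdR cfR : ℕ → ℕ → ℕ)
  (cdL<Z : ∀ a δ → δ < r → cdL a δ < Z) (cdR<Z : ∀ a δ → δ < r → cdR a δ < Z) where

  module _ (l l′ : ℕ → ℕ) where
    module P = Walk r Z cdL cfL l
    module P′ = Walk r Z cdR cfR l′

    -- The mixed product property of Kronecker powers. A code is the digit string, in radix Z, of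
    -- the inner indices of the blocks, so equality of codes is equality in each block and the
    -- double sum becomes a product. The accumulators z, w, z′, w′ are general for the sake of the
    -- induction.
    pairing : ∀ k z w z′ w′ →
      ∑ (r ^ k) (λ c → ∑ (r ^ k) (λ c′ → δ (P.codeOf k c z) (P′.codeOf k c′ z′) * (P.coefOf k c w * P′.coefOf k c′ w′)))
        ≡ δ z z′ * (w * w′) * ∏ k (λ b → kernel r cdL cfL cdR cfR (l b) (l′ b))
    pairing zero z w z′ w′ = arrange (δ z z′) (w * w′)
      where
      arrange : ∀ a b → a * b + 0 + 0 ≡ a * b * 1
      arrange = solve-∀
    pairing (suc k) z w z′ w′ = begin
      _ ≡⟨ cong (λ e → ∑ e (λ c → ∑ e (λ c′ → H (c % r) (c / r) (c′ % r) (c′ / r)))) (*-comm r (r ^ k)) ⟩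
      _ ≡⟨ ∑-∑-digits (r ^ k) r H ⟩
      ∑ r (λ x → ∑ r (λ y → ∑ (r ^ k) (λ q → ∑ (r ^ k) (λ q′ → H x q y q′))))
        ≡⟨ ∑-cong r (λ x hx → ∑-cong r λ y hy → trans
             (pairing k (z * Z + cdL (l k) x) (w * cfL (l k) x) (z′ * Z + cdR (l′ k) y) (w′ * cfR (l′ k) y))
             (factor x y hx hy)) ⟩
      ∑ r (λ x → ∑ r (λ y → D * (δ (cdL (l k) x) (cdR (l′ k) y) * (cfL (l k) x * cfR (l′ k) y)) * Π))
        ≡⟨ ∑-cong r (λ x _ → trans (∑-*ʳ r Π _) (cong (_* Π) (∑-*ˡ r D _))) ⟩
      ∑ r (λ x → D * ∑ r (λ y → δ (cdL (l k) x) (cdR (l′ k) y) * (cfL (l k) x * cfR (l′ k) y)) * Π)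
        ≡⟨ trans (∑-*ʳ r Π _) (cong (_* Π) (∑-*ˡ r D _)) ⟩
      D * kernel r cdL cfL cdR cfR (l k) (l′ k) * Π
        ≡⟨ *-assoc D (kernel r cdL cfL cdR cfR (l k) (l′ k)) Π ⟩
      D * (kernel r cdL cfL cdR cfR (l k) (l′ k) * Π) ∎
      where
      open ≡-Reasoning
      D Π : ℕ
      D = δ z z′ * (w * w′)
      Π = ∏ k (λ b → kernel r cdL cfL cdR cfR (l b) (l′ b))
      H : ℕ → ℕ → ℕ → ℕ → ℕ
      H x q y q′ = δ (P.codeOf k q (z * Z + cdL (l k) x)) (P′.codeOf k q′ (z′ * Z + cdR (l′ k) y))
        * (P.coefOf k q (w * cfL (l k) x) * P′.coefOf k q′ (w′ * cfR (l′ k) y))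
      arrange : ∀ a b w c w′ c′ p → a * b * (w * c * (w′ * c′)) * p ≡ b * (w * w′) * (a * (c * c′)) * p
      arrange = solve-∀
      factor : ∀ x y → x < r → y < r →
        δ (z * Z + cdL (l k) x) (z′ * Z + cdR (l′ k) y) * (w * cfL (l k) x * (w′ * cfR (l′ k) y)) * Π ≡
        D * (δ (cdL (l k) x) (cdR (l′ k) y) * (cfL (l k) x * cfR (l′ k) y)) * Π
      factor x y hx hy = trans
        (cong (λ e → e * (w * cfL (l k) x * (w′ * cfR (l′ k) y)) * Π)
          (trans (cong₂ δ (+-comm (z * Z) _) (+-comm (z′ * Z) _)) (δ-digit z z′ (cdL<Z (l k) x hx) (cdR<Z (l′ k) y hy))))
        (arrange (δ (cdL (l k) x) (cdR (l′ k) y)) (δ z z′) w (cfL (l k) x) w′ (cfR (l′ k) y) Π)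

-- Digit strings, blocks of coordinates and sums over lists

∑-bottom : ∀ n f → ∑ (suc n) f ≡ f 0 + ∑ n (λ i → f (suc i))
∑-bottom zero    f = refl
∑-bottom (suc n) f = trans (cong (f (suc n) +_) (∑-bottom n f)) (arrange (f (suc n)) (f 0) _)
  where
  arrange : ∀ a b c → a + (b + c) ≡ b + (a + c)
  arrange = solve-∀

∑-blocks : ∀ B κ F → ∑ (B * κ) F ≡ ∑ B (λ b → ∑ κ (λ t → F (b * κ + t)))
∑-blocks zero    κ F = refl
∑-blocks (suc B) κ F = trans (∑-split κ (B * κ) F)
  (cong₂ _+_ (∑-cong κ λ t _ → cong F (+-comm t (B * κ))) (∑-blocks B κ F))

∑-extend : ∀ {d D} F → d ≤ D → (∀ p → d ≤ p → F p ≡ 0) → ∑ D F ≡ ∑ d F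
∑-extend {d} {D} F h z = trans (cong (λ e → ∑ e F) (sym (m∸n+n≡m h)))
  (trans (∑-split (D ∸ d) d F) (cong (_+ ∑ d F) (∑-zero (D ∸ d) λ x _ → z (x + d) (m≤n+m d x))))

number : ∀ {m k} → Vec (Fin m) k → ℕ
number         []       = 0
number {m} (x ∷ xs) = toℕ x + number xs * m

number-< : ∀ {m k} (v : Vec (Fin m) k) → number v < m ^ k
number-< [] = s≤s z≤n
number-< {m} {suc k} (x ∷ xs) = subst (toℕ x + number xs * m <_) (*-comm (m ^ k) m) (digit-< (toℕ<n x) (number-< xs))

horner-bottom : ∀ m k f a → horner m (suc k) f a ≡ f 0 + horner m k (λ t → f (suc t)) a * m
horner-bottom m zero    f a = +-comm (a * m) (f 0)
horner-bottom m (suc k) f a = horner-bottom m k f (a * m + f (suc k))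

vector : ∀ {m} k (f : ℕ → ℕ) → (∀ t → f t < m) → Vec (Fin m) k
vector zero    f h = []
vector (suc k) f h = fromℕ< (h 0) ∷ vector k (λ t → f (suc t)) (λ t → h (suc t))

number-vector : ∀ {m} k f h → number {m} (vector k f h) ≡ horner m k f 0
number-vector zero    f h = refl
number-vector {m} (suc k) f h = trans (cong₂ (λ x y → x + y * m) (toℕ-fromℕ< (h 0)) (number-vector k _ _)) (sym (horner-bottom m k f 0))

dot-vector : ∀ {m} k f g h h′ → ⟪ vector {m} k f h , vector k g h′ ⟫ ≡ ∑ k (λ t → f t * g t)
dot-vector zero    f g h h′ = refl
dot-vector (suc k) f g h h′ = trans
  (cong₂ _+_ (cong₂ _*_ (toℕ-fromℕ< (h 0)) (toℕ-fromℕ< (h′ 0))) (dot-vector k _ _ _ _))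
  (sym (∑-bottom k (λ t → f t * g t)))

entries : ∀ {m d} → Vec (Fin m) d → List ℕ
entries u = toList (Vec.map toℕ u)

dot-∑ : ∀ {m d} (u v : Vec (Fin m) d) → ⟪ u , v ⟫ ≡ ∑ d (λ p → contents (entries u) p * contents (entries v) p)
dot-∑ []      []      = refl
dot-∑ {d = suc d} (x ∷ u) (y ∷ v) = trans (cong (toℕ x * toℕ y +_) (dot-∑ u v))
  (sym (∑-bottom d (λ p → contents (entries (x ∷ u)) p * contents (entries (y ∷ v)) p)))

length-entries : ∀ {m d} (u : Vec (Fin m) d) → length (entries u) ≡ d
length-entries []      = refl
length-entries (x ∷ u) = cong suc (length-entries u)

entries-++ : ∀ {m d e} (u : Vec (Fin m) d) (v : Vec (Fin m) e) → entries (u Vec.++ v) ≡ entries u ++ entries v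
entries-++ []      v = refl
entries-++ (x ∷ u) v = cong (toℕ x ∷_) (entries-++ u v)

flatten-∷ : ∀ {m n d} (u : Vec (Fin m) d) (us : Vec (Vec (Fin m) d) n) → flatten (u ∷ us) ≡ entries u ++ flatten us
flatten-∷ u us = entries-++ u (Vec.concat us)

contents-++ˡ : ∀ xs ys {i} → i < length xs → contents (xs ++ ys) i ≡ contents xs i
contents-++ˡ (x ∷ xs) ys {zero}  h       = refl
contents-++ˡ (x ∷ xs) ys {suc i} (s≤s h) = contents-++ˡ xs ys h

contents-++ʳ : ∀ xs ys i → contents (xs ++ ys) (length xs + i) ≡ contents ys i
contents-++ʳ []       ys i = refl
contents-++ʳ (x ∷ xs) ys i = contents-++ʳ xs ys i

contents-beyond : ∀ xs {i} → length xs ≤ i → contents xs i ≡ 0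
contents-beyond []       h       = refl
contents-beyond (x ∷ xs) {suc i} (s≤s h) = contents-beyond xs h

contents-entries-< : ∀ {m d} .{{_ : NonZero m}} (u : Vec (Fin m) d) i → contents (entries u) i < m
contents-entries-< {m} []  i       = >-nonZero⁻¹ m
contents-entries-< (x ∷ u) zero    = toℕ<n x
contents-entries-< (x ∷ u) (suc i) = contents-entries-< u i

contents-++-< : ∀ {m} xs ys → (∀ i → contents xs i < m) → (∀ i → contents ys i < m) → ∀ i → contents (xs ++ ys) i < m
contents-++-< []       ys hx hy i       = hy i
contents-++-< (x ∷ xs) ys hx hy zero    = hx 0
contents-++-< (x ∷ xs) ys hx hy (suc i) = contents-++-< xs ys (λ j → hx (suc j)) hy i

length-flatten : ∀ {m n d} (us : Vec (Vec (Fin m) d) n) → length (flatten us) ≡ n * d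
length-flatten us = length-entries (Vec.concat us)

contents-flatten : ∀ {m n d} (us : Vec (Vec (Fin m) d) n) i p → p < d →
  contents (flatten us) (toℕ i * d + p) ≡ contents (entries (lookup us i)) p
contents-flatten {d = d} (u ∷ us) zero p h = trans (cong (λ xs → contents xs p) (flatten-∷ u us))
  (contents-++ˡ (entries u) (flatten us) (subst (p <_) (sym (length-entries u)) h))
contents-flatten {d = d} (u ∷ us) (suc i) p h = begin
  contents (flatten (u ∷ us)) (d + toℕ i * d + p)
    ≡⟨ cong₂ contents (flatten-∷ u us) (trans (+-assoc d (toℕ i * d) p) (cong (_+ (toℕ i * d + p)) (sym (length-entries u)))) ⟩
  contents (entries u ++ flatten us) (length (entries u) + (toℕ i * d + p))
    ≡⟨ contents-++ʳ (entries u) (flatten us) (toℕ i * d + p) ⟩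
  contents (flatten us) (toℕ i * d + p)
    ≡⟨ contents-flatten us i p h ⟩
  contents (entries (lookup us i)) p ∎
  where open ≡-Reasoning

sumOver : ∀ {A : Set} → List A → (A → ℕ) → ℕ
sumOver []       f = 0
sumOver (x ∷ xs) f = f x + sumOver xs f

sumOver-++ : ∀ {A : Set} (xs ys : List A) f → sumOver (xs ++ ys) f ≡ sumOver xs f + sumOver ys f
sumOver-++ []       ys f = refl
sumOver-++ (x ∷ xs) ys f = trans (cong (f x +_) (sumOver-++ xs ys f)) (sym (+-assoc (f x) _ _))

sumOver-map : ∀ {A B : Set} (g : A → B) xs f → sumOver (List.map g xs) f ≡ sumOver xs (λ x → f (g x))
sumOver-map g []       f = refl
sumOver-map g (x ∷ xs) f = cong (f (g x) +_) (sumOver-map g xs f)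

sumOver-concatMap : ∀ {A B : Set} (g : A → List B) xs f → sumOver (concatMap g xs) f ≡ sumOver xs (λ x → sumOver (g x) f)
sumOver-concatMap g []       f = refl
sumOver-concatMap g (x ∷ xs) f = trans (sumOver-++ (g x) (concatMap g xs) f) (cong (sumOver (g x) f +_) (sumOver-concatMap g xs f))

sumOver-cong : ∀ {A : Set} (xs : List A) {f g} → (∀ x → f x ≡ g x) → sumOver xs f ≡ sumOver xs g
sumOver-cong []       h = refl
sumOver-cong (x ∷ xs) h = cong₂ _+_ (h x) (sumOver-cong xs h)

indicator : ∀ {P : Set} → Dec P → ℕ
indicator p = if does p then 1 else 0

sumOver-filter : ∀ {A : Set} {P : A → Set} (P? : ∀ x → Dec (P x)) xs f →
  sumOver (filter P? xs) f ≡ sumOver xs (λ x → indicator (P? x) * f x)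
sumOver-filter P? []       f = refl
sumOver-filter P? (x ∷ xs) f with P? x
... | yes _ = cong₂ _+_ (sym (+-identityʳ (f x))) (sumOver-filter P? xs f)
... | no  _ = sumOver-filter P? xs f

length-sumOver : ∀ {A : Set} (xs : List A) → length xs ≡ sumOver xs (λ _ → 1)
length-sumOver []       = refl
length-sumOver (x ∷ xs) = cong suc (length-sumOver xs)

sumOver-tabulate : ∀ {A : Set} n (g : Fin n → A) f F → (∀ i → f (g i) ≡ F (toℕ i)) → sumOver (tabulate g) f ≡ ∑ n F
sumOver-tabulate zero    g f F h = refl
sumOver-tabulate (suc n) g f F h = trans (cong₂ _+_ (h zero) (sumOver-tabulate n (λ i → g (suc i)) f (λ i → F (suc i)) (λ i → h (suc i))))
  (sym (∑-bottom n F))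

sumOver-cartesianProduct : ∀ {A B : Set} (xs : List A) (ys : List B) f →
  sumOver (cartesianProduct xs ys) f ≡ sumOver xs (λ x → sumOver ys (λ y → f (x , y)))
sumOver-cartesianProduct []       ys f = refl
sumOver-cartesianProduct (x ∷ xs) ys f = trans (sumOver-++ (List.map (x ,_) ys) _ f)
  (cong₂ _+_ (sumOver-map (x ,_) ys f) (sumOver-cartesianProduct xs ys f))

length-filter-sumOver : ∀ {A : Set} {P : A → Set} (P? : ∀ x → Dec (P x)) xs →
  length (filter P? xs) ≡ sumOver xs (λ x → indicator (P? x))
length-filter-sumOver P? xs = trans (length-sumOver (filter P? xs))
  (trans (sumOver-filter P? xs (λ _ → 1)) (sumOver-cong xs λ x → *-identityʳ _))

#OV-∑ : ∀ m {n d} (us vs : Vec (Vec (Fin m) d) n) (F : ℕ → ℕ → ℕ) →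
  (∀ i j → F (toℕ i) (toℕ j) ≡ indicator (m ∣? ⟪ lookup us i , lookup vs j ⟫)) →
  #OV m us vs ≡ ∑ n (λ i → ∑ n (λ j → F i j))
#OV-∑ m {n} us vs F h = trans (length-filter-sumOver (λ (i , j) → m ∣? ⟪ lookup us i , lookup vs j ⟫) (cartesianProduct (allFin n) (allFin n)))
  (trans (sumOver-cartesianProduct (allFin n) (allFin n) _)
    (sumOver-tabulate n (λ i → i) _ _ λ i → sumOver-tabulate n (λ j → j) _ _ λ j → sym (h i j)))

-- The counting program

all-≤-sum : ∀ xs → All (_≤ sum xs) xs
all-≤-sum []       = []
all-≤-sum (x ∷ xs) = m≤m+n x (sum xs) ∷ All.map (λ h → ≤-trans h (m≤n+m (sum xs) x)) (all-≤-sum xs)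

∑-term : ∀ n f i → i < n → f i ≤ ∑ n f
∑-term (suc n) f i h with i ≟ n
... | yes refl = m≤m+n (f n) (∑ n f)
... | no  ne   = ≤-trans (∑-term n f i (≤∧≢⇒< (≤-pred h) ne)) (m≤n+m (∑ n f) (f n))

contents-≤ : ∀ {U xs} k → All (_≤ U) xs → contents xs k ≤ U
contents-≤ k       []      = z≤n
contents-≤ zero    (h ∷ _) = h
contents-≤ (suc k) (_ ∷ h) = contents-≤ k h

power : Program
power = const 21 1 ⨾ for 18 (arith mul 21 21 22)

module Power (U V : ℕ) (2≤U : 2 ≤ U) (U≤V : size U ≤ V) where
  open Costed U V 2≤U U≤V

  power-run : ∀ {s} b k .{{_ : NonZero b}} → reg s 2 ≡ 1 → reg s 22 ≡ b → reg s 18 ≡ k → k ≤ U → b ≤ U → b ^ k ≤ U →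
    (∀ a → mem s a ≤ U) → RunU power s (λ s → reg s 21 ≡ b ^ k) (1 + (k * 5 + 1))
  power-run b k h2 h22 h18 k≤U b≤U p≤U hM = seqU (block (const 21 1) [] refl [] (≤-trans (s≤s z≤n) 2≤U ∷ []) hM)
    λ { _ _ _ refl → weakenU (λ _ _ e → trans (sym (*-identityʳ _)) e) ≤-refl
      (forU 18 (arith mul 21 21 22) (λ j s → reg s 21 * b ^ j ≡ b ^ k) k k≤U h2 refl refl (λ h → h) h18 (+-identityʳ (b ^ k))
        λ j r′ M′ _ _ fr mf h → weakenU (λ { _ _ refl → trans (cong (λ z → r′ 21 * z * b ^ j) (trans (fr 22 refl) h22))
                                                   (trans (*-assoc (r′ 21) b (b ^ j)) h) }) ≤-refl
          (block (arith mul 21 21 22) (21 ∷ 22 ∷ []) refl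
            (≤-trans (m≤m*n (r′ 21) (b ^ suc j) {{m^n≢0 b (suc j)}}) (≤-trans (≤-reflexive h) p≤U)
              ∷ (trans (fr 22 refl) h22 ⊑ b≤U) ∷ []) [] λ a → ≤-trans (≤-reflexive (cong (λ M → M a) (mf refl))) (hM a))) }

addPath lookupPath finish : Program
addPath    = (arith add 21 9 16 ⨾ load 22 21 ⨾ arith add 22 22 17) ⨾ store 21 22
lookupPath = arith add 21 9 16 ⨾ load 22 21 ⨾ arith mul 22 22 17 ⨾ arith add 11 11 22
finish     = arith div 21 11 5 ⨾ arith mul 21 21 5 ⨾ arith sub 11 11 21
  ⨾ arith div 21 11 3 ⨾ arith mul 21 21 3 ⨾ arith sub 0 11 21

mod-op : ∀ x r .{{_ : NonZero r}} → x ∸ ⟦ div ⟧ x r * r ≡ x % r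
mod-op x r = trans (cong (λ q → x ∸ q * r) (div-op x r)) (sym (m%n≡m∸m/n*n x r))

∑²-split : ∀ n (f g : ℕ → ℕ → ℕ) X → ∑ n (λ i → ∑ n (λ j → f i j + g i j * X)) ≡
  ∑ n (λ i → ∑ n (f i)) + ∑ n (λ i → ∑ n (g i)) * X
∑²-split n f g X = trans (∑-cong n λ i _ → trans (∑-+ n (f i) _) (cong (∑ n (f i) +_) (∑-*ʳ n X (g i))))
  (trans (∑-+ n _ _) (cong (∑ n (λ i → ∑ n (f i)) +_) (∑-*ʳ n X _)))

-- The pairs with e i j ≡ 0 are counted by the least significant digit in radix X.
extract-count : ∀ {X m N n total} .{{_ : NonZero m}} .{{_ : NonZero N}} .{{_ : NonZero X}} → X ^ m ≡ suc N → X ≡ n * n + 2 →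
  (e : ℕ → ℕ → ℕ) → Congruence._≈_ N total (∑ n (λ i → ∑ n (λ j → X ^ e i j))) →
  total % N % X ≡ ∑ n (λ i → ∑ n (λ j → indicator (m ∣? e i j)))
extract-count {X} {m} {N} {n} {total} X^m≡ X≡ e h = begin
  total % N % X      ≡⟨ cong (_% X) (residue (≈-trans h (∑-≈ n λ i _ → ∑-≈ n λ j _ → ^-%-≈ (e i j)))) ⟩
  W % N % X          ≡⟨ cong (_% X) (m<n⇒m%n≡m W<N) ⟩
  W % X              ≡⟨ cong (_% X) W≡ ⟩
  (cnt + higher * X) % X ≡⟨ digit-% higher cnt<X ⟩
  cnt ∎
  where
  open ≡-Reasoning
  open Congruence N
  open Cyclic X m N X^m≡
  W cnt : ℕ
  W = ∑ n (λ i → ∑ n (λ j → X ^ (e i j % m)))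
  cnt = ∑ n (λ i → ∑ n (λ j → indicator (m ∣? e i j)))
  rest : ℕ → ℕ
  rest zero    = 0
  rest (suc k) = X ^ k
  higher : ℕ
  higher = ∑ n (λ i → ∑ n (λ j → rest (e i j % m)))
  term : ∀ k → X ^ (k % m) ≡ indicator (m ∣? k) + rest (k % m) * X
  term k with m ∣? k
  ... | yes d rewrite n∣m⇒m%n≡0 k m d = refl
  ... | no ¬d with k % m in eq
  ...   | zero  = contradiction (m%n≡0⇒n∣m k m eq) ¬d
  ...   | suc q = *-comm X (X ^ q)
  W≡ : W ≡ cnt + higher * X
  W≡ = trans (∑-cong n λ i _ → ∑-cong n λ j _ → term (e i j)) (∑²-split n _ _ X)
  indicator≤1 : ∀ {P : Set} (p : Dec P) → indicator p ≤ 1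
  indicator≤1 (yes _) = ≤-refl
  indicator≤1 (no _)  = z≤n
  cnt<X : cnt < X
  cnt<X = subst (cnt <_) (sym X≡) (≤-trans (s≤s (≤-trans (∑-≤ n (n * 1) λ i _ → ∑-≤ n 1 λ j _ → indicator≤1 (m ∣? e i j))
    (≤-reflexive (cong (n *_) (*-identityʳ n))))) (≤-trans (≤-reflexive (+-comm 1 (n * n))) (+-monoʳ-≤ (n * n) (s≤s z≤n))))
  W≤ : W ≤ n * (n * X ^ (m ∸ 1))
  W≤ = ∑-≤ n _ λ i _ → ∑-≤ n _ λ j _ → ^-monoʳ-≤ X (m<1+n⇒m≤n (subst (e i j % m <_) (sym (suc-pred m)) (m%n<n (e i j) m)))
  X^m-split : X ^ m ≡ n * (n * X ^ (m ∸ 1)) + 2 * X ^ (m ∸ 1)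
  X^m-split = trans (cong (X ^_) (sym (suc-pred m))) (trans (cong (_* X ^ (m ∸ 1)) X≡) (arrange n (X ^ (m ∸ 1))))
    where
    arrange : ∀ n p → (n * n + 2) * p ≡ n * (n * p) + 2 * p
    arrange = solve-∀
  -- There are n² powers, each at most X^(m-1), and X^m = (n² + 2) X^(m-1). Hence W + 2 ≤ X^m, which
  -- is W < X^m - 1: reduction modulo N leaves W intact.
  W<N : W < N
  W<N = ≤-pred (≤-trans (≤-reflexive (+-comm 2 W)) (≤-trans (+-mono-≤ W≤ (*-monoʳ-≤ 2 (m^n>0 X (m ∸ 1))))
    (≤-reflexive (trans (sym X^m-split) X^m≡))))

-- A factorization of the matrix x^⟨u,v⟩ on κ coordinates into two factors with r entries per row.
-- It is required for every X, since the program is fixed before n is known; the entries are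
-- expressions in x and -1.
record Table (m κ r : ℕ) : Set where
  field
    Z       : ℕ
    Z≥1     : 1 ≤ Z
    cdL cdR : ℕ → ℕ → ℕ
    exL exR : ℕ → ℕ → Expr
    cdL<Z   : ∀ a δ → δ < r → cdL a δ < Z
    cdR<Z   : ∀ a δ → δ < r → cdR a δ < Z
    kernel≈ : ∀ X N .{{_ : NonZero N}} → X ^ m ≡ suc N → (u v : Vec (Fin m) κ) →
      Congruence._≈_ N (kernel r cdL (λ a x → value X (N ∸ 1) (exL a x)) cdR (λ a x → value X (N ∸ 1) (exR a x)) (number u) (number v))
        (X ^ ⟪ u , v ⟫)

size-pow : ∀ a k c e P R → 1 ≤ P * R → size a ≤ c * P → k ≤ e * R → size (a ^ k) ≤ (1 + e * c) * (P * R)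
size-pow a k c e P R h ha hk = ≤-trans (size-^ a k) (≤-trans (+-mono-≤ h (*-mono-≤ hk ha)) (≤-reflexive (arrange c e P R)))
  where
  arrange : ∀ c e P R → P * R + e * R * (c * P) ≡ (1 + e * c) * (P * R)
  arrange = solve-∀

record Sized (P q c : ℕ) : Set where
  constructor sized
  field size-≤ : size q ≤ c * P

-- Asymptotic bounds with explicit constants: quantities are compared with c * P for a scale P that
-- depends on n and d and a constant c that does not. The scales used are S = 1 + d + log n, S r^B,
-- S n r^B and S².
module Multiples (P : ℕ) (1≤P : 1 ≤ P) where

  const-≤ : ∀ c → c ≤ c * P
  const-≤ c = m≤m*n c P {{>-nonZero 1≤P}}

  sum-≤ : ∀ {a b} c e → a ≤ c * P → b ≤ e * P → a + b ≤ (c + e) * P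
  sum-≤ c e h k = ≤-trans (+-mono-≤ h k) (≤-reflexive (sym (*-distribʳ-+ P c e)))

  size-sum-≤ : ∀ a b c e → size a ≤ c * P → size b ≤ e * P → size (a + b) ≤ (c + e) * P
  size-sum-≤ a b c e h k = ≤-trans (size-+ a b) (sum-≤ c e h k)

  size-product-≤ : ∀ a b c e → size a ≤ c * P → size b ≤ e * P → size (a * b) ≤ (c + e) * P
  size-product-≤ a b c e h k = ≤-trans (size-* a b) (sum-≤ c e h k)

  size-∑ : ∀ n f (c : ℕ → ℕ) → (∀ i → i < n → size (f i) ≤ c i * P) → size (∑ n f) ≤ (1 + ∑ n c) * P
  size-∑ zero    f c h = const-≤ 1
  size-∑ (suc n) f c h = ≤-trans (size-sum-≤ (f n) (∑ n f) (c n) (1 + ∑ n c) (h n ≤-refl) (size-∑ n f c λ i q → h i (m≤n⇒m≤1+n q)))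
    (≤-reflexive (cong (_* P) (+-suc (c n) (∑ n c))))

  size-list-≤ : ∀ {qs cs} → Pointwise (Sized P) qs cs → size (sum qs) ≤ suc (sum cs) * P
  size-list-≤ [] = const-≤ 1
  size-list-≤ {q ∷ qs} {c ∷ cs} (sized h ∷ hs) = ≤-trans (size-sum-≤ q (sum qs) c (suc (sum cs)) h (size-list-≤ hs))
    (≤-reflexive (cong (_* P) (+-suc c (sum cs))))

size-≤-suc : ∀ x → size x ≤ suc x
size-≤-suc x = size-< {x} (≤-trans (n<2^n x) (^-monoʳ-≤ 2 (n≤1+n x))) (s≤s z≤n)
  where
  n<2^n : ∀ n → n < 2 ^ n
  n<2^n zero    = s≤s z≤n
  n<2^n (suc n) = ≤-trans (+-mono-≤ (m^n>0 2 n) (n<2^n n)) (≤-reflexive (cong (2 ^ n +_) (sym (+-identityʳ (2 ^ n)))))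

blocks≥ : ∀ d κ .{{_ : NonZero κ}} → d ≤ (d + (κ ∸ 1)) / κ * κ
blocks≥ d κ = +-cancelʳ-≤ (κ ∸ 1) d _ (begin
  d + (κ ∸ 1)                                      ≡⟨ m≡m%n+[m/n]*n (d + (κ ∸ 1)) κ ⟩
  (d + (κ ∸ 1)) % κ + (d + (κ ∸ 1)) / κ * κ        ≤⟨ +-monoˡ-≤ _ (m<1+n⇒m≤n (subst ((d + (κ ∸ 1)) % κ <_) (sym (suc-pred κ)) (m%n<n (d + (κ ∸ 1)) κ))) ⟩
  (κ ∸ 1) + (d + (κ ∸ 1)) / κ * κ                  ≡⟨ +-comm (κ ∸ 1) _ ⟩
  (d + (κ ∸ 1)) / κ * κ + (κ ∸ 1)                  ∎)
  where open ≤-Reasoning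

blocks≤ : ∀ d κ .{{_ : NonZero κ}} → (d + (κ ∸ 1)) / κ * κ ≤ d + κ
blocks≤ d κ = ≤-trans (m/n*n≤m (d + (κ ∸ 1)) κ) (+-monoʳ-≤ d (m∸n≤m κ 1))

module Machine {m κ r : ℕ} .{{_ : NonZero m}} .{{_ : NonZero κ}} .{{_ : NonZero r}} (tbl : Table m κ r) where

  open Table tbl

  instance
    Z-nonZero : NonZero Z
    Z-nonZero = >-nonZero Z≥1

  Q half tabSize : ℕ
  Q = m ^ κ
  half = Q * r + Q * r
  tabSize = half + half

  -- Entry δ of the row of letter a takes two cells, code and coefficient; the
  -- right rows follow the left ones.
  cell : ℕ → ℕ → ℕ → Expr
  cell zero    a δ = lit (if a <ᵇ Q then cdL a δ else cdR (a ∸ Q) δ)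
  cell (suc _) a δ = if a <ᵇ Q then exL a δ else exR (a ∸ Q) δ

  table : ℕ → Expr
  table j = cell (j % 2) (j / 2 / r) (j / 2 % r)

  open Code m κ r Z

  init₁ init₂ init₃ initialise rightTable program : Program
  init₁ = const 2 1 ⨾ arith mul 3 0 0 ⨾ const 21 2 ⨾ arith add 3 3 21 ⨾ arith mul 22 3 2 ⨾ const 18 m
  init₂ = arith sub 5 21 2 ⨾ arith sub 4 5 2
    ⨾ const 21 (κ ∸ 1) ⨾ arith add 6 1 21 ⨾ const 21 κ ⨾ arith div 6 6 21 ⨾ const 22 r ⨾ arith mul 18 6 2
  init₃ = arith mul 7 21 2 ⨾ arith mul 8 0 1 ⨾ arith add 8 8 8 ⨾ const 21 tabSize ⨾ arith add 9 8 21
    ⨾ const 10 0 ⨾ const 11 0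
  rightTable = const 21 half ⨾ arith add 8 8 21 ⨾ arith mul 10 0 1
  initialise = init₁ ⨾ power ⨾ init₂ ⨾ power ⨾ init₃
  program = initialise ⨾ fillTable tabSize table
    ⨾ sweep addPath ⨾ rightTable ⨾ sweep lookupPath ⨾ finish

  cell-index : ∀ {κ₀} a δ → δ < r → κ₀ < 2 → table (κ₀ + (δ + a * r) * 2) ≡ cell κ₀ a δ
  cell-index {κ₀} a δ hδ hκ = begin
    cell (j % 2) (j / 2 / r) (j / 2 % r)
      ≡⟨ cong₂ (λ x y → cell x (y / r) (y % r)) (digit-% (δ + a * r) hκ) (digit-/ (δ + a * r) hκ) ⟩
    cell κ₀ ((δ + a * r) / r) ((δ + a * r) % r)
      ≡⟨ cong₂ (cell κ₀) (digit-/ a hδ) (digit-% a hδ) ⟩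
    cell κ₀ a δ ∎
    where
    open ≡-Reasoning
    j = κ₀ + (δ + a * r) * 2

  <ᵇ-true : ∀ {x y} → x < y → (x <ᵇ y) ≡ true
  <ᵇ-true {x} {y} h with x <ᵇ y | <⇒<ᵇ h
  ... | true | _ = refl

  <ᵇ-false : ∀ {x y} → y ≤ x → (x <ᵇ y) ≡ false
  <ᵇ-false {x} {y} h with x <ᵇ y in eq
  ... | true  = contradiction (<ᵇ⇒< x y (subst T (sym eq) tt)) (≤⇒≯ h)
  ... | false = refl

  walkConst sweepConst : ℕ → ℕ
  walkConst t = (6 + (κ * (stepUnits + 3) + 1)) + t + 3
  sweepConst t = 2 + ((7 + (walkConst t + 1) + 3) + 1)

  initialConst programConst : ℕ
  initialConst = units init₁ (live (0 ∷ [])) + (m * 5 + units init₂ (live (1 ∷ 2 ∷ 21 ∷ [])) + 4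
    + units init₃ (live (0 ∷ 1 ∷ 2 ∷ 21 ∷ []))) + κ * 5
  programConst = initialConst + (fillUnits tabSize table + (sweepConst 9
    + (units rightTable (live (0 ∷ 1 ∷ 8 ∷ [])) + (sweepConst 10 + units finish (live (3 ∷ 5 ∷ 11 ∷ []))))))

  powConst codeConst cellConst pathConst boundConst : ℕ
  powConst   = 1 + m * 4
  codeConst  = 4 + size tabSize + (1 + κ * size Z)
  cellConst  = 1 + (1 + ∑ tabSize (λ j → weight (table j) * powConst))
  pathConst  = 1 + κ * cellConst
  boundConst = 1 + ((1 + κ * size r) + pathConst)

  -- In the order of `quantities` below: the bit length of each of them, as a multiple of (1 + d +
  -- log n)².
  sizeConsts : List ℕ
  sizeConsts = 2 ∷ size m ∷ size κ ∷ size r ∷ size Z ∷ 1 ∷ 1 + size κ ∷ powConst ∷ 1 + κ * size r ∷ codeConst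
    ∷ size (m ^ κ) ∷ cellConst ∷ pathConst ∷ boundConst ∷ 1 + ((1 + κ * size r) + (pathConst + boundConst)) ∷ []

  engineConst : ℕ
  engineConst = programConst * suc (sum sizeConsts)

  -- X plays the role of x in ℤ[x]/(x^m − 1), modelled by the integers modulo
  -- N = X^m − 1, and Y that of −1.  As n² + 1 < X, coefficients do not overflow.
  module Execution {n d} .{{_ : NonZero n}} (us vs : Vec (Vec (Fin m) d) n) where

    inp : ℕ → ℕ
    inp = contents (flatten us ++ flatten vs)

    inp<m : ∀ a → inp a < m
    inp<m = contents-++-< (flatten us) (flatten vs) (contents-entries-< (Vec.concat us)) (contents-entries-< (Vec.concat vs))

    length-inp : length (flatten us ++ flatten vs) ≡ n * d + n * d
    length-inp = trans (length-++ (flatten us)) (cong₂ _+_ (length-flatten us) (length-flatten vs))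

    inp-zero : ∀ a → n * d + n * d ≤ a → inp a ≡ 0
    inp-zero a h = contents-beyond (flatten us ++ flatten vs) (subst (_≤ a) (sym length-inp) h)

    X N Y B pw base tb : ℕ
    X    = n * n + 2
    N    = X ^ m ∸ 1
    Y    = N ∸ 1
    B    = (d + (κ ∸ 1)) / κ
    pw   = r ^ B
    base = n * d + n * d
    tb   = base + tabSize

    cfL cfR xL xR : ℕ → ℕ → ℕ
    cfL a δ = value X Y (exL a δ)
    cfR a δ = value X Y (exR a δ)
    xL i p = inp (0 + i * d + p)
    xR i p = inp (n * d + i * d + p)

    cells : ℕ → ℕ
    cells j = value X Y (table j)

    G : ℕ
    G = suc (∑ tabSize cells)

    -- Bounds for the addresses, for a cell after all paths of the uᵢ are stored, and for the
    -- accumulated result. No path has a coefficient above G ^ B.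
    codeBound cellBound totalBound : ℕ
    codeBound  = base + tabSize + Z ^ B
    cellBound  = n * (pw * G ^ B)
    totalBound = n * (pw * (G ^ B * cellBound))

    quantities : List ℕ
    quantities = 2 ∷ m ∷ κ ∷ r ∷ Z ∷ n ∷ d + κ ∷ X ^ m ∷ pw ∷ codeBound ∷ m ^ κ ∷ G ∷ G ^ B ∷ cellBound ∷ totalBound ∷ []

    instance
      X-nonZero : NonZero X
      X-nonZero = >-nonZero (≤-trans (s≤s z≤n) (m≤n+m 2 (n * n)))

    X≤X^m : X ≤ X ^ m
    X≤X^m = ≤-trans (≤-reflexive (sym (*-identityʳ X))) (^-monoʳ-≤ X (>-nonZero⁻¹ m))

    X^m≡ : X ^ m ≡ suc N
    X^m≡ = sym (m+[n∸m]≡n (m^n>0 X m))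

    instance
      N-nonZero : NonZero N
      N-nonZero = >-nonZero (∸-monoˡ-≤ 1 (≤-trans (m≤n+m 2 (n * n)) X≤X^m))

    open Congruence N

    dot : ℕ → ℕ → ℕ
    dot i j = ∑ d λ p → xL i p * xR j p

    S : ℕ
    S = 1 + d + ⌊log₂ n ⌋

    B≤ : B ≤ κ * S
    B≤ = ≤-trans (m/n≤m (d + (κ ∸ 1)) κ) (≤-trans (+-monoʳ-≤ d (m∸n≤m κ 1)) (≤-trans (lem d κ)
      (*-monoʳ-≤ κ (m≤m+n (1 + d) ⌊log₂ n ⌋))))
      where
      lem : ∀ d k .{{_ : NonZero k}} → d + k ≤ k * (1 + d)
      lem d k = ≤-trans (+-monoˡ-≤ k (m≤n*m d k)) (≤-reflexive (trans (+-comm (k * d) k) (sym (*-suc k d))))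

    1≤S : 1 ≤ S
    1≤S = s≤s z≤n

    1≤pw : 1 ≤ pw
    1≤pw = m^n>0 r B

    work : ℕ
    work = S * (n * pw)

    1≤work : 1 ≤ work
    1≤work = *-mono-≤ 1≤S (*-mono-≤ (>-nonZero⁻¹ n) 1≤pw)

    S≤work : S ≤ work
    S≤work = ≤-trans (≤-reflexive (sym (*-identityʳ S))) (*-monoʳ-≤ S (*-mono-≤ (>-nonZero⁻¹ n) 1≤pw))

    1≤Spw : 1 ≤ S * pw
    1≤Spw = *-mono-≤ 1≤S 1≤pw

    paths-cost : ∀ t → pw * ((6 + (B * (stepUnits + 3) + 1)) + t + 3) ≤ walkConst t * (S * pw)
    paths-cost t = ≤-trans (*-monoʳ-≤ pw
        (sum-≤ (6 + (κ * (stepUnits + 3) + 1) + t) 3 (sum-≤ (6 + (κ * (stepUnits + 3) + 1)) t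
          (sum-≤ 6 (κ * (stepUnits + 3) + 1) (const-≤ 6) (sum-≤ (κ * (stepUnits + 3)) 1 steps (const-≤ 1))) (const-≤ t)) (const-≤ 3)))
      (≤-reflexive (arrange pw (walkConst t) S))
      where
      open Multiples S 1≤S
      arrange : ∀ p c S → p * (c * S) ≡ c * (S * p)
      arrange = solve-∀
      arrange₂ : ∀ k S c → k * S * c ≡ k * c * S
      arrange₂ = solve-∀
      steps : B * (stepUnits + 3) ≤ κ * (stepUnits + 3) * S
      steps = ≤-trans (*-monoˡ-≤ (stepUnits + 3) B≤) (≤-reflexive (arrange₂ κ S (stepUnits + 3)))

    rows-cost : ∀ t → n * (7 + (pw * ((6 + (B * (stepUnits + 3) + 1)) + t + 3) + 1) + 3) ≤ (7 + (walkConst t + 1) + 3) * work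
    rows-cost t = ≤-trans (*-monoʳ-≤ n (sum-≤ (7 + (walkConst t + 1)) 3 (sum-≤ 7 (walkConst t + 1) (const-≤ 7)
        (sum-≤ (walkConst t) 1 (paths-cost t) (const-≤ 1))) (const-≤ 3)))
      (≤-reflexive (arrange n (7 + (walkConst t + 1) + 3) S pw))
      where
      open Multiples (S * pw) 1≤Spw
      arrange : ∀ n c S p → n * (c * (S * p)) ≡ c * (S * (n * p))
      arrange = solve-∀

    open Multiples work 1≤work

    sweep-cost : ∀ t → 2 + (n * (7 + (pw * ((6 + (B * (stepUnits + 3) + 1)) + t + 3) + 1) + 3) + 1) ≤ sweepConst t * work
    sweep-cost t = sum-≤ 2 (7 + (walkConst t + 1) + 3 + 1) (const-≤ 2) (sum-≤ (7 + (walkConst t + 1) + 3) 1 (rows-cost t) (const-≤ 1))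

    gather : ∀ a b c e f g A C F → a ≤ A * work → c ≤ C * work → f ≤ F * work →
      a + (b + (c + (e + (f + g)))) ≤ (A + (b + (C + (e + (F + g))))) * work
    gather a b c e f g A C F ha hc hf = sum-≤ A (b + (C + (e + (F + g)))) ha (sum-≤ b (C + (e + (F + g))) (const-≤ b)
      (sum-≤ C (e + (F + g)) hc (sum-≤ e (F + g) (const-≤ e) (sum-≤ F g hf (const-≤ g)))))

    size-n : size n ≤ 1 * S
    size-n = ≤-trans (s≤s (m≤n+m ⌊log₂ n ⌋ d)) (≤-reflexive (sym (*-identityˡ S)))

    size-d : size d ≤ 1 * S
    size-d = ≤-trans (size-≤-suc d) (≤-trans (m≤m+n (suc d) ⌊log₂ n ⌋) (≤-reflexive (sym (*-identityˡ S))))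

    size-X : size X ≤ 4 * S
    size-X = Multiples.size-sum-≤ S 1≤S (n * n) 2 2 2 (Multiples.size-product-≤ S 1≤S n n 1 1 size-n size-n) (Multiples.const-≤ S 1≤S 2)

    size-X^m : size (X ^ m) ≤ powConst * S
    size-X^m = ≤-trans (size-pow X m 4 m S 1 (≤-trans 1≤S (≤-reflexive (sym (*-identityʳ S)))) size-X (≤-reflexive (sym (*-identityʳ m))))
      (≤-reflexive (cong (powConst *_) (*-identityʳ S)))

    size-^B : ∀ a → size (a ^ B) ≤ (1 + κ * size a) * S
    size-^B a = ≤-trans (size-pow a B (size a) κ 1 S (≤-trans 1≤S (≤-reflexive (sym (*-identityˡ S)))) (≤-reflexive (sym (*-identityʳ (size a)))) B≤)
      (≤-reflexive (cong ((1 + κ * size a) *_) (*-identityˡ S)))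

    size-cells : ∀ j → size (cells j) ≤ weight (table j) * powConst * S
    size-cells j = ≤-trans (value-size (table j) (size≥1 (X ^ m)) (size-mono X≤X^m) (size-mono (≤-trans (m∸n≤m N 1) (m∸n≤m (X ^ m) 1))))
      (≤-trans (*-monoʳ-≤ (weight (table j)) size-X^m) (≤-reflexive (sym (*-assoc (weight (table j)) powConst S))))

    size-G : size G ≤ cellConst * S
    size-G = Multiples.size-sum-≤ S 1≤S 1 (∑ tabSize cells) 1 (1 + ∑ tabSize (λ j → weight (table j) * powConst)) (Multiples.const-≤ S 1≤S 1)
      (Multiples.size-∑ S 1≤S tabSize cells (λ j → weight (table j) * powConst) λ j _ → size-cells j)

    1≤S² : 1 ≤ S * S
    1≤S² = *-mono-≤ 1≤S 1≤S

    square : ∀ c {x} → x ≤ c * S → x ≤ c * (S * S)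
    square c h = ≤-trans h (*-monoʳ-≤ c (≤-trans (≤-reflexive (sym (*-identityʳ S))) (*-monoʳ-≤ S 1≤S)))

    -- The square comes from G ^ B: there are O(S) blocks, and G, a sum of fixed expressions in X
    -- and Y, has O(S) bits. The sum of all quantities later serves as the common bound U.
    size-largest : size (sum quantities) ≤ suc (sum sizeConsts) * (S * S)
    size-largest = Q.size-list-≤ {quantities} {sizeConsts}
      ( sized (Q.const-≤ 2) ∷ sized (Q.const-≤ (size m)) ∷ sized (Q.const-≤ (size κ)) ∷ sized (Q.const-≤ (size r))
      ∷ sized (Q.const-≤ (size Z)) ∷ sized hn ∷ sized (Q.size-sum-≤ d κ 1 (size κ) (square 1 size-d) (Q.const-≤ (size κ)))
      ∷ sized (square powConst size-X^m) ∷ sized hpw ∷ sized hcode ∷ sized (Q.const-≤ (size (m ^ κ)))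
      ∷ sized (square cellConst size-G) ∷ sized hG ∷ sized hcell
      ∷ sized (Q.size-product-≤ n (pw * (G ^ B * cellBound)) 1 ((1 + κ * size r) + (pathConst + boundConst)) hn
          (Q.size-product-≤ pw (G ^ B * cellBound) (1 + κ * size r) (pathConst + boundConst) hpw
            (Q.size-product-≤ (G ^ B) cellBound pathConst boundConst hG hcell)))
      ∷ [])
      where
      module Q = Multiples (S * S) 1≤S²
      hn : size n ≤ 1 * (S * S)
      hn = square 1 size-n
      hpw : size pw ≤ (1 + κ * size r) * (S * S)
      hpw = square (1 + κ * size r) (size-^B r)
      hnd : size (n * d) ≤ 2 * (S * S)
      hnd = Q.size-product-≤ n d 1 1 hn (square 1 size-d)
      hcode : size codeBound ≤ codeConst * (S * S)
      hcode = Q.size-sum-≤ (base + tabSize) (Z ^ B) (4 + size tabSize) (1 + κ * size Z)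
        (Q.size-sum-≤ base tabSize 4 (size tabSize) (Q.size-sum-≤ (n * d) (n * d) 2 2 hnd hnd) (Q.const-≤ (size tabSize)))
        (square (1 + κ * size Z) (size-^B Z))
      hG : size (G ^ B) ≤ pathConst * (S * S)
      hG = size-pow G B cellConst κ S S 1≤S² size-G B≤
      hcell : size cellBound ≤ boundConst * (S * S)
      hcell = Q.size-product-≤ n (pw * G ^ B) 1 ((1 + κ * size r) + pathConst) hn
        (Q.size-product-≤ pw (G ^ B) (1 + κ * size r) pathConst hpw hG)

    module Bounded (U V : ℕ) (bounds : All (_≤ U) quantities) (U≤V : size U ≤ V) where

      bound : ∀ k {x} → contents quantities k ≡ x → x ≤ U
      bound k refl = contents-≤ k bounds

      2≤U : 2 ≤ U
      2≤U = bound 0 refl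
      m≤U : m ≤ U
      m≤U = bound 1 refl
      κ≤U : κ ≤ U
      κ≤U = bound 2 refl
      r≤U : r ≤ U
      r≤U = bound 3 refl
      Z≤U : Z ≤ U
      Z≤U = bound 4 refl
      n≤U : n ≤ U
      n≤U = bound 5 refl
      d+κ≤U : d + κ ≤ U
      d+κ≤U = bound 6 refl
      X^m≤U : X ^ m ≤ U
      X^m≤U = bound 7 refl
      pw≤U : pw ≤ U
      pw≤U = bound 8 refl
      codeBound≤U : codeBound ≤ U
      codeBound≤U = bound 9 refl
      Q≤U : Q ≤ U
      Q≤U = bound 10 refl
      G≤U : G ≤ U
      G≤U = bound 11 refl
      G^B≤U : G ^ B ≤ U
      G^B≤U = bound 12 refl
      cellBound≤U : cellBound ≤ U
      cellBound≤U = bound 13 refl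
      totalBound≤U : totalBound ≤ U
      totalBound≤U = bound 14 refl

      1≤U : 1 ≤ U
      1≤U = ≤-trans (s≤s z≤n) 2≤U
      B≤U : B ≤ U
      B≤U = ≤-trans (m/n≤m (d + (κ ∸ 1)) κ) (≤-trans (+-monoʳ-≤ d (m∸n≤m κ 1)) d+κ≤U)
      d≤U : d ≤ U
      d≤U = ≤-trans (m≤m+n d κ) d+κ≤U
      tb≤U : tb ≤ U
      tb≤U = ≤-trans (m≤m+n tb (Z ^ B)) codeBound≤U
      base≤U : base ≤ U
      base≤U = ≤-trans (m≤m+n base tabSize) tb≤U
      nd≤U : n * d ≤ U
      nd≤U = ≤-trans (m≤m+n (n * d) (n * d)) base≤U
      Z^B≤U : Z ^ B ≤ U
      Z^B≤U = ≤-trans (m≤n+m (Z ^ B) tb) codeBound≤U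
      rightTab≤U : base + half ≤ U
      rightTab≤U = ≤-trans (+-monoʳ-≤ base (m≤m+n half half)) tb≤U

      row< : ∀ {i p} → i < n → p < d → i * d + p < n * d
      row< {i} {p} hi hp = subst (_< n * d) (+-comm p (i * d)) (digit-< hp hi)

      index< : ∀ {κ₀ a δ} → a < Q + Q → δ < r → κ₀ < 2 → κ₀ + (δ + a * r) * 2 < tabSize
      index< {κ₀} {a} {δ} ha hδ hκ = subst (κ₀ + (δ + a * r) * 2 <_) (arrange Q r) (digit-< hκ (digit-< hδ ha))
        where
        arrange : ∀ Q r → (Q + Q) * r * 2 ≡ Q * r + Q * r + (Q * r + Q * r)
        arrange = solve-∀

      indexL : ∀ a δ → base + ((a * r + δ) + (a * r + δ)) ≡ base + (0 + (δ + a * r) * 2)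
      indexL a δ = arrange base (a * r) δ
        where
        arrange : ∀ b x δ → b + ((x + δ) + (x + δ)) ≡ b + (0 + (δ + x) * 2)
        arrange = solve-∀

      indexR : ∀ a δ → base + half + ((a * r + δ) + (a * r + δ)) ≡ base + (0 + (δ + (a + Q) * r) * 2)
      indexR a δ = arrange base Q r a δ
        where
        arrange : ∀ b Q r a δ → b + (Q * r + Q * r) + ((a * r + δ) + (a * r + δ)) ≡ b + (0 + (δ + (a + Q) * r) * 2)
        arrange = solve-∀

      next : ∀ {x} j → x ≡ base + (0 + j) → x + 1 ≡ base + (1 + j)
      next j refl = trans (+-assoc base j 1) (cong (base +_) (+-comm j 1))

      record Stored (M : ℕ → ℕ) : Set where
        field
          inputs : ∀ a → a < base → M a ≡ inp a
          tables : ∀ j → j < tabSize → M (base + j) ≡ cells j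

      cells-codeL : ∀ a δ → a < Q → δ < r → cells (0 + (δ + a * r) * 2) ≡ cdL a δ
      cells-codeL a δ ha hδ rewrite cell-index {0} a δ hδ (s≤s z≤n) | <ᵇ-true ha = refl

      cells-coefL : ∀ a δ → a < Q → δ < r → cells (1 + (δ + a * r) * 2) ≡ cfL a δ
      cells-coefL a δ ha hδ rewrite cell-index {1} a δ hδ (s≤s (s≤s z≤n)) | <ᵇ-true ha = refl

      cells-codeR : ∀ a δ → δ < r → cells (0 + (δ + (a + Q) * r) * 2) ≡ cdR a δ
      cells-codeR a δ hδ rewrite cell-index {0} (a + Q) δ hδ (s≤s z≤n) | <ᵇ-false (m≤n+m Q a) | m+n∸n≡m a Q = refl

      cells-coefR : ∀ a δ → δ < r → cells (1 + (δ + (a + Q) * r) * 2) ≡ cfR a δ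
      cells-coefR a δ hδ rewrite cell-index {1} (a + Q) δ hδ (s≤s (s≤s z≤n)) | <ᵇ-false (m≤n+m Q a) | m+n∸n≡m a Q = refl

      cells≤G : ∀ {j} → j < tabSize → cells j ≤ G
      cells≤G {j} h = m≤n⇒m≤1+n (∑-term tabSize cells j h)

      cfL≤G : ∀ a δ → a < Q → δ < r → cfL a δ ≤ G
      cfL≤G a δ ha hδ = ≤-trans (≤-reflexive (sym (cells-coefL a δ ha hδ))) (cells≤G (index< (≤-trans ha (m≤m+n Q Q)) hδ (s≤s (s≤s z≤n))))

      cfR≤G : ∀ a δ → a < Q → δ < r → cfR a δ ≤ G
      cfR≤G a δ ha hδ = ≤-trans (≤-reflexive (sym (cells-coefR a δ hδ))) (cells≤G (index< (+-monoˡ-< Q ha) hδ (s≤s (s≤s z≤n))))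

      inside : ∀ {j} → j < tabSize → base + j ≤ U
      inside h = ≤-trans (+-monoʳ-≤ base (<⇒≤ h)) tb≤U

      leftData rightData : SweepData m κ r Z
      leftData = record
        { U = U ; V = V ; 2≤U = 2≤U ; U≤V = U≤V ; n = n ; d = d ; B = B ; pw = pw ; tabA = base ; tb = tb ; vec = 0
        ; x = xL ; cd = cdL ; cf = cfL ; G = G ; x<m = λ i p → inp<m _ ; cd<Z = cdL<Z ; cf≤G = cfL≤G ; 1≤G = s≤s z≤n
        ; m≤U = m≤U ; κ≤U = κ≤U ; r≤U = r≤U ; Z≤U = Z≤U ; n≤U = n≤U ; d≤U = d≤U ; B≤U = B≤U ; pw≤U = pw≤U
        ; tabA≤U = base≤U ; tb≤U = tb≤U ; vec≤U = z≤n
        ; entry≤U = λ a δ ha hδ → ≤-trans (≤-reflexive (indexL a δ)) (inside (index< (≤-trans ha (m≤m+n Q Q)) hδ (s≤s z≤n)))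
        ; row≤U = λ i h → ≤-trans (*-monoˡ-≤ d (<⇒≤ h)) nd≤U
        ; Q≤U = Q≤U ; Z^B≤U = Z^B≤U ; G^B≤U = G^B≤U }
      rightData = record
        { U = U ; V = V ; 2≤U = 2≤U ; U≤V = U≤V ; n = n ; d = d ; B = B ; pw = pw ; tabA = base + half ; tb = tb ; vec = n * d
        ; x = xR ; cd = cdR ; cf = cfR ; G = G ; x<m = λ i p → inp<m _ ; cd<Z = cdR<Z ; cf≤G = cfR≤G ; 1≤G = s≤s z≤n
        ; m≤U = m≤U ; κ≤U = κ≤U ; r≤U = r≤U ; Z≤U = Z≤U ; n≤U = n≤U ; d≤U = d≤U ; B≤U = B≤U ; pw≤U = pw≤U
        ; tabA≤U = rightTab≤U ; tb≤U = tb≤U ; vec≤U = nd≤U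
        ; entry≤U = λ a δ ha hδ → ≤-trans (≤-reflexive (indexR a δ)) (inside (index< (+-monoˡ-< Q ha) hδ (s≤s z≤n)))
        ; row≤U = λ i h → ≤-trans (+-monoʳ-≤ (n * d) (*-monoˡ-≤ d (<⇒≤ h))) base≤U
        ; Q≤U = Q≤U ; Z^B≤U = Z^B≤U ; G^B≤U = G^B≤U }

      module Left  = Sweep m κ r Z leftData
      module Right = Sweep m κ r Z rightData

      cellSum : ℕ → ℕ
      cellSum z = ∑ n λ i → ∑ pw λ c → δ (Left.code i c) z * Left.coef i c

      total : ℕ
      total = ∑ n λ i → ∑ pw λ c → Right.coef i c * cellSum (Right.code i c)

      cellSum≤ : ∀ z → cellSum z ≤ cellBound
      cellSum≤ z = ∑-≤ n _ λ i hi → ∑-≤ pw _ λ c _ →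
        ≤-trans (*-mono-≤ (δ≤1 (Left.code i c) z) (Left.Row.coef≤G^B i hi c)) (≤-reflexive (+-identityʳ _))

      total≤U : total ≤ U
      total≤U = ≤-trans (∑-≤ n _ λ i hi → ∑-≤ pw _ λ c _ → *-mono-≤ (Right.Row.coef≤G^B i hi c) (cellSum≤ (Right.code i c))) totalBound≤U

      -- What a cell holds and what is still to be added make up its final value. Being an identity
      -- of natural numbers for every z, it also bounds each cell throughout the sweep. It holds at
      -- the start because memory beyond the input is zero.
      Pending : (ℕ → ℕ) → (ℕ → ℕ) → Set
      Pending R M = Stored M × (∀ z → M (tb + z) + R z ≡ cellSum z)

      bounded : ∀ {R M} → Pending R M → ∀ a → M a ≤ U
      bounded {R} {M} (st , h) a with a <? base
      ... | yes p = ≤-trans (≤-reflexive (Stored.inputs st a p)) (≤-trans (<⇒≤ (inp<m a)) m≤U)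
      ... | no ¬p with a ∸ base <? tabSize
      ...   | yes q = ≤-trans (≤-reflexive (trans (cong M (sym (m+[n∸m]≡n (≮⇒≥ ¬p)))) (Stored.tables st (a ∸ base) q)))
                        (≤-trans (cells≤G q) G≤U)
      ...   | no ¬q = ≤-trans (≤-trans (≤-reflexive (cong M (sym split))) (m≤m+n (M (tb + z)) (R z)))
                        (≤-trans (≤-reflexive (h z)) (≤-trans (cellSum≤ z) cellBound≤U))
        where
        z : ℕ
        z = a ∸ base ∸ tabSize
        split : tb + z ≡ a
        split = trans (+-assoc base tabSize z) (trans (cong (base +_) (m+[n∸m]≡n (≮⇒≥ ¬q))) (m+[n∸m]≡n (≮⇒≥ ¬p)))

      okL : ∀ {R M} → Pending R M → Left.OK M
      okL {R} {M} p@(st , _) = record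
        { bounded = bounded p
        ; coord   = λ i q hi hq → Stored.inputs st _ (≤-trans (row< hi hq) (m≤m+n (n * d) (n * d)))
        ; codes   = λ a δ ha hδ → trans (cong M (indexL a δ)) (trans (Stored.tables st _ (index< (≤-trans ha (m≤m+n Q Q)) hδ (s≤s z≤n)))
                      (cells-codeL a δ ha hδ))
        ; coefs   = λ a δ ha hδ → trans (cong M (next _ (indexL a δ))) (trans (Stored.tables st _ (index< (≤-trans ha (m≤m+n Q Q)) hδ (s≤s (s≤s z≤n))))
                      (cells-coefL a δ ha hδ)) }

      okR : ∀ {R M} → Pending R M → Right.OK M
      okR {R} {M} p@(st , _) = record
        { bounded = bounded p
        ; coord   = λ i q hi hq → Stored.inputs st _ (subst (_< base) (sym (+-assoc (n * d) (i * d) q)) (+-monoʳ-< (n * d) (row< hi hq)))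
        ; codes   = λ a δ ha hδ → trans (cong M (indexR a δ)) (trans (Stored.tables st _ (index< (+-monoˡ-< Q ha) hδ (s≤s z≤n)))
                      (cells-codeR a δ hδ))
        ; coefs   = λ a δ ha hδ → trans (cong M (next _ (indexR a δ))) (trans (Stored.tables st _ (index< (+-monoˡ-< Q ha) hδ (s≤s (s≤s z≤n))))
                      (cells-coefR a δ hδ)) }

      open Costed U V 2≤U U≤V
      open Power U V 2≤U U≤V

      addPath-run : ∀ {r′ M} i c R → i < n → c < pw → r′ 9 ≡ tb → r′ 16 ≡ Left.code i c → r′ 17 ≡ Left.coef i c →
        Pending (λ z → δ (Left.code i c) z * Left.coef i c + R z) M →
        RunU addPath ⟨ r′ , M ⟩ (λ s → Pending R (mem s)) 9
      addPath-run {r′} {M} i c R hi hc h9 h16 h17 pend@(st , h) = seqU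
        (block (arith add 21 9 16 ⨾ load 22 21 ⨾ arith add 22 22 17) (9 ∷ 16 ∷ 17 ∷ []) refl
          ((h9 ⊑ tb≤U) ∷ (h16 ⊑ ≤-trans (<⇒≤ (Left.Row.code<Z^B i hi c)) Z^B≤U)
            ∷ (h17 ⊑ ≤-trans (Left.Row.coef≤G^B i hi c) G^B≤U) ∷ []) [] (bounded pend))
        λ { _ _ _ refl → timed (_ , _ , ⇓store , (record { inputs = inputs′ ; tables = tables′ } , cells′) ,
              +-mono-≤ (sz addr≤U) (≤-trans (sz new≤U) (m≤m+n V 0))) }
        where
        k w new : ℕ
        k = Left.code i c
        w = Left.coef i c
        new = M (r′ 9 + r′ 16) + r′ 17
        sz : ∀ {x} → x ≤ U → size x ≤ V
        sz p = ≤-trans (size-mono p) U≤V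
        addr : r′ 9 + r′ 16 ≡ tb + k
        addr = cong₂ _+_ h9 h16
        new-eq : new ≡ M (tb + k) + w
        new-eq = cong₂ (λ x y → M x + y) addr h17
        M′ : ℕ → ℕ
        M′ = M [ r′ 9 + r′ 16 ↦ new ]
        addr≤U : r′ 9 + r′ 16 ≤ U
        addr≤U = ≤-trans (≤-reflexive addr) (≤-trans (+-monoʳ-≤ tb (<⇒≤ (Left.Row.code<Z^B i hi c))) codeBound≤U)
        new-cell : M (tb + k) + w + R k ≡ cellSum k
        new-cell = trans (+-assoc (M (tb + k)) w (R k))
          (trans (cong (λ e → M (tb + k) + (e + R k)) (sym (trans (cong (_* w) (δ-refl k)) (+-identityʳ w)))) (h k))
        new≤U : new ≤ U
        new≤U = ≤-trans (≤-reflexive new-eq) (≤-trans (m≤m+n _ (R k)) (≤-trans (≤-reflexive new-cell)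
          (≤-trans (cellSum≤ k) cellBound≤U)))
        other : ∀ a → a ≢ tb + k → M′ a ≡ M a
        other a ne = update-other M (r′ 9 + r′ 16) a new (trans (cong (_≡ᵇ a) addr) neq)
          where
          neq : (tb + k ≡ᵇ a) ≡ false
          neq with tb + k ≡ᵇ a in eq
          ... | true  = contradiction (sym (≡ᵇ⇒≡ _ a (subst T (sym eq) tt))) ne
          ... | false = refl
        inputs′ : ∀ a → a < base → M′ a ≡ inp a
        inputs′ a p = trans (other a (<⇒≢ (≤-trans p (≤-trans (m≤m+n base tabSize) (m≤m+n tb k))))) (Stored.inputs st a p)
        tables′ : ∀ j → j < tabSize → M′ (base + j) ≡ cells j
        tables′ j p = trans (other (base + j) (<⇒≢ (≤-trans (+-monoʳ-< base p) (m≤m+n tb k)))) (Stored.tables st j p)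
        cells′ : ∀ z → M′ (tb + z) + R z ≡ cellSum z
        cells′ z with z ≟ k
        ... | yes refl = trans (cong (_+ R z) (trans (cong (λ a → (M [ a ↦ new ]) (tb + z)) addr)
                           (trans (update-same M (tb + z) new) new-eq))) new-cell
        ... | no  ne   = trans (cong₂ _+_ (other (tb + z) (λ e → ne (+-cancelˡ-≡ tb z k e)))
                           (cong (λ e → e * w + R z) (sym (δ-≢ k z λ e → ne (sym e))))) (h z)

      Counting : (ℕ → ℕ) → ℕ → (ℕ → ℕ) → Set
      Counting R a M = Pending (λ _ → 0) M × a + R 0 ≡ total

      lookupPath-run : ∀ {r′ M} i c R → i < n → c < pw → r′ 9 ≡ tb → r′ 16 ≡ Right.code i c → r′ 17 ≡ Right.coef i c →
        Counting (λ z → Right.coef i c * cellSum (Right.code i c) + R z) (r′ 11) M →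
        RunU lookupPath ⟨ r′ , M ⟩ (λ s → Counting R (reg s 11) (mem s)) 10
      lookupPath-run {r′} {M} i c R hi hc h9 h16 h17 (pend@(_ , cell) , h) = weakenU
        (λ { _ _ refl → pend , trans (cong (λ e → r′ 11 + e + R 0) found) (trans (+-assoc (r′ 11) _ (R 0)) h) }) ≤-refl
        (block lookupPath (9 ∷ 11 ∷ 16 ∷ 17 ∷ []) refl
          ((h9 ⊑ tb≤U) ∷ ≤-trans (m≤m+n (r′ 11) _) (≤-trans (≤-reflexive h) total≤U)
            ∷ (h16 ⊑ ≤-trans (<⇒≤ (Right.Row.code<Z^B i hi c)) Z^B≤U)
            ∷ (h17 ⊑ ≤-trans (Right.Row.coef≤G^B i hi c) G^B≤U) ∷ []) [] (bounded pend))
        where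
        found : M (r′ 9 + r′ 16) * r′ 17 ≡ Right.coef i c * cellSum (Right.code i c)
        found = trans (cong₂ _*_ (trans (cong M (cong₂ _+_ h9 h16)) (trans (sym (+-identityʳ _)) (cell (Right.code i c)))) h17)
          (*-comm (cellSum (Right.code i c)) (Right.coef i c))

      record Ready (s : State) : Set where
        field
          r0 : reg s 0 ≡ n
          r1 : reg s 1 ≡ d
          r2 : reg s 2 ≡ 1
          r3 : reg s 3 ≡ X
          r4 : reg s 4 ≡ Y
          r5 : reg s 5 ≡ N
          r6 : reg s 6 ≡ B
          r7 : reg s 7 ≡ pw
          r8 : reg s 8 ≡ base
          r9 : reg s 9 ≡ tb
          r10 : reg s 10 ≡ 0
          r11 : reg s 11 ≡ 0

      X≤U : X ≤ U
      X≤U = ≤-trans X≤X^m X^m≤U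

      at : ∀ {s : State} {M} → mem s ≡ M → s ≡ ⟨ reg s , M ⟩
      at refl = refl

      inp≤U : ∀ a → inp a ≤ U
      inp≤U a = ≤-trans (<⇒≤ (inp<m a)) m≤U

      units₃ units₂ initialUnits : ℕ
      units₃ = units init₃ (live (0 ∷ 1 ∷ 2 ∷ 21 ∷ []))
      units₂ = units init₂ (live (1 ∷ 2 ∷ 21 ∷ [])) + ((1 + (B * 5 + 1)) + units₃)
      initialUnits = units init₁ (live (0 ∷ [])) + ((1 + (m * 5 + 1)) + units₂)

      initialise-run : RunU initialise ⟨ contents (n ∷ d ∷ []) , inp ⟩ Ready initialUnits
      initialise-run = seqU (block init₁ (0 ∷ []) refl (n≤U ∷ []) (1≤U ∷ 2≤U ∷ m≤U ∷ []) inp≤U)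
        λ { _ _ _ refl → seqU (power-run X m refl (*-identityʳ X) refl m≤U X≤U X^m≤U inp≤U)
        λ { s₂ f₂ m₂ e₂ → after-power s₂ (f₂ 0 refl) (f₂ 1 refl) (f₂ 2 refl) (f₂ 3 refl) (m₂ refl) e₂ } }
        where
        finishInit : ∀ s → reg s 0 ≡ n → reg s 1 ≡ d → reg s 2 ≡ 1 → reg s 3 ≡ X → reg s 4 ≡ Y → reg s 5 ≡ N → reg s 6 ≡ B →
          mem s ≡ inp → reg s 21 ≡ pw → RunU init₃ s Ready units₃
        finishInit s q0 q1 q2 q3 q4 q5 q6 mm q21 = weakenU
          (λ { s₅ f₅ e₅ → record
            { r0 = trans (f₅ 0 refl) q0
            ; r1 = trans (f₅ 1 refl) q1
            ; r2 = trans (f₅ 2 refl) q2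
            ; r3 = trans (f₅ 3 refl) q3
            ; r4 = trans (f₅ 4 refl) q4
            ; r5 = trans (f₅ 5 refl) q5
            ; r6 = trans (f₅ 6 refl) q6
            ; r7 = trans (cong (λ s → reg s 7) e₅) (trans (cong₂ _*_ q21 q2) (*-identityʳ pw))
            ; r8 = trans (cong (λ s → reg s 8) e₅) (cong₂ (λ x y → x * y + x * y) q0 q1)
            ; r9 = trans (cong (λ s → reg s 9) e₅) (cong₂ (λ x y → x * y + x * y + tabSize) q0 q1)
            ; r10 = cong (λ s → reg s 10) e₅
            ; r11 = cong (λ s → reg s 11) e₅ } }) ≤-refl
          (blockAt init₃ (0 ∷ 1 ∷ 2 ∷ 21 ∷ []) (at mm) refl ((q0 ⊑ n≤U) ∷ (q1 ⊑ d≤U) ∷ (q2 ⊑ 1≤U) ∷ (q21 ⊑ pw≤U) ∷ [])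
            (≤-trans (m≤n+m tabSize base) tb≤U ∷ z≤n ∷ z≤n ∷ []) inp≤U)
        after-power : ∀ s → reg s 0 ≡ n → reg s 1 ≡ d → reg s 2 ≡ 1 → reg s 3 ≡ X → mem s ≡ inp → reg s 21 ≡ X ^ m →
          RunU (init₂ ⨾ power ⨾ init₃) s Ready units₂
        after-power s q0 q1 q2 q3 mm q21 = seqU
          (blockAt init₂ (1 ∷ 2 ∷ 21 ∷ []) (at mm) refl ((q1 ⊑ d≤U) ∷ (q2 ⊑ 1≤U) ∷ (q21 ⊑ X^m≤U) ∷ [])
            (≤-trans (m∸n≤m κ 1) κ≤U ∷ κ≤U ∷ r≤U ∷ []) inp≤U)
          λ { s₃ f₃ m₃ e₃ → let B-eq = trans (cong (λ e → ⟦ div ⟧ (e + (κ ∸ 1)) κ) q1) (div-op (d + (κ ∸ 1)) κ) in seqU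
            (power-run {s₃} r B (trans (f₃ 2 refl) q2) (cong (λ s → reg s 22) e₃)
              (trans (cong (λ s → reg s 18) e₃) (trans (cong₂ _*_ B-eq q2) (*-identityʳ B)))
              B≤U r≤U pw≤U (λ a → ≤-trans (≤-reflexive (cong (λ M → M a) (trans (m₃ refl) mm))) (inp≤U a)))
            λ { s₄ f₄ m₄ e₄ → finishInit s₄ (trans (f₄ 0 refl) (trans (f₃ 0 refl) q0)) (trans (f₄ 1 refl) (trans (f₃ 1 refl) q1))
              (trans (f₄ 2 refl) (trans (f₃ 2 refl) q2)) (trans (f₄ 3 refl) (trans (f₃ 3 refl) q3))
              (trans (f₄ 4 refl) (trans (cong (λ s → reg s 4) e₃) (cong₂ (λ x y → x ∸ y ∸ y) q21 q2)))
              (trans (f₄ 5 refl) (trans (cong (λ s → reg s 5) e₃) (cong₂ _∸_ q21 q2)))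
              (trans (f₄ 6 refl) (trans (cong (λ s → reg s 6) e₃) B-eq))
              (trans (m₄ refl) (trans (m₃ refl) mm)) e₄ } }

      programUnits : ℕ
      programUnits = initialUnits + (fillUnits tabSize table + (Left.sweepUnits 9
        + (units rightTable (live (0 ∷ 1 ∷ 8 ∷ [])) + (Right.sweepUnits 10 + units finish (live (3 ∷ 5 ∷ 11 ∷ []))))))

      leftTail : Left.TailSpec
      leftTail = record
        { tail = addPath ; tailUnits = 9
        ; tail-writes = refl , refl , refl , refl , refl , refl , refl , refl , refl , refl , refl , tt
        ; Inv = λ R _ M → Pending R M ; Inv-OK = okL ; g = λ k w z → δ k z * w ; tail-run = addPath-run }

      rightTail : Right.TailSpec
      rightTail = record
        { tail = lookupPath ; tailUnits = 10
        ; tail-writes = refl , refl , refl , refl , refl , refl , refl , refl , refl , refl , refl , tt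
        ; Inv = Counting ; Inv-OK = λ p → okR (proj₁ p) ; g = λ k w _ → w * cellSum k ; tail-run = lookupPath-run }

      module PL = Left.WithTail leftTail
      module PR = Right.WithTail rightTail

      N≤U : N ≤ U
      N≤U = ≤-trans (m∸n≤m (X ^ m) 1) X^m≤U

      Y≤U : Y ≤ U
      Y≤U = ≤-trans (m∸n≤m N 1) N≤U

      finish-run : ∀ s → reg s 3 ≡ X → reg s 5 ≡ N → reg s 11 ≡ total → (∀ a → mem s a ≤ U) →
        RunU finish s (λ s → reg s 0 ≡ total % N % X) (units finish (live (3 ∷ 5 ∷ 11 ∷ [])))
      finish-run s q3 q5 q11 hM = weakenU (λ { _ _ refl → trans (cong₃ (λ x y z → z ∸ ⟦ div ⟧ z x * x ∸ ⟦ div ⟧ (z ∸ ⟦ div ⟧ z x * x) y * y) q5 q3 q11)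
          (trans (cong (λ z → z ∸ ⟦ div ⟧ z X * X) (mod-op total N)) (mod-op (total % N) X)) }) ≤-refl
        (block finish (3 ∷ 5 ∷ 11 ∷ []) refl ((q3 ⊑ X≤U) ∷ (q5 ⊑ N≤U) ∷ (q11 ⊑ total≤U) ∷ []) [] hM)
        where
        cong₃ : ∀ (f : ℕ → ℕ → ℕ → ℕ) {a a′ b b′ c c′} → a ≡ a′ → b ≡ b′ → c ≡ c′ → f a b c ≡ f a′ b′ c′
        cong₃ f refl refl refl = refl

      count-run : ∀ s → reg s 0 ≡ n → reg s 1 ≡ d → reg s 2 ≡ 1 → reg s 3 ≡ X → reg s 5 ≡ N → reg s 6 ≡ B → reg s 7 ≡ pw →
        reg s 8 ≡ base → reg s 9 ≡ tb → reg s 11 ≡ 0 → Pending (λ _ → 0) (mem s) →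
        RunU (rightTable ⨾ sweep lookupPath ⨾ finish) s (λ s → reg s 0 ≡ total % N % X)
          (units rightTable (live (0 ∷ 1 ∷ 8 ∷ [])) + (Right.sweepUnits 10 + units finish (live (3 ∷ 5 ∷ 11 ∷ []))))
      count-run s q0 q1 q2 q3 q5 q6 q7 q8 q9 q11 pend = seqU
        (blockAt rightTable (0 ∷ 1 ∷ 8 ∷ []) refl refl ((q0 ⊑ n≤U) ∷ (q1 ⊑ d≤U) ∷ (q8 ⊑ base≤U) ∷ [])
          (≤-trans (m≤n+m half base) rightTab≤U ∷ []) (bounded pend))
        λ { s₁ f₁ m₁ e₁ → seqU
          (PR.sweep-run {reg s₁} {mem s₁}
            ( trans (f₁ 2 refl) q2 , trans (f₁ 0 refl) q0 , trans (f₁ 1 refl) q1 , trans (f₁ 6 refl) q6 , trans (f₁ 7 refl) q7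
            , trans (cong (λ s → reg s 8) e₁) (cong (_+ half) q8) , trans (f₁ 9 refl) q9
            , trans (cong (λ s → reg s 10) e₁) (cong₂ _*_ q0 q1))
            ( subst (Pending (λ _ → 0)) (sym (m₁ refl)) pend
            , trans (cong (_+ PR.remainingRows n 0) (trans (f₁ 11 refl) q11)) (PR.remainingRows-∑ n 0)))
          λ { s₂ f₂ m₂ (pend₂ , e₂) → finish-run s₂ (trans (f₂ 3 refl) (trans (f₁ 3 refl) q3)) (trans (f₂ 5 refl) (trans (f₁ 5 refl) q5))
            (trans (sym (+-identityʳ _)) e₂) (bounded pend₂) } }

      program-run : RunU program ⟨ contents (n ∷ d ∷ []) , inp ⟩ (λ s → reg s 0 ≡ total % N % X) programUnits
      program-run = seqU initialise-run
        λ { s₁ _ m₁ ready → let open Ready ready in seqU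
          (fillTable-run {M = mem s₁} 2≤U U≤V table tabSize tb≤U (≤-trans (size-mono X≤U) U≤V) (≤-trans (size-mono Y≤U) U≤V) r2 r3 r4 r8)
          λ { s₂ f₂ _ (tab , below , above) →
            let w : ∀ y → y < 20 → writes (fillTable tabSize table) y ≡ false
                w = fillTable-writes tabSize table
                keep : ∀ y → {T (y <ᵇ 20)} → reg s₂ y ≡ reg s₁ y
                keep y {h} = f₂ y (w y (<ᵇ⇒< y 20 h))
                mem₁ : ∀ a → mem s₁ a ≡ inp a
                mem₁ a = cong (λ M → M a) (m₁ refl)
            in seqU
            (PL.sweep-run {reg s₂} {mem s₂}
              (trans (keep 2) r2 , trans (keep 0) r0 , trans (keep 1) r1 , trans (keep 6) r6 , trans (keep 7) r7 , trans (keep 8) r8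
                , trans (keep 9) r9 , trans (keep 10) r10)
              ( record { inputs = λ a h → trans (below a h) (mem₁ a) ; tables = tab }
              , λ z → trans (cong (_+ PL.remainingRows n z) (trans (above (tb + z) (m≤m+n tb z)) (trans (mem₁ (tb + z))
                  (inp-zero (tb + z) (≤-trans (m≤m+n base tabSize) (m≤m+n tb z)))))) (PL.remainingRows-∑ n z)))
            λ { s₃ f₃ _ pend → count-run s₃ (trans (f₃ 0 refl) (trans (keep 0) r0)) (trans (f₃ 1 refl) (trans (keep 1) r1))
              (trans (f₃ 2 refl) (trans (keep 2) r2)) (trans (f₃ 3 refl) (trans (keep 3) r3)) (trans (f₃ 5 refl) (trans (keep 5) r5))
              (trans (f₃ 6 refl) (trans (keep 6) r6)) (trans (f₃ 7 refl) (trans (keep 7) r7)) (trans (f₃ 8 refl) (trans (keep 8) r8))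
              (trans (f₃ 9 refl) (trans (keep 9) r9)) (trans (f₃ 11 refl) (trans (keep 11) r11)) pend } } }

      -- Correctness: the total as a sum over pairs of vectors

      pairs : ℕ → ℕ → ℕ
      pairs i j = ∑ pw λ c → ∑ pw λ c′ → δ (Left.code i c) (Right.code j c′) * (Left.coef i c * Right.coef j c′)

      total-pairs : total ≡ ∑ n (λ i → ∑ n (λ j → pairs i j))
      total-pairs = trans (∑-cong n λ j _ → trans (∑-cong pw λ c′ _ → expand j c′) (trans (∑-swap pw n _)
          (∑-cong n λ i _ → ∑-swap pw pw _)))
        (∑-swap n n _)
        where
        arrange : ∀ a b c → a * (b * c) ≡ b * (c * a)
        arrange = solve-∀
        expand : ∀ j c′ → Right.coef j c′ * cellSum (Right.code j c′) ≡
          ∑ n (λ i → ∑ pw (λ c → δ (Left.code i c) (Right.code j c′) * (Left.coef i c * Right.coef j c′)))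
        expand j c′ = trans (sym (∑-*ˡ n (Right.coef j c′) _)) (∑-cong n λ i _ →
          trans (sym (∑-*ˡ pw (Right.coef j c′) _)) (∑-cong pw λ c _ →
            arrange (Right.coef j c′) (δ (Left.code i c) (Right.code j c′)) (Left.coef i c)))

      uL uR : ℕ → ℕ → Vec (Fin m) κ
      uL i b = vector κ (λ t → Left.coordinate i (b * κ + t)) (λ t → Left.coordinate<m i (b * κ + t))
      uR j b = vector κ (λ t → Right.coordinate j (b * κ + t)) (λ t → Right.coordinate<m j (b * κ + t))

      ∏-^ : ∀ k f (e : ℕ → ℕ) → (∀ b → f b ≈ X ^ e b) → ∏ k f ≈ X ^ ∑ k e
      ∏-^ zero    f e h = ≡⇒≈ refl
      ∏-^ (suc k) f e h = ≈-trans (*-≈ (h k) (∏-^ k f e h)) (≡⇒≈ (sym (^-distribˡ-+-* X (e k) (∑ k e))))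

      mask-< : ∀ {p} → p < d → 1 ∸ ((p + 1) ∸ d) ≡ 1
      mask-< {p} h = cong (1 ∸_) (m≤n⇒m∸n≡0 (subst (_≤ d) (+-comm 1 p) h))

      mask-≥ : ∀ {p} → d ≤ p → 1 ∸ ((p + 1) ∸ d) ≡ 0
      mask-≥ {p} h = trans (cong (1 ∸_) (trans (cong (_∸ d) (+-comm p 1)) (+-∸-assoc 1 h))) (0∸n≡0 (p ∸ d))

      dot-blocks : ∀ i j → ∑ B (λ b → ⟪ uL i b , uR j b ⟫) ≡ dot i j
      dot-blocks i j = begin
        ∑ B (λ b → ⟪ uL i b , uR j b ⟫)
          ≡⟨ ∑-cong B (λ b _ → dot-vector κ _ _ _ _) ⟩
        ∑ B (λ b → ∑ κ (λ t → F (b * κ + t)))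
          ≡⟨ sym (∑-blocks B κ F) ⟩
        ∑ (B * κ) F
          ≡⟨ ∑-extend F (blocks≥ d κ) (λ p h → trans (cong (λ z → xL i p * z * Right.coordinate j p) (mask-≥ h))
               (cong (_* Right.coordinate j p) (*-zeroʳ (xL i p)))) ⟩
        ∑ d F
          ≡⟨ ∑-cong d (λ p h → cong₂ _*_ (trans (cong (xL i p *_) (mask-< h)) (*-identityʳ (xL i p)))
               (trans (cong (xR j p *_) (mask-< h)) (*-identityʳ (xR j p)))) ⟩
        dot i j ∎
        where
        open ≡-Reasoning
        F : ℕ → ℕ
        F p = Left.coordinate i p * Right.coordinate j p

      -- `pairing` turns the pairs of walks with a common end into a product of one kernel per
      -- letter. By the property of the table each is a power of X whose exponent is the inner
      -- product on the coordinates of that letter; the exponents add up, and the zero padding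
      -- contributes nothing.
      pairs≈ : ∀ i j → pairs i j ≈ X ^ dot i j
      pairs≈ i j = ≈-trans (≡⇒≈ (trans (Pairing.pairing r Z cdL cfL cdR cfR cdL<Z cdR<Z (Left.letterOf i) (Right.letterOf j) B 0 1 0 1)
          (trans (*-identityˡ _) refl)))
        (≈-trans (∏-^ B _ (λ b → ⟪ uL i b , uR j b ⟫) λ b → subst₂ (λ x y → kernel r cdL cfL cdR cfR x y ≈ X ^ ⟪ uL i b , uR j b ⟫)
          (number-vector κ _ _) (number-vector κ _ _) (kernel≈ X N X^m≡ (uL i b) (uR j b)))
        (≡⇒≈ (cong (X ^_) (dot-blocks i j))))

      dot-lookup : ∀ i j → dot (toℕ i) (toℕ j) ≡ ⟪ lookup us i , lookup vs j ⟫
      dot-lookup i j = trans (∑-cong d λ p h → cong₂ _*_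
          (trans (contents-++ˡ (flatten us) (flatten vs) (subst (toℕ i * d + p <_) (sym (length-flatten us)) (row< (toℕ<n i) h)))
            (contents-flatten us i p h))
          (trans (cong (contents (flatten us ++ flatten vs)) (trans (+-assoc (n * d) (toℕ j * d) p) (cong (_+ (toℕ j * d + p)) (sym (length-flatten us)))))
            (trans (contents-++ʳ (flatten us) (flatten vs) (toℕ j * d + p)) (contents-flatten vs j p h))))
        (sym (dot-∑ (lookup us i) (lookup vs j)))

      answer : total % N % X ≡ #OV m us vs
      answer = trans (extract-count {n = n} X^m≡ refl dot (≈-trans (≡⇒≈ total-pairs) (∑-≈ n λ i _ → ∑-≈ n λ j _ → pairs≈ i j)))
        (sym (#OV-∑ m us vs (λ i j → indicator (m ∣? dot i j)) λ i j → cong (λ e → indicator (m ∣? e)) (dot-lookup i j)))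

      correct : Timed V program (input us vs) (λ s → reg s 0 ≡ #OV m us vs) programUnits
      correct = Costed.weakenU U V 2≤U U≤V (λ _ _ h → trans h answer) ≤-refl program-run

      initial-cost : initialUnits ≤ initialConst * work
      initial-cost = ≤-trans (≤-reflexive (arrange (units init₁ (live (0 ∷ []))) (m * 5) (units init₂ (live (1 ∷ 2 ∷ 21 ∷ [])))
          (B * 5) (units init₃ (live (0 ∷ 1 ∷ 2 ∷ 21 ∷ [])))))
        (sum-≤ (units init₁ (live (0 ∷ [])) + (m * 5 + units init₂ (live (1 ∷ 2 ∷ 21 ∷ [])) + 4 + units init₃ (live (0 ∷ 1 ∷ 2 ∷ 21 ∷ [])))) (κ * 5)
          (const-≤ _)
          (≤-trans (*-monoˡ-≤ 5 (≤-trans B≤ (*-monoʳ-≤ κ S≤work))) (≤-reflexive (arrange₂ κ work))))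
        where
        arrange : ∀ a b c x e → a + ((1 + (b + 1)) + (c + ((1 + (x + 1)) + e))) ≡ a + (b + c + 4 + e) + x
        arrange = solve-∀
        arrange₂ : ∀ k w → k * w * 5 ≡ k * 5 * w
        arrange₂ = solve-∀

      program-cost : programUnits ≤ programConst * work
      program-cost = gather initialUnits (fillUnits tabSize table) (Left.sweepUnits 9) (units rightTable (live (0 ∷ 1 ∷ 8 ∷ [])))
          (Right.sweepUnits 10) (units finish (live (3 ∷ 5 ∷ 11 ∷ [])))
          initialConst (sweepConst 9) (sweepConst 10) initial-cost (sweep-cost 9) (sweep-cost 10)

  -- With S = 1 + d + log n there are O(S n r^B) units of work, each unit standing for O(S²) bits.
  -- This is where the exponent 3 of the hidden factor comes from.
  solver : Σ Program λ p → Σ ℕ λ C → ∀ {n d} .{{_ : NonZero n}} (us vs : Vec (Vec (Fin m) d) n) →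
    Run p (input us vs) (λ s → reg s 0 ≡ #OV m us vs) (C * (1 + d + ⌊log₂ n ⌋) ^ 3 * n * r ^ ((d + (κ ∸ 1)) / κ))
  solver = program , engineConst , λ {n} {d} us vs → engine us vs
    where
    arrange : ∀ a b s n p → a * (s * (n * p)) * (b * (s * s)) ≡ a * b * (s * (s * (s * 1))) * n * p
    arrange = solve-∀
    engine : ∀ {n d} .{{_ : NonZero n}} (us vs : Vec (Vec (Fin m) d) n) →
      Run program (input us vs) (λ s → reg s 0 ≡ #OV m us vs) (engineConst * (1 + d + ⌊log₂ n ⌋) ^ 3 * n * r ^ ((d + (κ ∸ 1)) / κ))
    engine {n} {d} us vs = Run-weaken (λ _ _ h → h)
      (≤-trans (*-mono-≤ (Execution.Bounded.program-cost us vs largest (size largest) (all-≤-sum _) ≤-refl) (Execution.size-largest us vs))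
        (≤-reflexive (arrange programConst (suc (sum sizeConsts)) (1 + d + ⌊log₂ n ⌋) n (r ^ ((d + (κ ∸ 1)) / κ)))))
      (Timed.outcome (Execution.Bounded.correct us vs largest (size largest) (all-≤-sum _) ≤-refl))
      where
      largest : ℕ
      largest = sum (Execution.quantities us vs)

-- Factoring the Kronecker power

sumOver-*ˡ : ∀ {A : Set} c (xs : List A) f → sumOver xs (λ x → c * f x) ≡ c * sumOver xs f
sumOver-*ˡ c []       f = sym (*-zeroʳ c)
sumOver-*ˡ c (x ∷ xs) f = trans (cong (c * f x +_) (sumOver-*ˡ c xs f)) (sym (*-distribˡ-+ c (f x) _))

sumOver-+ : ∀ {A : Set} (xs : List A) f g → sumOver xs (λ x → f x + g x) ≡ sumOver xs f + sumOver xs g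
sumOver-+ []       f g = refl
sumOver-+ (x ∷ xs) f g = trans (cong (f x + g x +_) (sumOver-+ xs f g)) (+-interchange (f x) (g x) _ _)

sumOver-zero : ∀ {A : Set} (xs : List A) {f} → (∀ x → f x ≡ 0) → sumOver xs f ≡ 0
sumOver-zero []       h = refl
sumOver-zero (x ∷ xs) h = cong₂ _+_ (h x) (sumOver-zero xs h)

sumOver-≤ : ∀ {A : Set} (xs : List A) {f} c → (∀ x → f x ≤ c) → sumOver xs f ≤ length xs * c
sumOver-≤ []       c h = z≤n
sumOver-≤ (x ∷ xs) c h = +-mono-≤ (h x) (sumOver-≤ xs c h)

sumOver-swap : ∀ {A B : Set} (xs : List A) (ys : List B) (f : A → B → ℕ) →
  sumOver xs (λ x → sumOver ys (f x)) ≡ sumOver ys (λ y → sumOver xs (λ x → f x y))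
sumOver-swap []       ys f = sym (sumOver-zero ys λ _ → refl)
sumOver-swap (x ∷ xs) ys f = trans (cong (sumOver ys (f x) +_) (sumOver-swap xs ys f)) (sym (sumOver-+ ys (f x) _))

length-concatMap : ∀ {A B : Set} (g : A → List B) xs → length (concatMap g xs) ≡ sumOver xs (λ x → length (g x))
length-concatMap g []       = refl
length-concatMap g (x ∷ xs) = trans (length-++ (g x)) (cong (length (g x) +_) (length-concatMap g xs))

sumOver-tabulate-δ : ∀ {A : Set} n (f : Fin n → A) (w h : A → ℕ) (y : Fin n) → (∀ i → w (f i) ≡ δ (toℕ i) (toℕ y)) →
  sumOver (tabulate f) (λ a → w a * h a) ≡ h (f y)
sumOver-tabulate-δ (suc n) f w h zero e = trans (cong₂ _+_ (trans (cong (_* h (f zero)) (e zero)) (+-identityʳ _))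
    (trans (sumOver-tabulate n (λ i → f (suc i)) _ (λ _ → 0) λ i → cong (_* h (f (suc i))) (e (suc i))) (∑-zero n λ _ _ → refl)))
  (+-identityʳ _)
sumOver-tabulate-δ (suc n) f w h (suc y) e = cong₂ _+_ (cong (_* h (f zero)) (e zero))
  (sumOver-tabulate-δ n (λ i → f (suc i)) w h y (λ i → e (suc i)))

words : ∀ m k → List (Vec (Fin m) k)
words m zero    = [] ∷ []
words m (suc k) = concatMap (λ xs → List.map (_∷ xs) (allFin m)) (words m k)

sumOver-words : ∀ m k f → sumOver (words m (suc k)) f ≡ sumOver (words m k) (λ xs → sumOver (allFin m) (λ x → f (x ∷ xs)))
sumOver-words m k f = trans (sumOver-concatMap _ (words m k) f) (sumOver-cong (words m k) λ xs → sumOver-map (_∷ xs) (allFin m) f)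

sumOver-words-δ : ∀ m .{{_ : NonZero m}} k (v : Vec (Fin m) k) (g : Vec (Fin m) k → ℕ) →
  sumOver (words m k) (λ v′ → δ (number v′) (number v) * g v′) ≡ g v
sumOver-words-δ m zero    []       g = trans (+-identityʳ _) (+-identityʳ _)
sumOver-words-δ m (suc k) (y ∷ ys) g = begin
  _ ≡⟨ sumOver-words m k _ ⟩
  sumOver (words m k) (λ xs → sumOver (allFin m) (λ x → δ (number (x ∷ xs)) (number (y ∷ ys)) * g (x ∷ xs)))
    ≡⟨ sumOver-cong (words m k) (λ xs → trans (sumOver-cong (allFin m) (λ x → trans
         (cong (_* g (x ∷ xs)) (δ-digit (number xs) (number ys) (toℕ<n x) (toℕ<n y)))
         (arrange (δ (toℕ x) (toℕ y)) (δ (number xs) (number ys)) (g (x ∷ xs)))))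
       (sumOver-*ˡ (δ (number xs) (number ys)) (allFin m) _)) ⟩
  sumOver (words m k) (λ xs → δ (number xs) (number ys) * sumOver (allFin m) (λ x → δ (toℕ x) (toℕ y) * g (x ∷ xs)))
    ≡⟨ sumOver-words-δ m k ys _ ⟩
  sumOver (allFin m) (λ x → δ (toℕ x) (toℕ y) * g (x ∷ ys))
    ≡⟨ sumOver-tabulate-δ m (λ x → x) (λ x → δ (toℕ x) (toℕ y)) (λ x → g (x ∷ ys)) y (λ _ → refl) ⟩
  g (y ∷ ys) ∎
  where
  open ≡-Reasoning
  arrange : ∀ a b c → a * b * c ≡ b * (a * c)
  arrange = solve-∀

dot-++ : ∀ {m j k} (u v : Vec (Fin m) j) (us vs : Vec (Fin m) k) → ⟪ u Vec.++ us , v Vec.++ vs ⟫ ≡ ⟪ u , v ⟫ + ⟪ us , vs ⟫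
dot-++ []      []      us vs = refl
dot-++ (x ∷ u) (y ∷ v) us vs = trans (cong (toℕ x * toℕ y +_) (dot-++ u v us vs)) (sym (+-assoc (toℕ x * toℕ y) _ _))

dot-comm : ∀ {m k} (u v : Vec (Fin m) k) → ⟪ u , v ⟫ ≡ ⟪ v , u ⟫
dot-comm []      []      = refl
dot-comm (x ∷ u) (y ∷ v) = cong₂ _+_ (*-comm (toℕ x) (toℕ y)) (dot-comm u v)

pow : ℕ → Expr
pow zero    = lit 1
pow (suc e) = varX ⊗ pow e

value-pow : ∀ X Y e → value X Y (pow e) ≡ X ^ e
value-pow X Y zero    = refl
value-pow X Y (suc e) = cong (X *_) (value-pow X Y e)

-- A path is an inner vertex of the factorization together with the weight of
-- the edge leading to it.
Path : Set
Path = ℕ × Expr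

module Pair (X Y : ℕ) where

  -- The same contraction as `kernel`, on unpadded lists: there it is additive in both arguments
  -- under concatenation, and symmetric.
  pair : List Path → List Path → ℕ
  pair xs ys = sumOver xs λ (c , e) → sumOver ys λ (c′ , e′) → δ c c′ * (value X Y e * value X Y e′)

  pair-sym : ∀ xs ys → pair xs ys ≡ pair ys xs
  pair-sym xs ys = trans (sumOver-swap xs ys _) (sumOver-cong ys λ (c′ , e′) → sumOver-cong xs λ (c , e) →
    cong₂ _*_ (δ-sym c c′) (*-comm (value X Y e) (value X Y e′)))

  pair-++ˡ : ∀ xs xs′ ys → pair (xs ++ xs′) ys ≡ pair xs ys + pair xs′ ys
  pair-++ˡ xs xs′ ys = sumOver-++ xs xs′ _

  pair-++ʳ : ∀ xs ys ys′ → pair xs (ys ++ ys′) ≡ pair xs ys + pair xs ys′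
  pair-++ʳ xs ys ys′ = trans (sumOver-cong xs λ _ → sumOver-++ ys ys′ _) (sumOver-+ xs _ _)

module Blocks (m : ℕ) .{{_ : NonZero m}} where

  Block : Set
  Block = Vec (Fin m) 6

  quad : Block → ℕ
  quad (a ∷ b ∷ c ∷ d ∷ e ∷ f ∷ []) = toℕ a * toℕ b + toℕ c * toℕ d + toℕ e * toℕ f

  -- ⟨u , v⟩ + Q(u) + Q(v) = Q(v + σ u) for the involution σ swapping
  -- coordinates in pairs, so every row agrees with the rank one matrix with
  -- entries x^(− Q(u) − Q(v)) equally often.
  Agree : Block → Block → Set
  Agree u v = m ∣ ⟪ u , v ⟫ + (quad u + quad v)

  agree? : ∀ u v → Dec (Agree u v)
  agree? u v = m ∣? (⟪ u , v ⟫ + (quad u + quad v))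

  disagreeing : Block → List Block
  disagreeing u = filter (λ v → ¬? (agree? u v)) (words m 6)

  -- Since (m - 1) Q ≡ -Q modulo m, this is a natural exponent for x^(-Q(u)).
  phase : Block → ℕ
  phase u = (m ∸ 1) * quad u

  -- The entry x^⟨u,v⟩ - x^(-Q(u)-Q(v)) of the sparse summand, `varY` standing for -1.
  correction : Block → Block → Expr
  correction u v = pow ⟪ u , v ⟫ ⊕ (varY ⊗ (pow (phase u) ⊗ pow (phase v)))

  -- A digit names the inner vertex of one block: 0 for the single vertex through which the rank one
  -- part factors, and one more than `number v` for the vertex v of the sparse part.
  radix : ℕ
  radix = suc (m ^ 6)

  branch : ℕ → Expr → Path → Path
  branch i e (c , x) = i + c * radix , e ⊗ x

  -- Each block is either covered by the rank one part, or by the sparse part;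
  -- blocks of the latter kind are expanded alternately on the two sides.  The
  -- flag tells whether the next such block is expanded on this side.
  paths : Bool → ∀ K → Vec (Fin m) (K * 6) → List Path
  paths _     zero    _ = (0 , lit 1) ∷ []
  paths true  (suc K) (a ∷ b ∷ c ∷ d ∷ e ∷ f ∷ us) =
    let u = a ∷ b ∷ c ∷ d ∷ e ∷ f ∷ [] in
    List.map (branch 0 (pow (phase u))) (paths true K us)
    ++ concatMap (λ v → List.map (branch (suc (number v)) (correction u v)) (paths false K us)) (disagreeing u)
  paths false (suc K) (a ∷ b ∷ c ∷ d ∷ e ∷ f ∷ us) =
    let u = a ∷ b ∷ c ∷ d ∷ e ∷ f ∷ [] in
    List.map (branch 0 (pow (phase u))) (paths false K us)
    ++ List.map (branch (suc (number u)) (lit 1)) (paths true K us)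

  -- The transfer matrix has the rows (1, s) and (1, 1) and the leading eigenvalue 1 + √s. Without
  -- alternation one side would have 1 + s paths per block and the other side 2.
  count : ℕ → Bool → ℕ → ℕ
  count s _     zero    = 1
  count s true  (suc K) = count s true K + s * count s false K
  count s false (suc K) = count s false K + count s true K

  length-paths : ∀ {s} → (∀ u → length (disagreeing u) ≤ s) → ∀ p K us → length (paths p K us) ≤ count s p K
  length-paths h true  zero    us = ≤-refl
  length-paths h false zero    us = ≤-refl
  length-paths {s} h true (suc K) (a ∷ b ∷ c ∷ d ∷ e ∷ f ∷ us) = ≤-trans
    (≤-reflexive (trans (length-++ (List.map _ (paths true K us))) (cong₂ _+_ (length-map _ (paths true K us))
      (length-concatMap _ (disagreeing (a ∷ b ∷ c ∷ d ∷ e ∷ f ∷ []))))))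
    (+-mono-≤ (length-paths h true K us) (≤-trans
      (sumOver-≤ (disagreeing (a ∷ b ∷ c ∷ d ∷ e ∷ f ∷ [])) (count s false K) λ v → ≤-trans (≤-reflexive (length-map _ (paths false K us))) (length-paths h false K us))
      (*-monoˡ-≤ (count s false K) (h (a ∷ b ∷ c ∷ d ∷ e ∷ f ∷ [])))))
  length-paths {s} h false (suc K) (a ∷ b ∷ c ∷ d ∷ e ∷ f ∷ us) = ≤-trans
    (≤-reflexive (trans (length-++ (List.map _ (paths false K us))) (cong₂ _+_ (length-map _ (paths false K us)) (length-map _ (paths true K us)))))
    (+-mono-≤ (length-paths h false K us) (length-paths h true K us))

  digit-bound : ∀ (v : Block) → suc (number v) < radix
  digit-bound v = s≤s (number-< v)

  branch-< : ∀ {i y xs} K → i < radix → All (λ x → proj₁ x < radix ^ K) xs →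
    All (λ x → proj₁ x < radix ^ suc K) (List.map (branch i y) xs)
  branch-< {i} K hi hs = All.map⁺ (All.map (λ {x} h → subst (i + proj₁ x * radix <_) (*-comm (radix ^ K) radix) (digit-< hi h)) hs)

  codes-< : ∀ p K us → All (λ x → proj₁ x < radix ^ K) (paths p K us)
  codes-< true  zero us = s≤s z≤n ∷ []
  codes-< false zero us = s≤s z≤n ∷ []
  codes-< true (suc K) (a ∷ b ∷ c ∷ d ∷ e ∷ f ∷ us) = All.++⁺ (branch-< K (s≤s z≤n) (codes-< true K us))
    (All.concat⁺ (All.map⁺ (All.universal (λ v → branch-< K (digit-bound v) (codes-< false K us)) (disagreeing (a ∷ b ∷ c ∷ d ∷ e ∷ f ∷ [])))))
  codes-< false (suc K) (a ∷ b ∷ c ∷ d ∷ e ∷ f ∷ us) = All.++⁺ (branch-< K (s≤s z≤n) (codes-< false K us))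
    (branch-< K (digit-bound (a ∷ b ∷ c ∷ d ∷ e ∷ f ∷ [])) (codes-< true K us))

  module _ (X N : ℕ) .{{_ : NonZero N}} (X^m≡ : X ^ m ≡ suc N) where
    open Congruence N
    open Cyclic X m N X^m≡
    open Pair X (N ∸ 1)

    val : Expr → ℕ
    val = value X (N ∸ 1)

    pair-branch : ∀ {i j} e e′ xs ys → i < radix → j < radix →
      pair (List.map (branch i e) xs) (List.map (branch j e′) ys) ≡ δ i j * (val e * val e′) * pair xs ys
    pair-branch {i} {j} e e′ xs ys hi hj = trans (sumOver-map _ xs _) (trans (sumOver-cong xs λ (c , x) → trans (sumOver-map _ ys _)
        (trans (sumOver-cong ys λ (c′ , y) → trans (cong (_* (val e * val x * (val e′ * val y))) (δ-digit c c′ hi hj))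
          (arrange (δ i j) (δ c c′) (val e) (val x) (val e′) (val y))) (sumOver-*ˡ D ys _)))
      (sumOver-*ˡ D xs _))
      where
      D : ℕ
      D = δ i j * (val e * val e′)
      arrange : ∀ a b c d e f → a * b * (c * d * (e * f)) ≡ a * (c * e) * (b * (d * f))
      arrange = solve-∀

    pair-concatMap : ∀ {A : Set} (g : A → List Path) xs ys → pair (concatMap g xs) ys ≡ sumOver xs (λ x → pair (g x) ys)
    pair-concatMap g xs ys = sumOver-concatMap g xs _

    corrected : Block → Block → ℕ
    corrected u v = X ^ phase u * X ^ phase v + indicator (¬? (agree? u v)) * (val (correction u v) * 1)

    -- On an agreeing pair the exponents of the rank one entry and of x^⟨u,v⟩ differ by a multiple
    -- of m. On any other pair the rank one entry p meets its negative (N - 1) p in the correction,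
    -- and the two add up to a multiple of N. Both arguments add multiples where one would subtract.
    corrected≈ : ∀ u v → corrected u v ≈ X ^ ⟪ u , v ⟫
    corrected≈ u v with agree? u v
    ... | yes m∣ = ≈-trans (≡⇒≈ (trans (+-identityʳ _) (sym (^-distribˡ-+-* X (phase u) (phase v)))))
        (≈-trans (≈-sym (^-∣-≈ (⟪ u , v ⟫ + q) (phase u + phase v) m∣))
        (≈-trans (≡⇒≈ (cong (X ^_) whole)) (^-∣-≈ (m * q) ⟪ u , v ⟫ (m∣m*n q))))
      where
      q : ℕ
      q = quad u + quad v
      whole : ⟪ u , v ⟫ + q + (phase u + phase v) ≡ m * q + ⟪ u , v ⟫
      whole = trans (arrange (m ∸ 1) ⟪ u , v ⟫ (quad u) (quad v)) (cong (λ k → k * q + ⟪ u , v ⟫) (suc-pred m))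
        where
        arrange : ∀ k i a b → i + (a + b) + (k * a + k * b) ≡ suc k * (a + b) + i
        arrange = solve-∀
    ... | no _ = ≈-trans (≡⇒≈ (trans (cong (λ e → X ^ phase u * X ^ phase v + (e * 1 + 0)) values)
          (trans (arrange (X ^ ⟪ u , v ⟫) (N ∸ 1) (X ^ phase u * X ^ phase v)) (cong (λ k → X ^ ⟪ u , v ⟫ + X ^ phase u * X ^ phase v * k) (suc-pred N)))))
        (+-N≈ (X ^ ⟪ u , v ⟫) (X ^ phase u * X ^ phase v))
      where
      values : val (correction u v) ≡ X ^ ⟪ u , v ⟫ + (N ∸ 1) * (X ^ phase u * X ^ phase v)
      values = cong₂ (λ a b → a + (N ∸ 1) * b) (value-pow X _ ⟪ u , v ⟫) (cong₂ _*_ (value-pow X _ (phase u)) (value-pow X _ (phase v)))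
      arrange : ∀ a k p → p + ((a + k * p) * 1 + 0) ≡ a + p * suc k
      arrange = solve-∀

    -- The two mixed terms vanish, as a leading digit 0 never equals a positive one. In the sparse
    -- term the code digit singles out one entry of the row of u, and the roles of the two sides are
    -- exchanged for the remaining blocks; the symmetry of `pair` and of the inner product brings
    -- the induction hypothesis back into its original form.
    pair-paths : ∀ K us vs → pair (paths true K us) (paths false K vs) ≈ X ^ ⟪ us , vs ⟫
    pair-paths zero [] [] = ≡⇒≈ refl
    pair-paths (suc K) (a ∷ b ∷ c ∷ d ∷ e ∷ f ∷ us) (a′ ∷ b′ ∷ c′ ∷ d′ ∷ e′ ∷ f′ ∷ vs) =
      ≈-trans (≡⇒≈ expand)
      (≈-trans (+-≈ (*-≈ (≡⇒≈ {X ^ phase u * X ^ phase v} refl) (pair-paths K us vs)) (*-≈ (≡⇒≈ {indicator (¬? (agree? u v)) * (val (correction u v) * 1)} refl) swapped))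
      (≈-trans (≡⇒≈ (sym (*-distribʳ-+ (X ^ ⟪ us , vs ⟫) (X ^ phase u * X ^ phase v) (indicator (¬? (agree? u v)) * (val (correction u v) * 1)))))
      (≈-trans (*-≈ (corrected≈ u v) (≡⇒≈ {X ^ ⟪ us , vs ⟫} refl))
      (≡⇒≈ (trans (sym (^-distribˡ-+-* X ⟪ u , v ⟫ ⟪ us , vs ⟫)) (cong (X ^_) (sym (dot-++ u v us vs))))))))
      where
      u v : Block
      u = a ∷ b ∷ c ∷ d ∷ e ∷ f ∷ []
      v = a′ ∷ b′ ∷ c′ ∷ d′ ∷ e′ ∷ f′ ∷ []
      swapped : pair (paths false K us) (paths true K vs) ≈ X ^ ⟪ us , vs ⟫
      swapped = ≈-trans (≡⇒≈ (pair-sym (paths false K us) (paths true K vs)))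
        (≈-trans (pair-paths K vs us) (≡⇒≈ (cong (X ^_) (dot-comm vs us))))
      A C A′ C′ : List Path
      A  = List.map (branch 0 (pow (phase u))) (paths true K us)
      C  = concatMap (λ v → List.map (branch (suc (number v)) (correction u v)) (paths false K us)) (disagreeing u)
      A′ = List.map (branch 0 (pow (phase v))) (paths false K vs)
      C′ = List.map (branch (suc (number v)) (lit 1)) (paths true K vs)
      AA : pair A A′ ≡ X ^ phase u * X ^ phase v * pair (paths true K us) (paths false K vs)
      AA = trans (pair-branch (pow (phase u)) (pow (phase v)) (paths true K us) (paths false K vs) (s≤s z≤n) (s≤s z≤n))
        (cong (_* pair (paths true K us) (paths false K vs)) (trans (+-identityʳ _) (cong₂ _*_ (value-pow X _ (phase u)) (value-pow X _ (phase v)))))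
      AC : pair A C′ ≡ 0
      AC = pair-branch (pow (phase u)) (lit 1) (paths true K us) (paths true K vs) (s≤s z≤n) (digit-bound v)
      CA : pair C A′ ≡ 0
      CA = trans (pair-concatMap _ (disagreeing u) A′) (sumOver-zero (disagreeing u) λ w →
        pair-branch (correction u w) (pow (phase v)) (paths false K us) (paths false K vs) (digit-bound w) (s≤s z≤n))
      P : ℕ
      P = pair (paths false K us) (paths true K vs)
      CC : pair C C′ ≡ indicator (¬? (agree? u v)) * (val (correction u v) * 1) * P
      CC = begin
        pair C C′
          ≡⟨ pair-concatMap _ (disagreeing u) C′ ⟩
        sumOver (disagreeing u) (λ w → pair (List.map (branch (suc (number w)) (correction u w)) (paths false K us)) C′)
          ≡⟨ sumOver-cong (disagreeing u) (λ w → pair-branch (correction u w) (lit 1) (paths false K us) (paths true K vs) (digit-bound w) (digit-bound v)) ⟩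
        sumOver (disagreeing u) (λ w → δ (number w) (number v) * (val (correction u w) * 1) * P)
          ≡⟨ sumOver-filter (λ w → ¬? (agree? u w)) (words m 6) _ ⟩
        sumOver (words m 6) (λ w → indicator (¬? (agree? u w)) * (δ (number w) (number v) * (val (correction u w) * 1) * P))
          ≡⟨ sumOver-cong (words m 6) (λ w → arrange (indicator (¬? (agree? u w))) (δ (number w) (number v)) (val (correction u w) * 1) P) ⟩
        sumOver (words m 6) (λ w → δ (number w) (number v) * (indicator (¬? (agree? u w)) * (val (correction u w) * 1) * P))
          ≡⟨ sumOver-words-δ m 6 v (λ w → indicator (¬? (agree? u w)) * (val (correction u w) * 1) * P) ⟩
        indicator (¬? (agree? u v)) * (val (correction u v) * 1) * P ∎
        where
        open ≡-Reasoning
        arrange : ∀ i d x p → i * (d * x * p) ≡ d * (i * x * p)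
        arrange = solve-∀
      expand : pair (A ++ C) (A′ ++ C′) ≡ X ^ phase u * X ^ phase v * pair (paths true K us) (paths false K vs)
        + indicator (¬? (agree? u v)) * (val (correction u v) * 1) * P
      expand = trans (pair-++ˡ A C (A′ ++ C′)) (cong₂ _+_
        (trans (pair-++ʳ A A′ C′) (trans (cong₂ _+_ AA AC) (+-identityʳ _)))
        (trans (pair-++ʳ C A′ C′) (cong₂ _+_ CA CC)))

-- Path lists as rows of a table of fixed width

nth : List Path → ℕ → Path
-- The padding path: its code is a legal one, and its weight zero makes it contribute nothing to any
-- pairing.
nth []       _       = 0 , lit 0
nth (x ∷ _)  zero    = x
nth (_ ∷ xs) (suc i) = nth xs i

nth-< : ∀ {xs Z} i → 1 ≤ Z → All (λ x → proj₁ x < Z) xs → proj₁ (nth xs i) < Z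
nth-< i       h []      = h
nth-< zero    h (p ∷ _) = p
nth-< (suc i) h (_ ∷ p) = nth-< i h p

∑-nth : ∀ xs r (g : Path → ℕ) → g (0 , lit 0) ≡ 0 → length xs ≤ r → ∑ r (λ i → g (nth xs i)) ≡ sumOver xs g
∑-nth []       r       g z h       = ∑-zero r λ _ _ → z
∑-nth (x ∷ xs) (suc r) g z (s≤s h) = trans (∑-bottom r _) (cong (g x +_) (∑-nth xs r g z h))

decode : ∀ {m} .{{_ : NonZero m}} k → ℕ → Vec (Fin m) k
decode     zero    a = []
decode {m} (suc k) a = fromℕ< (m%n<n a m) ∷ decode k (a / m)

decode-number : ∀ {m} .{{_ : NonZero m}} {k} (v : Vec (Fin m) k) → decode k (number v) ≡ v
decode-number []       = refl
decode-number {m} (x ∷ xs) = cong₂ _∷_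
  (trans (fromℕ<-cong _ _ (digit-% (number xs) (toℕ<n x)) _ (toℕ<n x)) (fromℕ<-toℕ x (toℕ<n x)))
  (trans (cong (decode _) (digit-/ (number xs) (toℕ<n x))) (decode-number xs))

module Assemble (m : ℕ) .{{_ : NonZero m}} (s : ℕ) (few : ∀ u → length (Blocks.disagreeing m u) ≤ s) (K : ℕ) where
  open Blocks m

  -- The sum bounds the path counts of both sides at once. What it wastes over the maximum is a
  -- constant factor per letter, harmless once K is large.
  width : ℕ
  width = count s true K + count s false K

  entry : Bool → ℕ → ℕ → Path
  entry p a = nth (paths p K (decode (K * 6) a))

  entry-< : ∀ p a i → proj₁ (entry p a i) < radix ^ K
  entry-< p a i = nth-< i (m^n>0 radix K) (codes-< p K (decode (K * 6) a))

  table : Table m (K * 6) width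
  table = record
    { Z = radix ^ K ; Z≥1 = m^n>0 radix K
    ; cdL = λ a i → proj₁ (entry true a i) ; cdR = λ a i → proj₁ (entry false a i)
    ; exL = λ a i → proj₂ (entry true a i) ; exR = λ a i → proj₂ (entry false a i)
    ; cdL<Z = λ a i _ → entry-< true a i ; cdR<Z = λ a i _ → entry-< false a i
    ; kernel≈ = λ X N X^m≡ u v → Congruence.≈-trans N (Congruence.≡⇒≈ N (kernel-pair X N u v)) (pair-paths X N X^m≡ K u v) }
    where
    kernel-pair : ∀ X N u v → kernel width (λ a i → proj₁ (entry true a i)) (λ a i → value X (N ∸ 1) (proj₂ (entry true a i)))
        (λ a i → proj₁ (entry false a i)) (λ a i → value X (N ∸ 1) (proj₂ (entry false a i))) (number u) (number v)
      ≡ Pair.pair X (N ∸ 1) (paths true K u) (paths false K v)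
    kernel-pair X N u v rewrite decode-number u | decode-number v = trans
      (∑-cong width λ i _ → ∑-nth (paths false K v) width
        (λ (c , e) → δ (proj₁ (x i)) c * (value X (N ∸ 1) (proj₂ (x i)) * value X (N ∸ 1) e))
        (trans (cong (δ (proj₁ (x i)) 0 *_) (*-zeroʳ (value X (N ∸ 1) (proj₂ (x i))))) (*-zeroʳ (δ (proj₁ (x i)) 0)))
        (≤-trans (length-paths few false K v) (m≤n+m (count s false K) (count s true K))))
      (∑-nth (paths true K u) width
        (λ (c , e) → sumOver (paths false K v) λ (c′ , e′) → δ c c′ * (value X (N ∸ 1) e * value X (N ∸ 1) e′))
        (sumOver-zero (paths false K v) λ (c′ , e′) → *-zeroʳ (δ 0 c′))
        (≤-trans (length-paths few true K u) (m≤m+n (count s true K) (count s false K))))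
      where
      x : ℕ → Path
      x = nth (paths true K u)

  module _ (u μ : ℕ) (s≤ : s * (u * u) ≤ μ * μ) (u≤μ : u ≤ μ) where

    -- The fraction μ/u is a rational upper bound of √s. The vector (√s, 1) is the eigenvector of
    -- the transfer matrix for 1 + √s, so (μ/u, 1) dominates the two counts and grows by at most 1 +
    -- μ/u per step. The hypothesis u ≤ μ is the case of no blocks.
    count-bounds : ∀ k → count s true k * u ^ suc k ≤ μ * (μ + u) ^ k × count s false k * u ^ k ≤ (μ + u) ^ k
    count-bounds zero = ≤-trans (≤-reflexive (trans (+-identityʳ (u * 1)) (*-identityʳ u)))
      (≤-trans u≤μ (≤-reflexive (sym (*-identityʳ μ)))) , ≤-refl
    count-bounds (suc k) with count-bounds k
    ... | h₁ , h₀ = ≤-trans (≤-reflexive (arrange (count s true k) (count s false k) s u (u ^ k)))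
        (≤-trans (+-mono-≤ (*-monoʳ-≤ u h₁) (*-mono-≤ s≤ h₀)) (≤-reflexive (arrange₂ u μ ((μ + u) ^ k)))) ,
      ≤-trans (≤-reflexive (arrange₃ (count s true k) (count s false k) u (u ^ k)))
        (≤-trans (+-mono-≤ h₁ (*-monoʳ-≤ u h₀)) (≤-reflexive (sym (*-distribʳ-+ ((μ + u) ^ k) μ u))))
      where
      arrange : ∀ a b s u p → (a + s * b) * (u * (u * p)) ≡ u * (a * (u * p)) + s * (u * u) * (b * p)
      arrange = solve-∀
      arrange₂ : ∀ u μ p → u * (μ * p) + μ * μ * p ≡ μ * ((μ + u) * p)
      arrange₂ = solve-∀
      arrange₃ : ∀ a b u p → (b + a) * (u * p) ≡ a * (u * p) + u * (b * p)
      arrange₃ = solve-∀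

    width-bound : width * u ^ suc K ≤ (μ + u) ^ suc K
    width-bound with count-bounds K
    ... | h₁ , h₀ = ≤-trans (≤-reflexive (arrange (count s true K) (count s false K) u (u ^ K)))
      (≤-trans (+-mono-≤ h₁ (*-monoʳ-≤ u h₀)) (≤-reflexive (sym (*-distribʳ-+ ((μ + u) ^ K) μ u))))
      where
      arrange : ∀ a b u p → (a + b) * (u * p) ≡ a * (u * p) + u * (b * p)
      arrange = solve-∀

  width≥1 : 1 ≤ width
  width≥1 = ≤-trans (go K) (m≤n+m (count s false K) (count s true K))
    where
    go : ∀ k → 1 ≤ count s false k
    go zero    = ≤-refl
    go (suc k) = ≤-trans (go k) (m≤m+n (count s false k) (count s true k))

-- Counting the disagreeing blocks

sumOver-words-const : ∀ m k c → sumOver (words m k) (λ _ → c) ≡ m ^ k * c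
sumOver-words-const m zero    c = refl
sumOver-words-const m (suc k) c = trans (sumOver-words m k (λ _ → c)) (trans (sumOver-cong (words m k) λ _ → inner)
  (trans (sumOver-words-const m k (m * c)) (arrange m (m ^ k) c)))
  where
  arrange : ∀ m p c → p * (m * c) ≡ m * p * c
  arrange = solve-∀
  inner : sumOver (allFin m) (λ _ → c) ≡ m * c
  inner = trans (sumOver-tabulate m (λ i → i) (λ _ → c) (λ _ → c) (λ _ → refl)) (∑-const m c)

sumOver-mono : ∀ {A : Set} (xs : List A) {f g} → (∀ x → f x ≤ g x) → sumOver xs f ≤ sumOver xs g
sumOver-mono []       h = z≤n
sumOver-mono (x ∷ xs) h = +-mono-≤ (h x) (sumOver-mono xs h)

sumOver-allFin-gap : ∀ {n} {A : Set} (g : Fin n → A) (f : A → ℕ) c (i : Fin n) → (∀ x → f x ≤ c) → f (g i) + 1 ≤ c →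
  sumOver (tabulate g) f + 1 ≤ n * c
sumOver-allFin-gap {suc n} g f c zero h gap = ≤-trans (≤-reflexive (arrange (f (g zero)) _)) (+-mono-≤ gap
  (≤-trans (sumOver-≤ (tabulate (λ i → g (suc i))) c h) (≤-reflexive (cong (_* c) (length-tabulate (λ i → g (suc i)))))))
  where
  arrange : ∀ a b → a + b + 1 ≡ a + 1 + b
  arrange = solve-∀
sumOver-allFin-gap {suc n} g f c (suc i) h gap = ≤-trans (≤-reflexive (+-assoc (f (g zero)) _ 1))
  (+-mono-≤ (h (g zero)) (sumOver-allFin-gap (λ i → g (suc i)) f c i h gap))

complement : ∀ m .{{_ : NonZero m}} c → Σ (Fin m) λ x → m ∣ toℕ x + c
complement m c = fromℕ< (m%n<n ((m ∸ 1) * c) m) , m%n≡0⇒n∣m _ m (begin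
  (toℕ (fromℕ< (m%n<n ((m ∸ 1) * c) m)) + c) % m  ≡⟨ cong (λ x → (x + c) % m) (toℕ-fromℕ< (m%n<n ((m ∸ 1) * c) m)) ⟩
  (((m ∸ 1) * c) % m + c) % m                     ≡⟨ %-distribˡ-+ _ c m ⟩
  (((m ∸ 1) * c) % m % m + c % m) % m             ≡⟨ cong (λ x → (x + c % m) % m) (m%n%n≡m%n ((m ∸ 1) * c) m) ⟩
  (((m ∸ 1) * c) % m + c % m) % m                 ≡⟨ sym (%-distribˡ-+ ((m ∸ 1) * c) c m) ⟩
  ((m ∸ 1) * c + c) % m                           ≡⟨ cong (_% m) (trans (+-comm _ c) (trans (cong (_* c) (suc-pred m)) (*-comm m c))) ⟩
  (c * m) % m                                     ≡⟨ m*n%n≡0 c m ⟩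
  0                                               ∎)
  where open ≡-Reasoning

module _ (m : ℕ) .{{_ : NonZero m}} where
  open Blocks m

  -- For v₂ ≡ 1 − u₁ the agreement condition is linear in v₁ with coefficient 1.
  disagreeing-bound : ∀ u → length (disagreeing u) + m ^ 4 ≤ m ^ 6
  disagreeing-bound u@(u₁ ∷ u₂ ∷ u₃ ∷ u₄ ∷ u₅ ∷ u₆ ∷ []) = begin
    length (disagreeing u) + m ^ 4
      ≡⟨ cong₂ _+_ (trans (length-filter-sumOver (λ v → ¬? (agree? u v)) (words m 6)) (trans (sumOver-words m 5 _) (sumOver-words m 4 _)))
           (sym (trans (sumOver-words-const m 4 1) (*-identityʳ (m ^ 4)))) ⟩
    sumOver (words m 4) rowSum + sumOver (words m 4) (λ _ → 1)
      ≡⟨ sym (sumOver-+ (words m 4) rowSum (λ _ → 1)) ⟩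
    sumOver (words m 4) (λ v → rowSum v + 1)
      ≤⟨ sumOver-mono (words m 4) row ⟩
    sumOver (words m 4) (λ _ → m * (m * 1))
      ≡⟨ sumOver-words-const m 4 (m * (m * 1)) ⟩
    m ^ 4 * (m * (m * 1))
      ≡⟨ arrange m ⟩
    m ^ 6 ∎
    where
    open ≤-Reasoning
    arrange : ∀ m → m * (m * (m * (m * 1))) * (m * (m * 1)) ≡ m * (m * (m * (m * (m * (m * 1)))))
    arrange = solve-∀
    bad : Vec (Fin m) 4 → Fin m → Fin m → ℕ
    bad v y x = indicator (¬? (agree? u (x ∷ y ∷ v)))
    bad≤1 : ∀ v y x → bad v y x ≤ 1
    bad≤1 v y x with agree? u (x ∷ y ∷ v)
    ... | yes _ = z≤n
    ... | no  _ = ≤-refl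
    rowSum : Vec (Fin m) 4 → ℕ
    rowSum v = sumOver (allFin m) λ y → sumOver (allFin m) λ x → bad v y x
    row : ∀ v → rowSum v + 1 ≤ m * (m * 1)
    row v@(v₃ ∷ v₄ ∷ v₅ ∷ v₆ ∷ []) = sumOver-allFin-gap (λ y → y) _ (m * 1) y
        (λ y → ≤-trans (sumOver-≤ (allFin m) 1 (bad≤1 v y)) (≤-reflexive (cong (_* 1) {length (allFin m)} {m} (length-tabulate (λ i → i)))))
        (sumOver-allFin-gap (λ x → x) (bad v y) 1 x (bad≤1 v y) (≤-reflexive (cong (_+ 1) good)))
      where
      rest : ℕ → ℕ
      rest y = toℕ u₂ * y + (toℕ u₃ * toℕ v₃ + (toℕ u₄ * toℕ v₄ + (toℕ u₅ * toℕ v₅ + toℕ u₆ * toℕ v₆)))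
        + (quad u + (toℕ v₃ * toℕ v₄ + toℕ v₅ * toℕ v₆))
      y x : Fin m
      y = proj₁ (complement m (toℕ u₁ + (m ∸ 1)))
      x = proj₁ (complement m (rest (toℕ y)))
      -- After adding x m, the terms containing x become x (y + u₁ + (m - 1)) + x. The first bracket
      -- is divisible by m by the choice of y, and the remaining x together with `rest` by the
      -- choice of x.
      divisible : m ∣ ⟪ u , x ∷ y ∷ v ⟫ + (quad u + quad (x ∷ y ∷ v))
      divisible = ∣m+n∣m⇒∣n {m = toℕ x * m} (subst (m ∣_) (sym whole)
          (∣m∣n⇒∣m+n (∣n⇒∣m*n (toℕ x) (proj₂ (complement m (toℕ u₁ + (m ∸ 1))))) (proj₂ (complement m (rest (toℕ y))))))
        (n∣m*n (toℕ x))
        where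
        identity : ∀ k x y a₁ a₂ a₃ a₄ a₅ a₆ q b₃ b₄ b₅ b₆ →
          x * suc k + (a₁ * x + (a₂ * y + (a₃ * b₃ + (a₄ * b₄ + (a₅ * b₅ + (a₆ * b₆ + 0))))) + (q + (x * y + b₃ * b₄ + b₅ * b₆)))
          ≡ x * (y + (a₁ + k)) + (x + (a₂ * y + (a₃ * b₃ + (a₄ * b₄ + (a₅ * b₅ + a₆ * b₆))) + (q + (b₃ * b₄ + b₅ * b₆))))
        identity = solve-∀
        whole : toℕ x * m + (⟪ u , x ∷ y ∷ v ⟫ + (quad u + quad (x ∷ y ∷ v)))
          ≡ toℕ x * (toℕ y + (toℕ u₁ + (m ∸ 1))) + (toℕ x + rest (toℕ y))
        whole = trans (cong (λ k → toℕ x * k + (⟪ u , x ∷ y ∷ v ⟫ + (quad u + quad (x ∷ y ∷ v)))) (sym (suc-pred m)))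
          (identity (m ∸ 1) (toℕ x) (toℕ y) (toℕ u₁) (toℕ u₂) (toℕ u₃) (toℕ u₄) (toℕ u₅) (toℕ u₆) (quad u) (toℕ v₃) (toℕ v₄) (toℕ v₅) (toℕ v₆))
      good : bad v y x ≡ 0
      good with agree? u (x ∷ y ∷ v)
      ... | yes _ = refl
      ... | no ¬d = contradiction divisible ¬d

-- Over the field of two elements the hyperbolic form in six variables has 2⁵ + 2² = 36 zeros, which
-- leaves 28 of the 64 vectors in every row; the general bound would give only 48. Verified by
-- evaluation over all 64 blocks u.
disagreeing-2 : ∀ u → length (Blocks.disagreeing 2 u) ≤ 28
disagreeing-2 (a ∷ b ∷ c ∷ d ∷ e ∷ f ∷ []) = toWitness {a? = all? λ a → all? λ b → all? λ c → all? λ d → all? λ e → all? λ f →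
  length (Blocks.disagreeing 2 (a ∷ b ∷ c ∷ d ∷ e ∷ f ∷ [])) ≤? 28} _ a b c d e f

open import Data.Integer using (+_; -[1+_])
import Data.Integer as ℤ
import Data.Integer.Properties as ℤ
open import Data.Rational.Unnormalised as ℚ using (ℚᵘ; mkℚᵘ; ↥_; ↧ₙ_; 0ℚᵘ; 1ℚᵘ; ½)

-- Exponents

*-^ : ∀ a b n → (a * b) ^ n ≡ a ^ n * b ^ n
*-^ a b zero    = refl
*-^ a b (suc n) = trans (cong (a * b *_) (*-^ a b n)) (arrange a b (a ^ n) (b ^ n))
  where
  arrange : ∀ a b c d → a * b * (c * d) ≡ a * c * (b * d)
  arrange = solve-∀

swap-^ : ∀ x i j → (x ^ i) ^ j ≡ (x ^ j) ^ i
swap-^ x i j = trans (^-*-assoc x i j) (trans (cong (x ^_) (*-comm i j)) (sym (^-*-assoc x j i)))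

-- Bernoulli's inequality (1 + 1/x)^k ≥ 1 + k/x, cleared of denominators.
bernoulli : ∀ x k → x ^ k * (x + k) ≤ x * suc x ^ k
bernoulli x zero    = ≤-reflexive (trans (+-identityʳ (x + 0)) (trans (+-identityʳ x) (sym (*-identityʳ x))))
bernoulli x (suc k) = ≤-trans (≤-trans (m≤m+n _ (x ^ k * k)) (≤-reflexive (arrange x k (x ^ k))))
  (≤-trans (*-monoʳ-≤ (suc x) (bernoulli x k)) (≤-reflexive (arrange₂ x (suc x) (suc x ^ k))))
  where
  arrange : ∀ x k p → x * p * (x + suc k) + p * k ≡ suc x * (p * (x + k))
  arrange = solve-∀
  arrange₂ : ∀ x y p → y * (x * p) ≡ x * (y * p)
  arrange₂ = solve-∀

-- A strict inequality of rates beats any constant factor α: for k = (α + 1) x, Bernoulli makes (1 +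
-- 1/x)^k at least α + 2.
growth : ∀ {x y} α → 1 ≤ x → x < y → Σ ℕ λ k → 1 ≤ k × α * x ^ k ≤ y ^ k
growth {x} {y} α 1≤x x<y = k , *-mono-≤ {1} {suc α} (s≤s z≤n) 1≤x ,
  *-cancelʳ-≤ (α * x ^ k) (y ^ k) x (begin
    α * x ^ k * x           ≤⟨ m≤m+n _ (2 * x * x ^ k) ⟩
    α * x ^ k * x + 2 * x * x ^ k ≡⟨ arrange x α (x ^ k) ⟩
    x ^ k * (x + k)         ≤⟨ bernoulli x k ⟩
    x * suc x ^ k           ≤⟨ *-monoʳ-≤ x (^-monoˡ-≤ k x<y) ⟩
    x * y ^ k               ≡⟨ *-comm x (y ^ k) ⟩
    y ^ k * x               ∎)
  where
  open ≤-Reasoning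
  instance
    x-nonZero : NonZero x
    x-nonZero = >-nonZero 1≤x
  k : ℕ
  k = suc α * x
  arrange : ∀ x α p → α * p * x + 2 * x * p ≡ p * (x + suc α * x)
  arrange = solve-∀

-- The width is bounded by the power k + 1 of the rate R/u for only k blocks. The hypothesis
-- supplied by `growth` absorbs the surplus factor R, and the surplus u is dropped.
rate : ∀ w u R a b k .{{_ : NonZero u}} → w * u ^ suc k ≤ R ^ suc k → R * (R * a) ^ k ≤ (u * b) ^ k → w * a ^ k ≤ b ^ k
rate w u R a b k h g = *-cancelʳ-≤ (w * a ^ k) (b ^ k) (u ^ suc k) {{m^n≢0 u (suc k)}} (begin
  w * a ^ k * u ^ suc k      ≡⟨ arrange w (a ^ k) (u ^ suc k) ⟩
  w * u ^ suc k * a ^ k      ≤⟨ *-monoˡ-≤ (a ^ k) h ⟩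
  R * R ^ k * a ^ k          ≡⟨ trans (*-assoc R (R ^ k) (a ^ k)) (cong (R *_) (sym (*-^ R a k))) ⟩
  R * (R * a) ^ k            ≤⟨ g ⟩
  (u * b) ^ k                ≡⟨ trans (*-^ u b k) (*-comm (u ^ k) (b ^ k)) ⟩
  b ^ k * u ^ k              ≤⟨ *-monoʳ-≤ (b ^ k) (m≤n*m (u ^ k) u) ⟩
  b ^ k * u ^ suc k          ∎)
  where
  open ≤-Reasoning
  arrange : ∀ w a u → w * a * u ≡ w * u * a
  arrange = solve-∀

ʳ-intro : ∀ {t A b e k} → ↥ e ≡ + k → t ^ ↧ₙ e * ↧ₙ b ^ k ≤ A ^ ↧ₙ e * ℤ.∣ ↥ b ∣ ^ k → t ≤ A · b ^ʳ e
ʳ-intro {e = mkℚᵘ _ _} refl h = h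

-- Rounding d up to a multiple Bκ is harmless on the left and costs at most b ^ κ on the right,
-- because Bκ ≤ d + κ. This factor does not depend on d and goes into the constant C.
rounded : ∀ r a b κ d .{{_ : NonZero κ}} .{{_ : NonZero a}} .{{_ : NonZero b}} → r * a ^ κ ≤ b ^ κ →
  r ^ ((d + (κ ∸ 1)) / κ) * a ^ d ≤ b ^ κ * b ^ d
rounded r a b κ d h = begin
  r ^ B * a ^ d          ≤⟨ *-monoʳ-≤ (r ^ B) (^-monoʳ-≤ a (blocks≥ d κ)) ⟩
  r ^ B * a ^ (B * κ)    ≡⟨ cong (r ^ B *_) (trans (cong (a ^_) (*-comm B κ)) (sym (^-*-assoc a κ B))) ⟩
  r ^ B * (a ^ κ) ^ B    ≡⟨ sym (*-^ r (a ^ κ) B) ⟩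
  (r * a ^ κ) ^ B        ≤⟨ ^-monoˡ-≤ B h ⟩
  (b ^ κ) ^ B            ≡⟨ trans (^-*-assoc b κ B) (cong (b ^_) (*-comm κ B)) ⟩
  b ^ (B * κ)            ≤⟨ ^-monoʳ-≤ b (blocks≤ d κ) ⟩
  b ^ (d + κ)            ≡⟨ trans (cong (b ^_) (+-comm d κ)) (^-distribˡ-+-* b κ d) ⟩
  b ^ κ * b ^ d          ∎
  where
  open ≤-Reasoning
  B : ℕ
  B = (d + (κ ∸ 1)) / κ

-- As 1 + μ/u is at least 1 + √s, the last hypothesis places the E-th power of the rate per block
-- strictly below b/a. Here a clears the denominator of the base and E that of the exponent. The
-- margin determines how many blocks make up one letter.
sparse : ∀ m .{{_ : NonZero m}} s (few : ∀ u → length (Blocks.disagreeing m u) ≤ s) u μ E a b → 1 ≤ u → 1 ≤ a →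
  s * (u * u) ≤ μ * μ → u ≤ μ → (μ + u) ^ E * a < u ^ E * b →
  Σ ℕ λ k → 1 ≤ k × Assemble.width m s few k ^ E * a ^ k ≤ b ^ k
sparse m s few u μ E a b 1≤u 1≤a s≤ u≤μ x<y with growth ((μ + u) ^ E) (*-mono-≤ (m^n>0 (μ + u) {{>-nonZero (≤-trans 1≤u (m≤n+m u μ))}} E) 1≤a) x<y
... | k , 1≤k , h = k , 1≤k , rate (w ^ E) (u ^ E) ((μ + u) ^ E) a b k {{m^n≢0 u E {{>-nonZero 1≤u}}}} raised h
  where
  w : ℕ
  w = Assemble.width m s few k
  raised : w ^ E * (u ^ E) ^ suc k ≤ ((μ + u) ^ E) ^ suc k
  raised = begin
    w ^ E * (u ^ E) ^ suc k    ≡⟨ cong (w ^ E *_) (swap-^ u E (suc k)) ⟩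
    w ^ E * (u ^ suc k) ^ E    ≡⟨ sym (*-^ w (u ^ suc k) E) ⟩
    (w * u ^ suc k) ^ E        ≤⟨ ^-monoˡ-≤ E (Assemble.width-bound m s few k u μ s≤ u≤μ) ⟩
    ((μ + u) ^ suc k) ^ E      ≡⟨ swap-^ (μ + u) (suc k) E ⟩
    ((μ + u) ^ E) ^ suc k      ∎
    where open ≤-Reasoning

solvable-from : ∀ {m} b e (A w : ℕ) (blocks : ℕ → ℕ) →
  (∀ {t} c d → t ≤ c * w ^ blocks d → t ≤ (c * A) · b ^ʳ (e ℚ.* fromℕ d)) →
  (Σ Program λ p → Σ ℕ λ C → ∀ {n d} .{{_ : NonZero n}} (us vs : Vec (Vec (Fin m) d) n) →
    Run p (input us vs) (λ s → reg s 0 ≡ #OV m us vs) (C * (1 + d + ⌊log₂ n ⌋) ^ 3 * n * w ^ blocks d)) →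
  #OV-SolvableInÕ[n· b ^[ e ·d]] m
solvable-from {m} b e A w blocks convert (p , C , run) = p , C * A , 3 , go
  where
  arrange : ∀ C S n A → C * S * n * A ≡ C * A * S * n
  arrange = solve-∀
  go : ∀ n d .{{_ : NonZero n}} (us vs : Vec (Vec (Fin m) d) n) → Σ State λ s → Σ ℕ λ t →
    (p , input us vs ⇓ s , t) × reg s 0 ≡ #OV m us vs × t ≤ (C * A * (1 + d + ⌊log₂ n ⌋) ^ 3 * n) · b ^ʳ (e ℚ.* fromℕ d)
  go n d us vs with run us vs
  ... | s , t , steps , q , l = s , t , steps , q ,
    subst (λ c → t ≤ c · b ^ʳ (e ℚ.* fromℕ d)) (arrange C ((1 + d + ⌊log₂ n ⌋) ^ 3) n A)
      (convert (C * (1 + d + ⌊log₂ n ⌋) ^ 3 * n) d l)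

module Solve (m : ℕ) .{{_ : NonZero m}} (s : ℕ) (few : ∀ u → length (Blocks.disagreeing m u) ≤ s) (k : ℕ) (1≤k : 1 ≤ k) where
  open Assemble m s few k

  instance
    width-nonZero : NonZero width
    width-nonZero = >-nonZero width≥1
    κ-nonZero : NonZero (k * 6)
    κ-nonZero = m*n≢0 k 6 {{>-nonZero 1≤k}}

  κ : ℕ
  κ = k * 6

  blocks : ℕ → ℕ
  blocks d = (d + (κ ∸ 1)) / κ

  power-κ : ∀ x → (x ^ 6) ^ k ≡ x ^ κ
  power-κ x = trans (^-*-assoc x 6 k) (cong (x ^_) (*-comm 6 k))

  solvable : ∀ b e (A : ℕ) →
    (∀ {t} c d → t ≤ c * width ^ blocks d → t ≤ (c * A) · b ^ʳ (e ℚ.* fromℕ d)) →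
    #OV-SolvableInÕ[n· b ^[ e ·d]] m
  solvable b e A convert = solvable-from b e A width blocks convert (Machine.solver table)

  solvable-base : ∀ a b .{{_ : NonZero b}} → width ^ 1 * (suc a ^ 6) ^ k ≤ (b ^ 6) ^ k →
    #OV-SolvableInÕ[n· mkℚᵘ (+ b) a ^[ 1ℚᵘ ·d]] m
  solvable-base a b h = solvable (mkℚᵘ (+ b) a) 1ℚᵘ (b ^ κ) λ {t} c d l →
    ʳ-intro {b = mkℚᵘ (+ b) a} {1ℚᵘ ℚ.* fromℕ d} {d} (ℤ.*-identityˡ (+ d)) (begin
      t ^ 1 * suc a ^ d                          ≡⟨ cong (_* suc a ^ d) (^-identityʳ t) ⟩
      t * suc a ^ d                              ≤⟨ *-monoˡ-≤ (suc a ^ d) l ⟩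
      c * width ^ blocks d * suc a ^ d           ≡⟨ *-assoc c _ _ ⟩
      c * (width ^ blocks d * suc a ^ d)         ≤⟨ *-monoʳ-≤ c (rounded width (suc a) b κ d rate-κ) ⟩
      c * (b ^ κ * b ^ d)                        ≡⟨ sym (*-assoc c _ _) ⟩
      c * b ^ κ * b ^ d                          ≡⟨ cong (_* b ^ d) (sym (^-identityʳ (c * b ^ κ))) ⟩
      (c * b ^ κ) ^ 1 * b ^ d                    ∎)
    where
    open ≤-Reasoning
    rate-κ : width * suc a ^ κ ≤ b ^ κ
    rate-κ = subst₂ _≤_ (cong₂ _*_ (^-identityʳ width) (power-κ (suc a))) (power-κ b) h

  -- Equals F / (2 (F + 2)); the unnormalised numerator is F itself, which makes the comparison of
  -- powers explicit.
  exponent : ℕ → ℚᵘ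
  exponent F = ½ ℚ.- mkℚᵘ (+ 1) (suc F)

  exponent-↥ : ∀ F d → ↥ (exponent F ℚ.* fromℕ d) ≡ + (F * d)
  exponent-↥ F d = trans (cong (ℤ._* + d) (trans (cong (ℤ._+ -[1+ 1 ]) (ℤ.*-identityˡ (+ (2 + F)))) refl)) (sym (ℤ.pos-* F d))

  solvable-exponent : ∀ F → width ^ (2 * (2 + F) * 1) * 1 ^ k ≤ (m ^ (6 * F)) ^ k →
    #OV-SolvableInÕ[n· fromℕ m ^[ exponent F ·d]] m
  solvable-exponent F h = solvable (fromℕ m) (exponent F) (m ^ κ) λ {t} c d l →
    ʳ-intro {b = fromℕ m} {exponent F ℚ.* fromℕ d} {F * d} (exponent-↥ F d) (begin
      t ^ E * 1 ^ (F * d)                        ≡⟨ trans (cong (t ^ E *_) (^-zeroˡ (F * d))) (*-identityʳ (t ^ E)) ⟩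
      t ^ E                                      ≤⟨ ^-monoˡ-≤ E l ⟩
      (c * width ^ blocks d) ^ E                 ≡⟨ *-^ c (width ^ blocks d) E ⟩
      c ^ E * (width ^ blocks d) ^ E             ≡⟨ cong (c ^ E *_) (swap-^ width (blocks d) E) ⟩
      c ^ E * (width ^ E) ^ blocks d             ≤⟨ *-monoʳ-≤ (c ^ E) (bound d) ⟩
      c ^ E * ((m ^ κ) ^ E * m ^ (F * d))        ≡⟨ sym (*-assoc (c ^ E) _ _) ⟩
      c ^ E * (m ^ κ) ^ E * m ^ (F * d)          ≡⟨ cong (_* m ^ (F * d)) (sym (*-^ c (m ^ κ) E)) ⟩
      (c * m ^ κ) ^ E * m ^ (F * d)              ∎)
    where
    open ≤-Reasoning
    -- The denominator exactly as the unnormalised product with `fromℕ d` leaves it, trailing 1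
    -- included.
    E : ℕ
    E = 2 * (2 + F) * 1
    F≤E : F ≤ E
    F≤E = ≤-trans (m≤n+m F 2) (≤-trans (m≤m+n (2 + F) (2 + F + 0)) (≤-reflexive (sym (*-identityʳ (2 * (2 + F))))))
    rate-κ : width ^ E * 1 ^ κ ≤ (m ^ F) ^ κ
    rate-κ = subst₂ _≤_ (cong (width ^ E *_) (trans (^-zeroˡ k) (sym (^-zeroˡ κ))))
      (trans (cong (_^ k) (trans (cong (m ^_) (*-comm 6 F)) (sym (^-*-assoc m F 6)))) (power-κ (m ^ F))) h
    instance
      m^F-nonZero : NonZero (m ^ F)
      m^F-nonZero = m^n≢0 m F
    bound : ∀ d → (width ^ E) ^ blocks d ≤ (m ^ κ) ^ E * m ^ (F * d)
    bound d = begin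
      (width ^ E) ^ blocks d                ≡⟨ sym (trans (cong ((width ^ E) ^ blocks d *_) (^-zeroˡ d)) (*-identityʳ _)) ⟩
      (width ^ E) ^ blocks d * 1 ^ d        ≤⟨ rounded (width ^ E) 1 (m ^ F) κ d rate-κ ⟩
      (m ^ F) ^ κ * (m ^ F) ^ d             ≡⟨ cong₂ _*_ (swap-^ m F κ) (^-*-assoc m F d) ⟩
      (m ^ κ) ^ F * m ^ (F * d)             ≤⟨ *-monoˡ-≤ (m ^ (F * d)) (^-monoʳ-≤ (m ^ κ) {{m^n≢0 m κ}} F≤E) ⟩
      (m ^ κ) ^ E * m ^ (F * d)             ∎

solvable-rational : ∀ m .{{_ : NonZero m}} s (few : ∀ u → length (Blocks.disagreeing m u) ≤ s) u μ a b .{{_ : NonZero b}} →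
  1 ≤ u → s * (u * u) ≤ μ * μ → u ≤ μ → (μ + u) ^ 1 * suc a ^ 6 < u ^ 1 * b ^ 6 →
  #OV-SolvableInÕ[n· mkℚᵘ (+ b) a ^[ 1ℚᵘ ·d]] m
solvable-rational m s few u μ a b 1≤u s≤ u≤μ x<y =
  from (sparse m s few u μ 1 (suc a ^ 6) (b ^ 6) 1≤u (m^n>0 (suc a) 6) s≤ u≤μ x<y)
  where
  from : (Σ ℕ λ k → 1 ≤ k × Assemble.width m s few k ^ 1 * (suc a ^ 6) ^ k ≤ (b ^ 6) ^ k) →
    #OV-SolvableInÕ[n· mkℚᵘ (+ b) a ^[ 1ℚᵘ ·d]] m
  from (k , 1≤k , h) = Solve.solvable-base m s few k 1≤k a b h

solvable-2 : #OV-SolvableInÕ[n· (+ 136 ℚ./ 100) ^[ 1ℚᵘ ·d]] 2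
-- 5.3² = 28.09 ≥ 28, and 1 + 5.3 = 6.3 is below 1.36⁶ = 6.327...; the argument 99 is the
-- denominator 100 less one.
solvable-2 = solvable-rational 2 28 disagreeing-2 10 53 99 136 (s≤s z≤n)
  (≤ᵇ⇒≤ (28 * (10 * 10)) (53 * 53) _) (≤ᵇ⇒≤ 10 53 _) (<ᵇ⇒< ((53 + 10) ^ 1 * 100 ^ 6) (10 ^ 1 * 136 ^ 6) _)

-- The saving for general m

2^⌊log₂⌋> : ∀ m → 2 ≤ m → m ≤ 2 ^ (2 * ⌊log₂ m ⌋)
2^⌊log₂⌋> m 2≤m = ≤-trans (<⇒≤ (<2^size m)) (^-monoʳ-≤ 2 (+-mono-≤ 1≤ℓ (m≤m+n ⌊log₂ m ⌋ 0)))
  where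
  1≤ℓ : 1 ≤ ⌊log₂ m ⌋
  1≤ℓ = ⌊log₂⌋-mono-≤ {2} 2≤m

-- Bernoulli at v + 1 gives (1 + 1/v)^(v+1) ≥ 2 + 1/v. Read backwards, v + 1 factors 1 - 1/(v + 1)
-- halve a quantity.
doubling : ∀ v .{{_ : NonZero v}} → 2 * v ^ suc v ≤ suc v ^ suc v
doubling v = *-cancelʳ-≤ _ _ v (begin
  2 * v ^ suc v * v               ≤⟨ m≤m+n _ (v ^ suc v) ⟩
  2 * v ^ suc v * v + v ^ suc v   ≡⟨ arrange v (v ^ suc v) ⟩
  v ^ suc v * (v + suc v)         ≤⟨ bernoulli v (suc v) ⟩
  v * suc v ^ suc v               ≡⟨ *-comm v _ ⟩
  suc v ^ suc v * v               ∎)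
  where
  open ≤-Reasoning
  arrange : ∀ v p → 2 * p * v + p ≡ p * (v + suc v)
  arrange = solve-∀

-- (1 − 1/u)^(24 u ℓ) ≤ 2^(− 24 ℓ) ≤ m^(− 12).
absorbs : ∀ m v → 2 ≤ m → 1 ≤ v → m ^ 12 * v ^ (24 * (suc v * ⌊log₂ m ⌋) + 2) < suc v ^ (24 * (suc v * ⌊log₂ m ⌋) + 2)
absorbs m v 2≤m 1≤v = begin-strict
  m ^ 12 * v ^ (24 * (u * ℓ) + 2)            ≡⟨ cong (m ^ 12 *_) (split v) ⟩
  m ^ 12 * ((v ^ u) ^ (24 * ℓ) * v ^ 2)      ≡⟨ sym (*-assoc (m ^ 12) _ _) ⟩
  m ^ 12 * (v ^ u) ^ (24 * ℓ) * v ^ 2        ≤⟨ *-monoˡ-≤ (v ^ 2) (*-monoˡ-≤ ((v ^ u) ^ (24 * ℓ)) m^12≤) ⟩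
  2 ^ (24 * ℓ) * (v ^ u) ^ (24 * ℓ) * v ^ 2  ≡⟨ cong (_* v ^ 2) (sym (*-^ 2 (v ^ u) (24 * ℓ))) ⟩
  (2 * v ^ u) ^ (24 * ℓ) * v ^ 2             ≤⟨ *-monoˡ-≤ (v ^ 2) (^-monoˡ-≤ (24 * ℓ) (doubling v {{>-nonZero 1≤v}})) ⟩
  -- The surplus 2 in the exponent makes the inequality strict, as `growth` demands.
  (u ^ u) ^ (24 * ℓ) * v ^ 2                 <⟨ *-monoʳ-< ((u ^ u) ^ (24 * ℓ)) {{m^n≢0 (u ^ u) (24 * ℓ) {{m^n≢0 u u}}}} v²<u² ⟩
  (u ^ u) ^ (24 * ℓ) * u ^ 2                 ≡⟨ sym (split u) ⟩
  u ^ (24 * (u * ℓ) + 2)                     ∎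
  where
  open ≤-Reasoning
  u ℓ : ℕ
  u = suc v
  ℓ = ⌊log₂ m ⌋
  arrange : ∀ u ℓ → 24 * (u * ℓ) ≡ u * (24 * ℓ)
  arrange = solve-∀
  split : ∀ x → x ^ (24 * (u * ℓ) + 2) ≡ (x ^ u) ^ (24 * ℓ) * x ^ 2
  split x = trans (^-distribˡ-+-* x (24 * (u * ℓ)) 2) (cong (_* x ^ 2) (trans (cong (x ^_) (arrange u ℓ)) (sym (^-*-assoc x u (24 * ℓ)))))
  m^12≤ : m ^ 12 ≤ 2 ^ (24 * ℓ)
  m^12≤ = ≤-trans (^-monoˡ-≤ 12 (2^⌊log₂⌋> m 2≤m)) (≤-reflexive (trans (^-*-assoc 2 (2 * ℓ) 12) (cong (2 ^_) (arrange₂ ℓ))))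
    where
    arrange₂ : ∀ ℓ → 2 * ℓ * 12 ≡ 24 * ℓ
    arrange₂ = solve-∀
  v²<u² : v ^ 2 < u ^ 2
  v²<u² = ≤-trans (s≤s (m≤m+n (v ^ 2) (2 * v))) (≤-reflexive (arrange₃ v))
    where
    arrange₃ : ∀ v → suc (v * (v * 1) + 2 * v) ≡ suc v * (suc v * 1)
    arrange₃ = solve-∀

-- A block of six coordinates costs m³ (1 − 1/u) instead of m³, with u = 30 m².
module Saving (m : ℕ) .{{_ : NonZero m}} (2≤m : 2 ≤ m) where

  s v h w μ : ℕ
  s = m ^ 6 ∸ m ^ 4
  v = 30 * (m * m) ∸ 1
  -- Chosen so that μ/u = m³ - 1 - m/30, whence 1 + μ/u is exactly m³ (1 - 1/u). It must be at least
  -- √s, which is about m³ - m/2.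
  h = m + 30
  w = 30 * (m * m * m) ∸ h
  μ = m * m * w

  few : ∀ u → length (Blocks.disagreeing m u) ≤ s
  few u = m+n≤o⇒m≤o∸n _ (disagreeing-bound m u)

  4≤m² : 4 ≤ m * m
  4≤m² = *-mono-≤ 2≤m 2≤m

  8≤m³ : 8 ≤ m * m * m
  8≤m³ = *-mono-≤ 4≤m² 2≤m

  u≡ : suc v ≡ 30 * (m * m)
  u≡ = m+[n∸m]≡n (≤-trans (≤ᵇ⇒≤ 1 120 _) (*-monoʳ-≤ 30 4≤m²))

  w≥30 : 30 + h ≤ 30 * (m * m * m)
  w≥30 = ≤-trans (≤-trans (≤-reflexive (arrange m)) (+-mono-≤ (m≤m*n m (m * m) {{>-nonZero (≤-trans (s≤s z≤n) 4≤m²)}}) (≤-trans (≤ᵇ⇒≤ 60 232 _) (*-monoʳ-≤ 29 8≤m³))))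
    (≤-reflexive (arrange₂ m))
    where
    arrange : ∀ m → 30 + (m + 30) ≡ m + 60
    arrange = solve-∀
    arrange₂ : ∀ m → m * (m * m) + 29 * (m * m * m) ≡ 30 * (m * m * m)
    arrange₂ = solve-∀

  w+h≡ : w + h ≡ 30 * (m * m * m)
  w+h≡ = m∸n+n≡m (≤-trans (m≤n+m h 30) w≥30)

  30≤w : 30 ≤ w
  30≤w = m+n≤o⇒m≤o∸n 30 w≥30

  u≤μ : suc v ≤ μ
  u≤μ = ≤-trans (≤-reflexive (trans u≡ (*-comm 30 (m * m)))) (*-monoʳ-≤ (m * m) 30≤w)

  μ+u≡ : μ + suc v ≡ m ^ 3 * v
  μ+u≡ = +-cancelʳ-≡ (m ^ 3) _ _ (begin
    m * m * w + suc v + m ^ 3               ≡⟨ cong (λ u → m * m * w + u + m ^ 3) u≡ ⟩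
    m * m * w + 30 * (m * m) + m ^ 3        ≡⟨ arrange m w ⟩
    m * m * (w + (m + 30))                  ≡⟨ cong (m * m *_) w+h≡ ⟩
    m * m * (30 * (m * m * m))              ≡⟨ arrange₂ m ⟩
    m ^ 3 * (30 * (m * m))                  ≡⟨ cong (m ^ 3 *_) (sym u≡) ⟩
    m ^ 3 * suc v                           ≡⟨ trans (*-suc (m ^ 3) v) (+-comm (m ^ 3) _) ⟩
    m ^ 3 * v + m ^ 3                       ∎)
    where
    open ≡-Reasoning
    arrange : ∀ m w → m * m * w + 30 * (m * m) + m * (m * (m * 1)) ≡ m * m * (w + (m + 30))
    arrange = solve-∀
    arrange₂ : ∀ m → m * m * (30 * (m * m * m)) ≡ m * (m * (m * 1)) * (30 * (m * m))
    arrange₂ = solve-∀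

  -- The smallest case m = 2 needs the term h².
  slack : 1800 * (m * m * m) ≤ 840 * m * (m * m * m) + h * h
  slack with m ≟ 2
  ... | yes m≡2 = subst (λ m → 1800 * (m * m * m) ≤ 840 * m * (m * m * m) + (m + 30) * (m + 30)) (sym m≡2) (≤ᵇ⇒≤ 14400 14464 _)
  ... | no  m≢2  = ≤-trans (*-monoˡ-≤ (m * m * m) (≤-trans (≤ᵇ⇒≤ 1800 2520 _) (*-monoʳ-≤ 840 (≤∧≢⇒< 2≤m λ e → m≢2 (sym e)))))
    (m≤m+n _ (h * h))

  -- Write C = 30 m³ = w + h. Divided by m⁴, the inequality s u² ≤ μ² reads C² - 900 m⁴ ≤ (C - h)²,
  -- and expanding the square leaves this.
  gap : ∀ c → c * h ≡ 30 * (m * m * m) * h → 2 * (c * h) ≤ 900 * (m * m * m * m) + h * h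
  gap c e = begin
    2 * (c * h)                                              ≡⟨ cong (2 *_) e ⟩
    2 * (30 * (m * m * m) * (m + 30))                        ≡⟨ arrange (m * m * m) m ⟩
    60 * (m * m * m * m) + 1800 * (m * m * m)                ≤⟨ +-monoʳ-≤ (60 * (m * m * m * m)) slack ⟩
    60 * (m * m * m * m) + (840 * m * (m * m * m) + h * h)   ≡⟨ arrange₂ (m * m * m) m (h * h) ⟩
    900 * (m * m * m * m) + h * h                            ∎
    where
    open ≤-Reasoning
    arrange : ∀ q m → 2 * (30 * q * (m + 30)) ≡ 60 * (q * m) + 1800 * q
    arrange q m = trans (distrib q m 30) (cong (λ e → 60 * (q * m) + e) (sym (*-assoc 60 30 q)))
      where
      distrib : ∀ q m c → 2 * (30 * q * (m + c)) ≡ 60 * (q * m) + 60 * (c * q)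
      distrib = solve-∀
    arrange₂ : ∀ q m x → 60 * (q * m) + (840 * m * q + x) ≡ 900 * (q * m) + x
    arrange₂ q m x = trans (sym (+-assoc (60 * (q * m)) _ x)) (cong (_+ x)
      (trans (cong (λ e → 60 * (q * m) + e) (trans (*-assoc 840 m q) (cong (840 *_) (*-comm m q)))) (sym (*-distribʳ-+ (q * m) 60 840))))

  s≤ : s * (suc v * suc v) ≤ μ * μ
  -- The added terms complete s to m⁶ and w to w + h, so that no truncated subtraction has to be
  -- expanded.
  s≤ = +-cancelʳ-≤ (m ^ 4 * (suc v * suc v) + m ^ 4 * (h * h)) _ _ (begin
    s * U² + (m ^ 4 * U² + m ^ 4 * (h * h))                ≡⟨ sym (+-assoc (s * U²) _ _) ⟩
    s * U² + m ^ 4 * U² + m ^ 4 * (h * h)                  ≡⟨ cong (_+ m ^ 4 * (h * h)) (sym (*-distribʳ-+ U² s (m ^ 4))) ⟩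
    (s + m ^ 4) * U² + m ^ 4 * (h * h)                     ≡⟨ cong₂ (λ x u → x * (u * u) + m ^ 4 * (h * h)) (m∸n+n≡m (^-monoʳ-≤ m (≤ᵇ⇒≤ 4 6 _))) u≡ ⟩
    m ^ 6 * (30 * (m * m) * (30 * (m * m))) + m ^ 4 * (h * h) ≡⟨ arrange m h ⟩
    m ^ 4 * (30 * (m * m * m) * (30 * (m * m * m)) + h * h) ≡⟨ cong (λ c → m ^ 4 * (c * c + h * h)) (sym w+h≡) ⟩
    m ^ 4 * ((w + h) * (w + h) + h * h)                    ≡⟨ arrange₂ m w h ⟩
    m * m * w * (m * m * w) + m ^ 4 * (2 * ((w + h) * h))  ≤⟨ +-monoʳ-≤ (μ * μ) (*-monoʳ-≤ (m ^ 4) (gap (w + h) (cong (_* h) w+h≡))) ⟩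
    μ * μ + m ^ 4 * (900 * (m * m * m * m) + h * h)        ≡⟨ cong (λ e → μ * μ + e) (trans (*-distribˡ-+ (m ^ 4) _ (h * h)) (cong (λ u → m ^ 4 * u + m ^ 4 * (h * h)) square)) ⟩
    μ * μ + (m ^ 4 * U² + m ^ 4 * (h * h))                 ∎)
    where
    open ≤-Reasoning
    U² : ℕ
    U² = suc v * suc v
    square : 900 * (m * m * m * m) ≡ U²
    square = trans (arrange₃ m 30) (cong₂ _*_ (sym u≡) (sym u≡))
      where
      arrange₃ : ∀ m c → c * c * (m * m * m * m) ≡ c * (m * m) * (c * (m * m))
      arrange₃ = solve-∀
    arrange : ∀ m h → m * (m * (m * (m * (m * (m * 1))))) * (30 * (m * m) * (30 * (m * m))) + m * (m * (m * (m * 1))) * (h * h)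
      ≡ m * (m * (m * (m * 1))) * (30 * (m * m * m) * (30 * (m * m * m)) + h * h)
    arrange m h = general m h 30
      where
      general : ∀ m h c → m * (m * (m * (m * (m * (m * 1))))) * (c * (m * m) * (c * (m * m))) + m * (m * (m * (m * 1))) * (h * h)
        ≡ m * (m * (m * (m * 1))) * (c * (m * m * m) * (c * (m * m * m)) + h * h)
      general = solve-∀
    arrange₂ : ∀ m w h → m * (m * (m * (m * 1))) * ((w + h) * (w + h) + h * h)
      ≡ m * m * w * (m * m * w) + m * (m * (m * (m * 1))) * (2 * ((w + h) * h))
    arrange₂ = solve-∀

  1≤v : 1 ≤ v
  1≤v = ≤-pred (≤-trans (≤-trans (≤ᵇ⇒≤ 2 120 _) (*-monoʳ-≤ 30 4≤m²)) (≤-reflexive (sym u≡)))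

  ℓ period F E : ℕ
  ℓ = ⌊log₂ m ⌋
  -- As u = 30 m² and 2 · 360 = 24 · 30, the denominator E = 2 (period + 1) becomes 24 u ℓ + 2, the
  -- exponent treated by `absorbs`.
  period = 360 * (m ^ 2 * ℓ)
  F = period ∸ 1
  E = 2 * (2 + F) * 1

  1≤m²ℓ : 1 ≤ m ^ 2 * ℓ
  1≤m²ℓ = *-mono-≤ (m^n>0 m 2) (⌊log₂⌋-mono-≤ {2} 2≤m)

  period≡ : suc F ≡ period
  period≡ = m+[n∸m]≡n (≤-trans 1≤m²ℓ (m≤m+n (m ^ 2 * ℓ) (359 * (m ^ 2 * ℓ))))

  E≡ : E ≡ 24 * (suc v * ℓ) + 2
  E≡ = begin
    2 * suc (suc F) * 1              ≡⟨ cong (λ p → 2 * suc p * 1) period≡ ⟩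
    2 * suc (360 * (m ^ 2 * ℓ)) * 1  ≡⟨ arrange 360 (m ^ 2 * ℓ) ⟩
    2 * 360 * (m ^ 2 * ℓ) + 2        ≡⟨ cong (λ e → e + 2) (trans (*-assoc 24 30 (m ^ 2 * ℓ)) (cong (24 *_) (arrange₂ 30 m ℓ))) ⟩
    24 * (30 * (m * m) * ℓ) + 2      ≡⟨ cong (λ u → 24 * (u * ℓ) + 2) (sym u≡) ⟩
    24 * (suc v * ℓ) + 2             ∎
    where
    open ≡-Reasoning
    arrange : ∀ c x → 2 * suc (c * x) * 1 ≡ 2 * c * x + 2
    arrange = solve-∀
    arrange₂ : ∀ c m ℓ → c * (m * (m * 1) * ℓ) ≡ c * (m * m) * ℓ
    arrange₂ = solve-∀

  -- Since 3 E = 6 F + 12, lowering the exponent from 1/2 by 1/(F + 2) requires a gain of m¹² in the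
  -- E-th power of the cost of a block. The factor (1 - 1/u)^E provides it.
  base< : (μ + suc v) ^ E * 1 < suc v ^ E * m ^ (6 * F)
  base< = begin-strict
    (μ + suc v) ^ E * 1             ≡⟨ trans (*-identityʳ _) (trans (cong (_^ E) μ+u≡) (*-^ (m ^ 3) v E)) ⟩
    (m ^ 3) ^ E * v ^ E             ≡⟨ cong (_* v ^ E) (trans (^-*-assoc m 3 E) (trans (cong (m ^_) (arrange F)) (^-distribˡ-+-* m (6 * F) 12))) ⟩
    m ^ (6 * F) * m ^ 12 * v ^ E    ≡⟨ *-assoc (m ^ (6 * F)) _ _ ⟩
    m ^ (6 * F) * (m ^ 12 * v ^ E)  <⟨ *-monoʳ-< (m ^ (6 * F)) {{m^n≢0 m (6 * F)}} (subst (λ e → m ^ 12 * v ^ e < suc v ^ e) (sym E≡) (absorbs m v 2≤m 1≤v)) ⟩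
    m ^ (6 * F) * suc v ^ E         ≡⟨ *-comm (m ^ (6 * F)) _ ⟩
    suc v ^ E * m ^ (6 * F)         ∎
    where
    open ≤-Reasoning
    arrange : ∀ F → 3 * (2 * (2 + F) * 1) ≡ 6 * F + 12
    arrange = solve-∀

  solvable : #OV-SolvableInÕ[n· fromℕ m ^[ ½ ℚ.- mkℚᵘ (+ 1) period ·d]] m
  solvable = subst (λ p → #OV-SolvableInÕ[n· fromℕ m ^[ ½ ℚ.- mkℚᵘ (+ 1) p ·d]] m) period≡
    (from (sparse m s few (suc v) μ E 1 (m ^ (6 * F)) (s≤s z≤n) ≤-refl s≤ u≤μ base<))
    where
    from : (Σ ℕ λ k → 1 ≤ k × Assemble.width m s few k ^ E * 1 ^ k ≤ (m ^ (6 * F)) ^ k) →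
      #OV-SolvableInÕ[n· fromℕ m ^[ ½ ℚ.- mkℚᵘ (+ 1) (suc F) ·d]] m
    from (k , 1≤k , g) = Solve.solvable-exponent m s few k 1≤k F g

theorem1p4 : #OV-SolvableInÕ[n· (+ 136 ℚ./ 100) ^[ 1ℚᵘ ·d]] 2
    × Σ (ℕ → ℚᵘ) λ a →
    (∀ m → 2 ≤ m → 0ℚᵘ ℚ.< a m)
    × IsΩ[1/m²logm] a
    × (∀ m → 2 ≤ m → #OV-SolvableInÕ[n· fromℕ m ^[ ½ ℚ.- a m ·d]] m)
theorem1p4 = solvable-2 , a , (λ m _ → ℚ.*<* (ℤ.+<+ (s≤s z≤n)))
  -- The constant is 1/361: with M = m² ⌊log₂ m⌋ the product in question is M / (360 M + 1), and M ≥
  -- 1.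
  , (mkℚᵘ (+ 1) 360 , ℚ.*<* (ℤ.+<+ (s≤s z≤n)) , a-bound)
  , λ m 2≤m → Saving.solvable m {{>-nonZero (≤-trans (s≤s z≤n) 2≤m)}} 2≤m
  where
  a : ℕ → ℚᵘ
  a m = mkℚᵘ (+ 1) (360 * (m ^ 2 * ⌊log₂ m ⌋))
  a-bound : ∀ m → 2 ≤ m → mkℚᵘ (+ 1) 360 ℚ.≤ a m ℚ.* fromℕ (m ^ 2 * ⌊log₂ m ⌋)
  a-bound m 2≤m = ratio (m ^ 2 * ⌊log₂ m ⌋) (Saving.1≤m²ℓ m {{>-nonZero (≤-trans (s≤s z≤n) 2≤m)}} 2≤m)
    where
    ratio : ∀ M → 1 ≤ M → mkℚᵘ (+ 1) 360 ℚ.≤ mkℚᵘ (+ 1) (360 * M) ℚ.* fromℕ M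
    ratio M 1≤M = ℚ.*≤* (subst₂ ℤ._≤_ (sym (ℤ.*-identityˡ _))
      (trans (ℤ.pos-* M 361) (cong (ℤ._* + 361) (sym (ℤ.*-identityˡ (+ M)))))
      (ℤ.+≤+ (≤-trans (≤-reflexive (*-identityʳ (suc (360 * M)))) (≤-trans (+-monoˡ-≤ (360 * M) 1≤M) (≤-reflexive (*-comm 361 M))))))
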